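{- Let $\Upsilon$ be a gain signed graph and $S\subseteq E$. Then $M(\Upsilon\setminus S)=M(\Upsilon)\setminus S$ and $M(\Upsilon/S)=M(\Upsilon)/S$, where on the right the operations are matroid deletion and contraction.
   Context: Let $\mathbb{K}$ be a field of characteristic $\ne2$. A graph $\Gamma=(V,E)$ has vertex set $V=\{v_1,\dots,v_n\}$ and finite edge set $E$; edges are links (two ends at distinct vertices), loops (two ends at one vertex), half edges (one end) or loose edges (no ends); parallel edges allowed. A gain signed graph $\Upsilon=(\Gamma,\sigma,\varphi)$: $\sigma:E\to\{\pm1\}$ (half edges negative, loose edges positive); with an orientation $\tau$ (signs $\tau(v,e)\in\{\pm1\}$ on edge ends, $\tau(v,e)\tau(w,e)=-\sigma(e)$ for a link or loop with ends $v,w$) each edge has gain $\varphi(e)\in\mathbb{K}$, negated on reorientation. Neutral = gain $0$. Walk gain of $W=u_0e_1\cdots e_lu_l$: $\varphi(W)=-\sum_i\varphi(e_i)\sigma(W_{0,i-1})\tau(u_{i-1},e_i)$, $\sigma(W_{0,j})=\prod_{i\le j}\sigma(e_i)$. Ultrawalks may begin with a half edge $e_0$ at $u_0$ and/or end with a half edge $e_{l+1}$ at $u_l$; their gain adds $\tau(u_0,e_0)\varphi(e_0)$ and/or $-\varphi(e_{l+1})\sigma(W_{0,l})\tau(u_l,e_{l+1})$ to $\varphi(W_{0,l})$. Circles: connected 2-regular subgraphs, sign = product of edge signs; a negative figure is a negative circle or a half edge. A sign circuit is a positive circle, a loose edge, or a handcuff (two negative figures with exactly one common vertex, or two disjoint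 negative figures plus a path joining them meeting them only at its ends). Its gain: the edge gain for a loose edge; else $\varphi(W)$ for a circuit walk (once around a positive circle; for a handcuff with figures $C_1,C_2$, connecting path $P$ of length $\ge0$: around $C_1$, along $P$, around $C_2$, back along $P$ if both circles; from half edge $C_1$ along $P$, around $C_2$, back, ending with $C_1$ if $C_1$ half edge and $C_2$ circle; from one half edge along $P$ to the other if both half edges); well defined up to sign; neutral if $0$. $S$ is hyperbalanced if all sign circuits in $S$ are neutral, hyperfrustrated otherwise; sign balanced if no negative circle and no half edge. $b_\Sigma(S)$ = number of sign-balanced connected components of $(V,S)$ (loose edges excluded); $\pi_b(S)$ = their vertex sets. $M(\Upsilon)$: the matroid on $E$ with rank $|V|-b_\Sigma(S)+\delta(S)$, $\delta=0$ if $S$ hyperbalanced and $1$ otherwise (for a gain signed graph on any vertex set). Switching: sign switcher $\zeta:V\to\{\pm1\}$ changes $\sigma(e)$ to $\zeta(v)\sigma(e)\zeta(w)$ for a link/loop with ends $v,w$ and $\tau(v,e)$ to $\zeta(v)\tau(v,e)$; gain switcher $\theta:V\to\mathbb{K}$ changes $\varphi(e)$ to $\tau(v,e)\theta(v)+\varphi(e)+\tau(w,e)\theta(w)$ (link/loop), $\tau(v,e)\theta(v)+\varphi(e)$ (half edge at $v$), loose edges unchanged. Deletion $\Upsilon\setminus S$: restriction to $E\setminus S$ on the same vertices. Contraction: for $v\in V$ let $B_v$ be the block of $\pi_b(S)$ containing $v$, if any. The signed contraction $\Sigma/S$: switch signs so all edges of sign-balanced components of $S$ are positive; vertex set $\pi_b(S)$,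 edge set $E\setminus S$; a link or loop with ends $v,w$ gets ends at those of $B_v,B_w$ that exist, keeping its switched sign if both exist, becoming a negative half edge if exactly one exists and a positive loose edge if none; a half edge at $v$ becomes a half edge at $B_v$ if it exists, else a loose edge; loose edges stay loose; surviving ends keep their switched orientation. If $S$ is hyperbalanced, $\Upsilon/S$ is formed by first gain-switching so every edge of $S$ is neutral, then forming $\Sigma/S$ with edges of $E\setminus S$ keeping their switched gains. If $S$ is hyperfrustrated, $\Upsilon/S$ is $\Sigma/S$ with all gains $0$. -}

module Defs where

open import Level using (Level; _⊔_) renaming (suc to lsuc)
open import Algebra.Bundles using (CommutativeRing)
open import Data.Nat using (ℕ) renaming (suc to ℕsuc; _+_ to _+ℕ_)
open import Data.Fin using (Fin)
open import Data.Fin.Subset using (Subset; _∈_; _∉_; _⊆_; _∩_; ∁)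
open import Data.Maybe using (Maybe; just; nothing)
open import Data.List using (List; []; _∷_; _++_; length)
open import Data.List.Membership.Propositional using () renaming (_∈_ to _∈ˡ_)
open import Data.List.Relation.Unary.All using (All)
open import Data.List.Relation.Unary.Unique.Propositional using (Unique)
open import Data.Product using (Σ; ∃; _×_; _,_)
open import Data.Sum using (_⊎_)
open import Relation.Nullary using (¬_)
open import Relation.Binary.PropositionalEquality using (_≡_)

record Field (c ℓ : Level) : Set (lsuc (c ⊔ ℓ)) where
  field
    commutativeRing : CommutativeRing c ℓ
  open CommutativeRing commutativeRing public
  field
    1≉0     : ¬ (1# ≈ 0#)
    inverse : ∀ x → ¬ (x ≈ 0#) → Σ Carrier (λ y → (x * y) ≈ 1#)

data Sign : Set where
  pos neg : Sign

_·_ : Sign → Sign → Sign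
pos · s = s
neg · pos = neg
neg · neg = pos

opp : Sign → Sign
opp pos = neg
opp neg = pos

_∖_ : ∀ {m} → Subset m → Subset m → Subset m
A ∖ B = A ∩ ∁ B

-- Edges of a graph with vertex set Fin n.
--   ends v w t₁ t₂ : a link (v ≢ w) or loop (v ≡ w) with first end at v
--                    carrying orientation sign t₁ = τ(v,e) and second end
--                    at w carrying t₂ = τ(w,e).  Its sign is determined by
--                    τ(v,e)τ(w,e) = -σ(e), i.e. σ(e) = -(t₁ t₂).
--   half v t       : a half edge at v with τ(v,e) = t (always negative).
--   loose          : a loose edge (always positive).

data Edge (n : ℕ) : Set where
  ends  : (v w : Fin n) (t₁ t₂ : Sign) → Edge n
  half  : (v : Fin n) (t : Sign) → Edge n
  loose : Edge n

edgeSign : ∀ {n} → Edge n → Sign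
edgeSign (ends v w t₁ t₂) = opp (t₁ · t₂)
edgeSign (half v t)       = neg
edgeSign loose            = pos

module GainSigned {c ℓ : Level} (K : Field c ℓ) where
  open Field K

  _⊙_ : Sign → Carrier → Carrier
  pos ⊙ x = x
  neg ⊙ x = - x

  -- A gain signed graph with vertex set Fin n and edge set E ⊆ Fin m
  -- (edge data at indices outside E is irrelevant).  The orientation τ
  -- is recorded in the edge data; the sign σ is edgeSign.
  record GSG (n m : ℕ) : Set c where
    field
      edgeSet : Subset m
      edge    : Fin m → Edge n
      gain    : Fin m → Carrier
  open GSG public

  σ : ∀ {n m} → GSG n m → Fin m → Sign
  σ Υ e = edgeSign (edge Υ e)

  module _ {n m : ℕ} (Υ : GSG n m) where

    data Arc : Fin n → Fin n → Set where
      fwd : (e : Fin m) {v w : Fin n} {t₁ t₂ : Sign} →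
            edge Υ e ≡ ends v w t₁ t₂ → Arc v w
      bwd : (e : Fin m) {v w : Fin n} {t₁ t₂ : Sign} →
            edge Υ e ≡ ends v w t₁ t₂ → Arc w v

    arcEdge : ∀ {u v} → Arc u v → Fin m
    arcEdge (fwd e _) = e
    arcEdge (bwd e _) = e

    arcTau : ∀ {u v} → Arc u v → Sign
    arcTau (fwd e {t₁ = t₁} _) = t₁
    arcTau (bwd e {t₂ = t₂} _) = t₂

    revArc : ∀ {u v} → Arc u v → Arc v u
    revArc (fwd e p) = bwd e p
    revArc (bwd e p) = fwd e p

    data Walk : Fin n → Fin n → Set where
      []  : ∀ {u} → Walk u u
      _∷_ : ∀ {u v w} → Arc u v → Walk v w → Walk u w

    _++ʷ_ : ∀ {u v w} → Walk u v → Walk v w → Walk u w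
    []      ++ʷ W = W
    (a ∷ V) ++ʷ W = a ∷ (V ++ʷ W)

    revWalk : ∀ {u v} → Walk u v → Walk v u
    revWalk []      = []
    revWalk (a ∷ W) = revWalk W ++ʷ (revArc a ∷ [])

    walkEdges : ∀ {u v} → Walk u v → List (Fin m)
    walkEdges []      = []
    walkEdges (a ∷ W) = arcEdge a ∷ walkEdges W

    departures : ∀ {u v} → Walk u v → List (Fin n)
    departures []               = []
    departures (_∷_ {u} a W)    = u ∷ departures W

    walkVerts : ∀ {u v} → Walk u v → List (Fin n)
    walkVerts {v = v} W = departures W ++ (v ∷ [])

    walkSign : ∀ {u v} → Walk u v → Sign
    walkSign []      = pos
    walkSign (a ∷ W) = σ Υ (arcEdge a) · walkSign W

    -- Σ_i φ(e_i) σ(W_{0,i-1}) τ(u_{i-1},e_i), with the running prefix sign s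
    gainSum : Sign → ∀ {u v} → Walk u v → Carrier
    gainSum s []      = 0#
    gainSum s (a ∷ W) =
      ((s · arcTau a) ⊙ gain Υ (arcEdge a)) + gainSum (s · σ Υ (arcEdge a)) W

    walkGain : ∀ {u v} → Walk u v → Carrier
    walkGain W = - gainSum pos W

    HalfAt : Fin n → Set
    HalfAt x = Σ (Fin m) (λ e → Σ Sign (λ t → edge Υ e ≡ half x t))

    halfEdge : ∀ {x} → HalfAt x → Fin m
    halfEdge (e , _) = e

    halfTau : ∀ {x} → HalfAt x → Sign
    halfTau (_ , t , _) = t

    -- ultrawalk gains: initial half edge e₀ at u₀ and/or final half edge
    -- e_{l+1} at u_l
    initTerm : ∀ {x} → HalfAt x → Carrier
    initTerm h = halfTau h ⊙ gain Υ (halfEdge h)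

    finalTerm : ∀ {u x} → Walk u x → HalfAt x → Carrier
    finalTerm W h = - ((walkSign W · halfTau h) ⊙ gain Υ (halfEdge h))

    -- circles: closed walks of positive length with no repeated edge and no
    -- repeated vertex (the edge set is a connected 2-regular subgraph)
    record IsCircle {x : Fin n} (C : Walk x x) : Set where
      field
        nonempty    : ¬ (walkEdges C ≡ [])
        edgesUnique : Unique (walkEdges C)
        vertsUnique : Unique (departures C)

    -- paths: walks with no repeated vertex (hence no repeated edge)
    IsPath : ∀ {u v} → Walk u v → Set
    IsPath W = Unique (walkVerts W)

    data Figure (x : Fin n) : Set where
      circ  : (C : Walk x x) → IsCircle C → walkSign C ≡ neg → Figure x
      halfE : HalfAt x → Figure x

    figEdges : ∀ {x} → Figure x → List (Fin m)
    figEdges (circ C _ _) = walkEdges C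
    figEdges (halfE h)    = halfEdge h ∷ []

    figVerts : ∀ {x} → Figure x → List (Fin n)
    figVerts (circ C _ _)  = departures C
    figVerts {x} (halfE h) = x ∷ []

    handcuffGain : ∀ {x₁ x₂} → Figure x₁ → Walk x₁ x₂ → Figure x₂ → Carrier
    handcuffGain (circ C₁ _ _) P (circ C₂ _ _) =
      walkGain (C₁ ++ʷ (P ++ʷ (C₂ ++ʷ revWalk P)))
    handcuffGain (halfE h₁) P (circ C₂ _ _) =
      let W = P ++ʷ (C₂ ++ʷ revWalk P) in
      (initTerm h₁ + walkGain W) + finalTerm W h₁
    handcuffGain (circ C₁ _ _) P (halfE h₂) =
      -- labelled so that the walk starts at the half edge
      let W = revWalk P ++ʷ (C₁ ++ʷ P) in
      (initTerm h₂ + walkGain W) + finalTerm W h₂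
    handcuffGain (halfE h₁) P (halfE h₂) =
      (initTerm h₁ + walkGain P) + finalTerm P h₂

    -- handcuffs: two negative figures joined by a path P (length ≥ 0)
    -- meeting them only at its ends; if P has length 0 the figures have
    -- exactly one common vertex, otherwise they are disjoint.
    record Handcuff : Set where
      field
        x₁ x₂  : Fin n
        F₁     : Figure x₁
        P      : Walk x₁ x₂
        F₂     : Figure x₂
        path   : IsPath P
        meet₁  : ∀ y → y ∈ˡ figVerts F₁ → y ∈ˡ walkVerts P → y ≡ x₁
        meet₂  : ∀ y → y ∈ˡ figVerts F₂ → y ∈ˡ walkVerts P → y ≡ x₂
        meet₁₂ : ∀ y → y ∈ˡ figVerts F₁ → y ∈ˡ figVerts F₂ → y ∈ˡ walkVerts P
        edgesDistinct : Unique (figEdges F₁ ++ (walkEdges P ++ figEdges F₂))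

    data SignCircuit : Set where
      posCircle : ∀ {x} (C : Walk x x) → IsCircle C → walkSign C ≡ pos →
                  SignCircuit
      looseEdge : (e : Fin m) → edge Υ e ≡ loose → SignCircuit
      handcuff  : Handcuff → SignCircuit

    circuitEdges : SignCircuit → List (Fin m)
    circuitEdges (posCircle C _ _) = walkEdges C
    circuitEdges (looseEdge e _)   = e ∷ []
    circuitEdges (handcuff H)      =
      figEdges (Handcuff.F₁ H) ++
        (walkEdges (Handcuff.P H) ++ figEdges (Handcuff.F₂ H))

    circuitGain : SignCircuit → Carrier
    circuitGain (posCircle C _ _) = walkGain C
    circuitGain (looseEdge e _)   = gain Υ e
    circuitGain (handcuff H)      =
      handcuffGain (Handcuff.F₁ H) (Handcuff.P H) (Handcuff.F₂ H)

    _⊆ˡ_ : List (Fin m) → Subset m → Set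
    L ⊆ˡ S = All (λ e → e ∈ S) L

    Hyperbalanced : Subset m → Set ℓ
    Hyperbalanced S =
      ∀ (C : SignCircuit) → circuitEdges C ⊆ˡ S → circuitGain C ≈ 0#

    Connected : Subset m → Fin n → Fin n → Set
    Connected S u v = Σ (Walk u v) (λ W → walkEdges W ⊆ˡ S)

    SignBalancedAt : Subset m → Fin n → Set
    SignBalancedAt S v =
      (∀ x (C : Walk x x) → IsCircle C → walkSign C ≡ neg →
         walkEdges C ⊆ˡ S → Connected S x v → ⊥′)
      × (∀ x (h : HalfAt x) → halfEdge h ∈ S → Connected S x v → ⊥′)
      where open import Data.Empty renaming (⊥ to ⊥′)

    -- π_b(S) labelled by Fin b: β v = just i iff the component of v is
    -- sign balanced, and then i names its vertex set (the block B_v).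
    record BalancedBlocks (S : Subset m) (b : ℕ) : Set where
      field
        β        : Fin n → Maybe (Fin b)
        unbal    : ∀ v → β v ≡ nothing → ¬ SignBalancedAt S v
        bal      : ∀ v i → β v ≡ just i → SignBalancedAt S v
        sameBlock : ∀ u v i j → β u ≡ just i → β v ≡ just j →
                    (i ≡ j → Connected S u v) × (Connected S u v → i ≡ j)
        onto     : ∀ i → ∃ (λ v → β v ≡ just i)

    -- the rank of S in M(Υ) is r:  r = |V| - b_Σ(S) + δ(S)
    HasRank : Subset m → ℕ → Set ℓ
    HasRank S r = Σ ℕ (λ b → BalancedBlocks S b ×
      ((Hyperbalanced S × r +ℕ b ≡ n) ⊎ (¬ Hyperbalanced S × r +ℕ b ≡ ℕsuc n)))

  _∖ᵍ_ : ∀ {n m} → GSG n m → Subset m → GSG n m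
  Υ ∖ᵍ S = record { edgeSet = edgeSet Υ ∖ S ; edge = edge Υ ; gain = gain Υ }

  signSwitchEdge : ∀ {n} → (Fin n → Sign) → Edge n → Edge n
  signSwitchEdge ζ (ends v w t₁ t₂) = ends v w (ζ v · t₁) (ζ w · t₂)
  signSwitchEdge ζ (half v t)       = half v (ζ v · t)
  signSwitchEdge ζ loose            = loose

  signSwitch : ∀ {n m} → (Fin n → Sign) → GSG n m → GSG n m
  signSwitch ζ Υ = record
    { edgeSet = edgeSet Υ ; edge = λ e → signSwitchEdge ζ (edge Υ e)
    ; gain = gain Υ }

  gainSwitchGain : ∀ {n} → (Fin n → Carrier) → Edge n → Carrier → Carrier
  gainSwitchGain θ (ends v w t₁ t₂) x = ((t₁ ⊙ θ v) + x) + (t₂ ⊙ θ w)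
  gainSwitchGain θ (half v t)       x = (t ⊙ θ v) + x
  gainSwitchGain θ loose            x = x

  gainSwitch : ∀ {n m} → (Fin n → Carrier) → GSG n m → GSG n m
  gainSwitch θ Υ = record
    { edgeSet = edgeSet Υ ; edge = edge Υ
    ; gain = λ e → gainSwitchGain θ (edge Υ e) (gain Υ e) }

  contractEdge : ∀ {n b} → (Fin n → Maybe (Fin b)) → Edge n → Edge b
  contractEdge β (ends v w t₁ t₂) with β v | β w
  ... | just i  | just j  = ends i j t₁ t₂
  ... | just i  | nothing = half i t₁
  ... | nothing | just j  = half j t₂
  ... | nothing | nothing = loose
  contractEdge β (half v t) with β v
  ... | just i  = half i t
  ... | nothing = loose
  contractEdge β loose = loose

  -- Υ' is (a realisation of) the contraction Υ/S, with vertex set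
  -- π_b(S) ≅ Fin b.  The switchings are the (non-unique) choices made in
  -- the construction.
  record IsContraction {n m b : ℕ} (Υ : GSG n m) (S : Subset m)
                       (Υ' : GSG b m) : Set (c ⊔ ℓ) where
    field
      blocks  : BalancedBlocks Υ S b
      ζ       : Fin n → Sign
      θ       : Fin n → Carrier
    open BalancedBlocks blocks
    Υ₁ = gainSwitch θ Υ
    Υ₂ = signSwitch ζ Υ₁
    field
      balPositive : ∀ e v w t₁ t₂ i → e ∈ S → edge Υ e ≡ ends v w t₁ t₂ →
                    β v ≡ just i → σ Υ₂ e ≡ pos
      edgeSet'    : edgeSet Υ' ≡ edgeSet Υ ∖ S
      edge'       : ∀ e → e ∈ edgeSet Υ' → edge Υ' e ≡ contractEdge β (edge Υ₂ e)
      gains'      :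
        (Hyperbalanced Υ S
          × (∀ e → e ∈ S → gain Υ₁ e ≈ 0#)
          × (∀ e → e ∈ edgeSet Υ' → gain Υ' e ≈ gain Υ₂ e))
        ⊎ (¬ Hyperbalanced Υ S × (∀ e → e ∈ edgeSet Υ' → gain Υ' e ≈ 0#))

{-# OPTIONS --safe #-}
module Submission where

-- The rank of S is n − b(S) + δ(S), so the theorem says that b and δ transfer.
-- For b, walks of Υ in T ∪ S that start in a balanced block of S correspond, with their signs
-- up to switching, to walks of Υ/S in T, as long as no negative figure is met.
-- For δ, S is hyperbalanced iff some gain switcher θ makes all its edges neutral, and such
-- switchers for T in Υ/S and for T ∪ S in Υ determine each other: θ is changed by
-- ± constants on the balanced blocks of S, and it is forced on the unbalanced components since
-- 2 ≠ 0.  To find θ for a hyperbalanced set, edges are added one at a time.  Either the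
-- new edge is made neutral by switching a balanced component by a constant, or it completes
-- a sign circuit all of whose other edges are neutral, and so it is neutral itself.
-- Equality in K is not decidable, so all this is done up to double negation, which is harmless
-- because the conclusion is an equation between natural numbers.

open import Defs
open import Level using (Level; _⊔_)
open import Algebra.Bundles using (CommutativeRing)
import Algebra.Properties.CommutativeSemigroup
import Algebra.Properties.Ring
import Algebra.Properties.Semiring.Mult
import Algebra.Solver.Ring
open import Algebra.Solver.Ring.AlmostCommutativeRing using (fromCommutativeRing; _-Raw-AlmostCommutative⟶_)
open import Data.Empty using (⊥; ⊥-elim)
open import Data.Fin.Base using (Fin; zero; suc)
import Data.Fin.Properties as Finₚ
open import Data.Fin.Subset using (Subset; _∈_; _⊆_; _∪_) renaming (⊥ to ∅)
open import Data.Fin.Subset.Properties using (_∈?_; x∈p∪q⁻; p⊆p∪q; q⊆p∪q; ∉⊥; ∪-identityʳ)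
open import Data.Integer.Base as ℤ using (ℤ; +_; -[1+_]; _⊖_)
import Data.Integer.Properties as ℤₚ
open import Data.List.Base using (List; []; _∷_; _++_; [_]; filter; allFin)
import Data.List.Properties as Listₚ
import Data.List.Membership.DecPropositional as DecMembership
open import Data.List.Membership.Propositional using () renaming (_∈_ to _∈ˡ_; _∉_ to _∉ˡ_)
open import Data.List.Membership.Propositional.Properties
  using (∈-++⁺ˡ; ∈-++⁺ʳ; ∈-++⁻; ∈-filter⁺; ∈-filter⁻; ∈-allFin)
open import Data.List.Relation.Binary.Disjoint.Propositional using (Disjoint)
open import Data.List.Relation.Binary.Permutation.Propositional as Perm
  using (_↭_; ↭-sym; ↭-trans; ↭-reflexive; prep)
import Data.List.Relation.Binary.Permutation.Propositional.Properties as Permₚ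
import Data.List.Relation.Binary.Permutation.Setoid.Properties as PermSetoid
open import Data.List.Relation.Unary.All as All using (All; []; _∷_)
import Data.List.Relation.Unary.All.Properties as Allₚ
open import Data.List.Relation.Unary.AllPairs using ([]; _∷_)
open import Data.List.Relation.Unary.Any using (here; there)
open import Data.List.Relation.Unary.Unique.Propositional using (Unique)
import Data.List.Relation.Unary.Unique.Propositional.Properties as Uniqueₚ
open import Data.Maybe.Base using (Maybe; just; nothing; maybe′)
open import Data.Maybe.Properties using (just-injective)
open import Data.Nat using (ℕ; zero; suc)
import Data.Nat as ℕ
import Data.Nat.Properties as ℕₚ
open import Data.Product using (Σ; _×_; _,_; proj₁; proj₂)
open import Data.Sum using (_⊎_; inj₁; inj₂; [_,_]′)
open import Function.Base using (_∘_; id)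
open import Relation.Binary.PropositionalEquality as ≡ using (_≡_; _≢_)
open import Relation.Nullary using (¬_; Dec; yes; no)
open import Relation.Nullary.Decidable using (¬¬-excluded-middle)
open import Relation.Unary using (Decidable)

-- Signs, and a ring solver with integer coefficients

-- A circuit of Υ/S lifts only to a walk of Υ, which may repeat vertices inside a block, so
-- hyperbalance is hard to carry across a contraction circuit by circuit. Existence of a switcher
-- that annihilates every gain is a linear condition instead: it is tested edge by edge, and
-- switchers simply add. In this view a positive circle is a consistency condition on its own. A
-- negative figure prescribes the switcher at its base, but only through twice its value. Two such
-- prescriptions transported along a path must agree, and `defect` measures their disagreement;
-- dividing by 2 turns this into the gain of the handcuff. In the ranks, Υ/S has b(S) vertices, so
-- b(S) cancels from the sum and what remains is δ(T) + δ(S) = δ(T ∪ S), with δ(T) taken in Υ/S. If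
-- S is hyperfrustrated, the right side is 1 and the zero gains of Υ/S make δ(T) = 0; if S is
-- hyperbalanced, the potentials are compared.

·-assoc : ∀ a b c → (a · b) · c ≡ a · (b · c)
·-assoc pos b c = ≡.refl
·-assoc neg pos c = ≡.refl
·-assoc neg neg pos = ≡.refl
·-assoc neg neg neg = ≡.refl

·-identityʳ : ∀ a → a · pos ≡ a
·-identityʳ pos = ≡.refl
·-identityʳ neg = ≡.refl

·-comm : ∀ a b → a · b ≡ b · a
·-comm pos b = ≡.sym (·-identityʳ b)
·-comm neg pos = ≡.refl
·-comm neg neg = ≡.refl

·-square : ∀ a → a · a ≡ pos
·-square pos = ≡.refl
·-square neg = ≡.refl

opp-·ˡ : ∀ a b → opp a · b ≡ opp (a · b)
opp-·ˡ pos pos = ≡.refl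
opp-·ˡ pos neg = ≡.refl
opp-·ˡ neg pos = ≡.refl
opp-·ˡ neg neg = ≡.refl

opp-·ʳ : ∀ a b → a · opp b ≡ opp (a · b)
opp-·ʳ pos b = ≡.refl
opp-·ʳ neg pos = ≡.refl
opp-·ʳ neg neg = ≡.refl

·≡neg : ∀ a b → a · b ≡ neg → b ≡ opp a
·≡neg pos b p = p
·≡neg neg pos p = ≡.refl

·-cancelˡ : ∀ a b → a · (a · b) ≡ b
·-cancelˡ a b = ≡.trans (≡.sym (·-assoc a a b)) (≡.cong (_· b) (·-square a))

sign-cases : ∀ a → a ≡ pos ⊎ a ≡ neg
sign-cases pos = inj₁ ≡.refl
sign-cases neg = inj₂ ≡.refl

pos≢neg : ¬ (pos ≡ neg)
pos≢neg ()

-- A ring solver must compare coefficients, and equality in the field is not decidable. Integers map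
-- into every commutative ring and have decidable equality, so they serve as coefficients.
module IntegerSolver {c ℓ} (R : CommutativeRing c ℓ) where
  open CommutativeRing R
  open Algebra.Properties.Ring ring
  open Algebra.Properties.Semiring.Mult semiring renaming (_×_ to _×ᵐ_)
  open import Relation.Binary.Reasoning.Setoid setoid

  ⟦_⟧ℤ : ℤ → Carrier
  ⟦ + n ⟧ℤ      = n ×ᵐ 1#
  ⟦ -[1+ n ] ⟧ℤ = - (suc n ×ᵐ 1#)

  ⊖-homo : ∀ m n → ⟦ m ⊖ n ⟧ℤ ≈ (m ×ᵐ 1#) - (n ×ᵐ 1#)
  ⊖-homo zero zero = sym (-‿inverseʳ _)
  ⊖-homo zero (suc n) = sym (+-identityˡ _)
  ⊖-homo (suc m) zero = sym (trans (+-congˡ -0#≈0#) (+-identityʳ _))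
  ⊖-homo (suc m) (suc n) = begin
    ⟦ suc m ⊖ suc n ⟧ℤ ≡⟨ ≡.cong ⟦_⟧ℤ (ℤₚ.[1+m]⊖[1+n]≡m⊖n m n) ⟩
    ⟦ m ⊖ n ⟧ℤ ≈⟨ ⊖-homo m n ⟩
    m1 - n1 ≈⟨ +-congʳ (+-identityʳ _) ⟨
    (m1 + 0#) - n1 ≈⟨ +-congʳ (+-congˡ (-‿inverseʳ 1#)) ⟨
    (m1 + (1# - 1#)) - n1 ≈⟨ +-congʳ (+-assoc _ _ _) ⟨
    ((m1 + 1#) - 1#) - n1 ≈⟨ +-assoc _ _ _ ⟩
    (m1 + 1#) + (- 1# - n1) ≈⟨ +-cong (+-comm _ _) (-‿+-comm 1# n1) ⟩
    (1# + m1) - (1# + n1) ∎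
    where m1 = m ×ᵐ 1#
          n1 = n ×ᵐ 1#

  +-homo : ∀ i j → ⟦ i ℤ.+ j ⟧ℤ ≈ ⟦ i ⟧ℤ + ⟦ j ⟧ℤ
  +-homo (+ m) (+ n) = ×-homo-+ 1# m n
  +-homo (+ m) -[1+ n ] = ⊖-homo m (suc n)
  +-homo -[1+ m ] (+ n) = trans (⊖-homo n (suc m)) (+-comm _ _)
  +-homo -[1+ m ] -[1+ n ] = begin
    - (suc (suc (m ℕ.+ n)) ×ᵐ 1#) ≡⟨ ≡.cong (λ k → - (suc k ×ᵐ 1#)) (≡.sym (ℕₚ.+-suc m n)) ⟩
    - ((suc m ℕ.+ suc n) ×ᵐ 1#) ≈⟨ -‿cong (×-homo-+ 1# (suc m) (suc n)) ⟩
    - ((suc m ×ᵐ 1#) + (suc n ×ᵐ 1#)) ≈⟨ -‿+-comm _ _ ⟨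
    - (suc m ×ᵐ 1#) - (suc n ×ᵐ 1#) ∎

  -‿homo : ∀ i → ⟦ ℤ.- i ⟧ℤ ≈ - ⟦ i ⟧ℤ
  -‿homo (+ zero) = sym -0#≈0#
  -‿homo (+ suc n) = refl
  -‿homo -[1+ n ] = sym (-‿involutive _)

  *-homo : ∀ i j → ⟦ i ℤ.* j ⟧ℤ ≈ ⟦ i ⟧ℤ * ⟦ j ⟧ℤ
  *-homo (+ m) (+ n) = trans (reflexive (≡.cong ⟦_⟧ℤ (≡.sym (ℤₚ.pos-* m n)))) (×1-homo-* m n)
  *-homo i@(+ m) j@(-[1+ n ]) = begin
    ⟦ i ℤ.* j ⟧ℤ ≡⟨ ≡.cong ⟦_⟧ℤ (≡.sym (ℤₚ.neg-distribʳ-* i (ℤ.- j))) ⟩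
    ⟦ ℤ.- (i ℤ.* (ℤ.- j)) ⟧ℤ ≈⟨ -‿homo (i ℤ.* (ℤ.- j)) ⟩
    - ⟦ i ℤ.* + suc n ⟧ℤ ≈⟨ -‿cong (*-homo i (+ suc n)) ⟩
    - (⟦ i ⟧ℤ * ⟦ + suc n ⟧ℤ) ≈⟨ -‿distribʳ-* _ _ ⟩
    ⟦ i ⟧ℤ * ⟦ j ⟧ℤ ∎
  *-homo i@(-[1+ m ]) (+ n) = begin
    ⟦ i ℤ.* + n ⟧ℤ ≡⟨ ≡.cong ⟦_⟧ℤ (≡.sym (ℤₚ.neg-distribˡ-* (+ suc m) (+ n))) ⟩
    ⟦ ℤ.- (+ suc m ℤ.* + n) ⟧ℤ ≈⟨ -‿homo (+ suc m ℤ.* + n) ⟩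
    - ⟦ + suc m ℤ.* + n ⟧ℤ ≈⟨ -‿cong (*-homo (+ suc m) (+ n)) ⟩
    - (⟦ + suc m ⟧ℤ * ⟦ + n ⟧ℤ) ≈⟨ -‿distribˡ-* _ _ ⟩
    ⟦ i ⟧ℤ * ⟦ + n ⟧ℤ ∎
  *-homo -[1+ m ] -[1+ n ] = begin
    ⟦ + suc m ℤ.* + suc n ⟧ℤ ≈⟨ *-homo (+ suc m) (+ suc n) ⟩
    (suc m ×ᵐ 1#) * (suc n ×ᵐ 1#) ≈⟨ -‿involutive _ ⟨
    - (- ((suc m ×ᵐ 1#) * (suc n ×ᵐ 1#))) ≈⟨ -‿cong (-‿distribˡ-* _ _) ⟩
    - (- (suc m ×ᵐ 1#) * (suc n ×ᵐ 1#)) ≈⟨ -‿distribʳ-* _ _ ⟩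
    - (suc m ×ᵐ 1#) * - (suc n ×ᵐ 1#) ∎

  ℤ-morphism : ℤ.+-*-rawRing -Raw-AlmostCommutative⟶ fromCommutativeRing R
  ℤ-morphism = record
    { ⟦_⟧ = ⟦_⟧ℤ ; +-homo = +-homo ; *-homo = *-homo ; -‿homo = -‿homo
    ; 0-homo = refl ; 1-homo = +-identityʳ 1# }

  coeff≟ : ∀ i j → Maybe (⟦ i ⟧ℤ ≈ ⟦ j ⟧ℤ)
  coeff≟ i j with i ℤₚ.≟ j
  ... | yes i≡j = just (reflexive (≡.cong ⟦_⟧ℤ i≡j))
  ... | no _    = nothing

  open Algebra.Solver.Ring ℤ.+-*-rawRing (fromCommutativeRing R) ℤ-morphism coeff≟ public
    using (solve; _:=_; con; _:+_; _:*_; :-_; _:-_)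

-- Walks, figures and circuits

module _ {a} {A : Set a} where
  Unique-++⁻ : ∀ (xs : List A) {ys} → Unique (xs ++ ys) → Unique xs × Unique ys × Disjoint xs ys
  Unique-++⁻ [] u = [] , u , λ ()
  Unique-++⁻ (x ∷ xs) (x∉ ∷ u) with Unique-++⁻ xs u
  ... | uxs , uys , d = Allₚ.++⁻ˡ xs x∉ ∷ uxs , uys ,
    λ { (here ≡.refl , z∈ys) → All.lookup (Allₚ.++⁻ʳ xs x∉) z∈ys ≡.refl ; (there z∈xs , z∈ys) → d (z∈xs , z∈ys) }

  Unique-++-swap : ∀ (xs ys : List A) → Unique (xs ++ ys) → Unique (ys ++ xs)
  Unique-++-swap xs ys u with Unique-++⁻ xs u
  ... | uxs , uys , d = Uniqueₚ.++⁺ uys uxs (λ (p , q) → d (q , p))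

  Unique-resp-↭ : ∀ {xs ys : List A} → xs ↭ ys → Unique xs → Unique ys
  Unique-resp-↭ p = PermSetoid.Unique-resp-↭ (≡.setoid A) (Perm.↭⇒↭ₛ p)

  ∈-++-comm : ∀ (xs : List A) {ys z} → z ∈ˡ xs ++ ys → z ∈ˡ ys ++ xs
  ∈-++-comm xs {ys} p = [ ∈-++⁺ʳ ys , ∈-++⁺ˡ ]′ (∈-++⁻ xs p)

_∈ˡ?_ : ∀ {k} (y : Fin k) (xs : List (Fin k)) → Dec (y ∈ˡ xs)
_∈ˡ?_ = DecMembership._∈?_ Finₚ._≟_

module Walks {c ℓ} (K : Field c ℓ) where
  open GainSigned K

  ends-injective : ∀ {n} {p q p′ q′ : Fin n} {t₁ t₂ t₁′ t₂′} → ends p q t₁ t₂ ≡ ends p′ q′ t₁′ t₂′ → p ≡ p′ × q ≡ q′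
  ends-injective ≡.refl = ≡.refl , ≡.refl

  module _ {n m : ℕ} (Υ : GSG n m) where
    private
      infixr 5 _⊕_
      _⊕_ : ∀ {u v w} → Walk Υ u v → Walk Υ v w → Walk Υ u w
      _⊕_ = _++ʷ_ Υ
      sg : ∀ {u v} → Walk Υ u v → Sign
      sg = walkSign Υ
      edges : ∀ {u v} → Walk Υ u v → List (Fin m)
      edges = walkEdges Υ
      deps verts : ∀ {u v} → Walk Υ u v → List (Fin n)
      deps = departures Υ
      verts = walkVerts Υ

    walkSign-++ : ∀ {u v w} (V : Walk Υ u v) (W : Walk Υ v w) → sg (V ⊕ W) ≡ sg V · sg W
    walkSign-++ [] W = ≡.refl
    walkSign-++ (a ∷ V) W = ≡.trans (≡.cong (σ Υ (arcEdge Υ a) ·_) (walkSign-++ V W))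
      (≡.sym (·-assoc (σ Υ (arcEdge Υ a)) (sg V) (sg W)))

    arcEdge-rev : ∀ {u v} (a : Arc Υ u v) → arcEdge Υ (revArc Υ a) ≡ arcEdge Υ a
    arcEdge-rev (fwd e p) = ≡.refl
    arcEdge-rev (bwd e p) = ≡.refl

    walkSign-rev : ∀ {u v} (W : Walk Υ u v) → sg (revWalk Υ W) ≡ sg W
    walkSign-rev [] = ≡.refl
    walkSign-rev (a ∷ W) = ≡.trans (walkSign-++ (revWalk Υ W) _)
      (≡.trans (≡.cong₂ _·_ (walkSign-rev W)
        (≡.trans (·-identityʳ _) (≡.cong (σ Υ) (arcEdge-rev a))))
        (·-comm (sg W) _))

    walkEdges-++ : ∀ {u v w} (V : Walk Υ u v) (W : Walk Υ v w) → edges (V ⊕ W) ≡ edges V ++ edges W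
    walkEdges-++ [] W = ≡.refl
    walkEdges-++ (a ∷ V) W = ≡.cong (_ ∷_) (walkEdges-++ V W)

    departures-++ : ∀ {u v w} (V : Walk Υ u v) (W : Walk Υ v w) → deps (V ⊕ W) ≡ deps V ++ deps W
    departures-++ [] W = ≡.refl
    departures-++ (a ∷ V) W = ≡.cong (_ ∷_) (departures-++ V W)

    walkVerts-++ : ∀ {u v w} (V : Walk Υ u v) (W : Walk Υ v w) → verts (V ⊕ W) ≡ deps V ++ verts W
    walkVerts-++ [] W = ≡.refl
    walkVerts-++ (a ∷ V) W = ≡.cong (_ ∷_) (walkVerts-++ V W)

    module _ {P : Fin m → Set} where
      All-++ : ∀ {u v w} (V : Walk Υ u v) {W : Walk Υ v w} → All P (edges V) → All P (edges W) → All P (edges (V ⊕ W))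
      All-++ V {W} pV pW = ≡.subst (All P) (≡.sym (walkEdges-++ V W)) (Allₚ.++⁺ pV pW)

      All-++⁻ : ∀ {u v w} (V : Walk Υ u v) {W : Walk Υ v w} → All P (edges (V ⊕ W)) → All P (edges V) × All P (edges W)
      All-++⁻ V {W} p = Allₚ.++⁻ (edges V) (≡.subst (All P) (walkEdges-++ V W) p)

    walkEdges-rev : ∀ {u v} (W : Walk Υ u v) → edges (revWalk Υ W) ↭ edges W
    walkEdges-rev [] = Perm.refl
    walkEdges-rev (a ∷ W) = ↭-trans (↭-reflexive (walkEdges-++ (revWalk Υ W) _))
      (↭-trans (Permₚ.++-comm (edges (revWalk Υ W)) _)
        (↭-trans (↭-reflexive (≡.cong (_∷ _) (arcEdge-rev a))) (prep _ (walkEdges-rev W))))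

    walkVerts-rev : ∀ {u v} (W : Walk Υ u v) → verts (revWalk Υ W) ↭ verts W
    walkVerts-rev [] = Perm.refl
    walkVerts-rev (_∷_ {u} {v} a W) = ↭-trans (↭-reflexive (≡.trans (walkVerts-++ (revWalk Υ W) _)
        (≡.sym (Listₚ.++-assoc (deps (revWalk Υ W)) [ v ] [ u ]))))
      (↭-trans (Permₚ.++-comm (verts (revWalk Υ W)) [ u ]) (prep u (walkVerts-rev W)))

    All-rev : ∀ {P : Fin m → Set} {u v} (W : Walk Υ u v) → All P (edges W) → All P (edges (revWalk Υ W))
    All-rev W = Permₚ.All-resp-↭ (↭-sym (walkEdges-rev W))

    IsPath-rev : ∀ {u v} (W : Walk Υ u v) → IsPath Υ W → IsPath Υ (revWalk Υ W)
    IsPath-rev W = Unique-resp-↭ (↭-sym (walkVerts-rev W))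

    start∈ : ∀ {u v} (W : Walk Υ u v) → u ∈ˡ verts W
    start∈ [] = here ≡.refl
    start∈ (a ∷ W) = here ≡.refl

    end∈ : ∀ {u v} (W : Walk Υ u v) → v ∈ˡ verts W
    end∈ W = ∈-++⁺ʳ (deps W) (here ≡.refl)

    start∈departures : ∀ {u v} (W : Walk Υ u v) → u ≢ v → u ∈ˡ deps W
    start∈departures [] u≢u = ⊥-elim (u≢u ≡.refl)
    start∈departures (a ∷ W) _ = here ≡.refl

    end∉departures : ∀ {u v} (W : Walk Υ u v) → IsPath Υ W → v ∉ˡ deps W
    end∉departures W u v∈ = proj₂ (proj₂ (Unique-++⁻ (deps W) u)) (v∈ , here ≡.refl)

    arc-ends : ∀ {u v} (a : Arc Υ u v) {p q t₁ t₂} → edge Υ (arcEdge Υ a) ≡ ends p q t₁ t₂ →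
      (u ≡ p × v ≡ q) ⊎ (u ≡ q × v ≡ p)
    arc-ends (fwd e x) y = inj₁ (ends-injective (≡.trans (≡.sym x) y))
    arc-ends (bwd e x) y with ends-injective (≡.trans (≡.sym x) y)
    ... | r , s = inj₂ (s , r)

    walkEdges-ends : ∀ {u v} (W : Walk Υ u v) {f} → f ∈ˡ edges W →
      Σ (Fin n) λ p → Σ (Fin n) λ q → Σ Sign λ t₁ → Σ Sign λ t₂ → edge Υ f ≡ ends p q t₁ t₂
    walkEdges-ends (fwd e x ∷ W) (here ≡.refl) = _ , _ , _ , _ , x
    walkEdges-ends (bwd e x ∷ W) (here ≡.refl) = _ , _ , _ , _ , x
    walkEdges-ends (a ∷ W) (there f∈) = walkEdges-ends W f∈

    walkEdges-verts : ∀ {u v} (W : Walk Υ u v) {f p q t₁ t₂} → f ∈ˡ edges W →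
      edge Υ f ≡ ends p q t₁ t₂ → p ∈ˡ verts W × q ∈ˡ verts W
    walkEdges-verts (a ∷ W) (here ≡.refl) x with arc-ends a x
    ... | inj₁ (≡.refl , ≡.refl) = here ≡.refl , there (start∈ W)
    ... | inj₂ (≡.refl , ≡.refl) = there (start∈ W) , here ≡.refl
    walkEdges-verts (a ∷ W) (there f∈) x with walkEdges-verts W f∈ x
    ... | p∈ , q∈ = there p∈ , there q∈

    path-noLoop : ∀ {u v} (W : Walk Υ u v) → IsPath Υ W → ∀ {f p q t₁ t₂} → f ∈ˡ edges W →
      edge Υ f ≡ ends p q t₁ t₂ → p ≢ q
    path-noLoop (a ∷ W) (u∉ ∷ _) (here ≡.refl) x p≡q with arc-ends a x
    ... | inj₁ (≡.refl , ≡.refl) = All.lookup u∉ (start∈ W) p≡q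
    ... | inj₂ (≡.refl , ≡.refl) = All.lookup u∉ (start∈ W) (≡.sym p≡q)
    path-noLoop (a ∷ W) (_ ∷ un) (there f∈) x = path-noLoop W un f∈ x

    arcEdge∉ : ∀ {u v w} (a : Arc Υ u v) (W : Walk Υ v w) → u ∉ˡ verts W → arcEdge Υ a ∉ˡ edges W
    arcEdge∉ (fwd e x) W u∉ e∈ = u∉ (proj₁ (walkEdges-verts W e∈ x))
    arcEdge∉ (bwd e x) W u∉ e∈ = u∉ (proj₂ (walkEdges-verts W e∈ x))

    ∉⇒All≢ : ∀ {a} {A : Set a} {x : A} {xs} → x ∉ˡ xs → All (x ≢_) xs
    ∉⇒All≢ {xs = xs} x∉ = All.tabulate (λ y∈ x≡y → x∉ (≡.subst (_∈ˡ xs) (≡.sym x≡y) y∈))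

    path-edgesUnique : ∀ {u v} (W : Walk Υ u v) → IsPath Υ W → Unique (edges W)
    path-edgesUnique [] _ = []
    path-edgesUnique (a ∷ W) (u∉ ∷ un) =
      ∉⇒All≢ (arcEdge∉ a W (λ u∈ → All.lookup u∉ u∈ ≡.refl)) ∷ path-edgesUnique W un

    -- The walk is an index, so that matching on `split V W` replaces it by `V ⊕ W` throughout the
    -- goal.
    data Split {u v} (y : Fin n) : Walk Υ u v → Set where
      split : (V : Walk Υ u y) (W : Walk Υ y v) → Split y (V ⊕ W)

    splitAt : ∀ {u v y} (W : Walk Υ u v) → y ∈ˡ verts W → Split y W
    splitAt [] (here ≡.refl) = split [] []
    splitAt (a ∷ W) (here ≡.refl) = split [] (a ∷ W)
    splitAt (a ∷ W) (there y∈) with splitAt W y∈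
    ... | split V V′ = split (a ∷ V) V′

    IsPath-++⁻ : ∀ {u v w} (V : Walk Υ u v) {W : Walk Υ v w} → IsPath Υ (V ⊕ W) → IsPath Υ V × IsPath Υ W
    IsPath-++⁻ V {[]} u = ≡.subst (Unique) (walkVerts-++ V []) u , [] ∷ []
    IsPath-++⁻ {v = v} V {W@(_ ∷ W′)} u with Unique-++⁻ (deps V) (≡.subst Unique (walkVerts-++ V W) u)
    ... | uV , uW@(_ ∷ _) , d = Uniqueₚ.++⁺ uV ([] ∷ []) (λ { (z∈ , here ≡.refl) → d (z∈ , here ≡.refl) }) , uW

    module _ {D : Fin n → Set} (D? : Decidable D) where
      -- Cutting at the last visit rather than at any visit gives `only`, which is what the `meet`
      -- conditions of a handcuff ask of the connecting path.
      record LastHit {u v} (W : Walk Υ u v) : Set where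
        constructor lastHit′
        field
          {y} : Fin n
          V₁  : Walk Υ u y
          V₂  : Walk Υ y v
          eq  : W ≡ V₁ ⊕ V₂
          hit : D y
          only : ∀ z → D z → z ∈ˡ verts V₂ → z ≡ y

      record FirstHit {u v} (W : Walk Υ u v) : Set where
        constructor firstHit′
        field
          {y} : Fin n
          V₁  : Walk Υ u y
          V₂  : Walk Υ y v
          eq  : W ≡ V₁ ⊕ V₂
          hit : D y
          only : ∀ z → D z → z ∈ˡ verts V₁ → z ≡ y

      Misses : ∀ {u v} → Walk Υ u v → Set
      Misses W = ∀ z → D z → z ∉ˡ verts W

      lastHit : ∀ {u v} (W : Walk Υ u v) → LastHit W ⊎ Misses W
      lastHit {u} [] with D? u
      ... | yes d = inj₁ (lastHit′ [] [] ≡.refl d λ { z _ (here z≡u) → z≡u })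
      ... | no ¬d = inj₂ λ { z d (here ≡.refl) → ¬d d }
      lastHit {u} (a ∷ W) with lastHit W
      ... | inj₁ (lastHit′ V₁ V₂ eq d o) = inj₁ (lastHit′ (a ∷ V₁) V₂ (≡.cong (a ∷_) eq) d o)
      ... | inj₂ miss with D? u
      ...   | yes d = inj₁ (lastHit′ [] (a ∷ W) ≡.refl d
                λ { z _ (here z≡u) → z≡u ; z d (there z∈) → ⊥-elim (miss z d z∈) })
      ...   | no ¬d = inj₂ λ { z d (here ≡.refl) → ¬d d ; z d (there z∈) → miss z d z∈ }

      firstHit : ∀ {u v} (W : Walk Υ u v) → FirstHit W ⊎ Misses W
      firstHit {u} [] with D? u
      ... | yes d = inj₁ (firstHit′ [] [] ≡.refl d λ { z _ (here z≡u) → z≡u })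
      ... | no ¬d = inj₂ λ { z d (here ≡.refl) → ¬d d }
      firstHit {u} (a ∷ W) with D? u
      ... | yes d = inj₁ (firstHit′ [] (a ∷ W) ≡.refl d λ { z _ (here z≡u) → z≡u })
      ... | no ¬d with firstHit W
      ...   | inj₁ (firstHit′ V₁ V₂ eq d o) = inj₁ (firstHit′ (a ∷ V₁) V₂ (≡.cong (a ∷_) eq) d
                λ { z d (here ≡.refl) → ⊥-elim (¬d d) ; z d (there z∈) → o z d z∈ })
      ...   | inj₂ miss = inj₂ λ { z d (here ≡.refl) → ¬d d ; z d (there z∈) → miss z d z∈ }

    -- The departures of `a ∷ W` are the vertices of the path up to a cyclic shift. An empty `W`
    -- gives a loop; the condition on the edge excludes going back along a path of one edge.
    circle-arc : ∀ {u v} (a : Arc Υ u v) (W : Walk Υ v u) → IsPath Υ W → arcEdge Υ a ∉ˡ edges W →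
      IsCircle Υ (a ∷ W)
    circle-arc {u} a W p a∉ = record
      { nonempty = λ ()
      ; edgesUnique = ∉⇒All≢ a∉ ∷ path-edgesUnique W p
      ; vertsUnique = Unique-++-swap (deps W) [ u ] p }

    circle-rotate : ∀ {x y} (A : Walk Υ x y) (B : Walk Υ y x) → IsCircle Υ (A ⊕ B) → IsCircle Υ (B ⊕ A)
    circle-rotate A B c = record
      { nonempty = λ p → nonempty (≡.trans (walkEdges-++ A B)
          (≡.cong₂ _++_ (Listₚ.++-conicalʳ (edges B) (edges A) (≡.trans (≡.sym (walkEdges-++ B A)) p))
                        (Listₚ.++-conicalˡ (edges B) (edges A) (≡.trans (≡.sym (walkEdges-++ B A)) p))))
      ; edgesUnique = ≡.subst Unique (≡.sym (walkEdges-++ B A))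
          (Unique-++-swap (edges A) (edges B) (≡.subst Unique (walkEdges-++ A B) edgesUnique))
      ; vertsUnique = ≡.subst Unique (≡.sym (departures-++ B A))
          (Unique-++-swap (deps A) (deps B) (≡.subst Unique (departures-++ A B) vertsUnique)) }
      where open IsCircle c

    walkSign-rotate : ∀ {x y} (A : Walk Υ x y) (B : Walk Υ y x) → sg (B ⊕ A) ≡ sg (A ⊕ B)
    walkSign-rotate A B = ≡.trans (walkSign-++ B A) (≡.trans (·-comm (sg B) (sg A)) (≡.sym (walkSign-++ A B)))

    record _≈ᶠ_ {x y} (F : Figure Υ x) (F′ : Figure Υ y) : Set where
      constructor ≈ᶠ-intro
      field
        verts⊆ : ∀ {z} → z ∈ˡ figVerts Υ F → z ∈ˡ figVerts Υ F′
        verts⊇ : ∀ {z} → z ∈ˡ figVerts Υ F′ → z ∈ˡ figVerts Υ F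
        edges⊇ : ∀ {f} → f ∈ˡ figEdges Υ F′ → f ∈ˡ figEdges Υ F

    -- A figure of a handcuff must be based where the connecting path attaches; a cyclic shift moves
    -- the base of a circle to any of its vertices.
    rotate : ∀ {x y} (F : Figure Υ x) → y ∈ˡ figVerts Υ F → Σ (Figure Υ y) (F ≈ᶠ_)
    rotate (halfE h) (here ≡.refl) = halfE h , ≈ᶠ-intro id id id
    rotate {y = y} (circ C c s) y∈ with splitAt C (∈-++⁺ˡ y∈)
    ... | split A B = circ (B ⊕ A) (circle-rotate A B c) (≡.trans (walkSign-rotate A B) s) , ≈ᶠ-intro
      (λ z∈ → ≡.subst (_ ∈ˡ_) (≡.sym (departures-++ B A)) (∈-++-comm (deps A) (≡.subst (_ ∈ˡ_) (departures-++ A B) z∈)))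
      (λ z∈ → ≡.subst (_ ∈ˡ_) (≡.sym (departures-++ A B)) (∈-++-comm (deps B) (≡.subst (_ ∈ˡ_) (departures-++ B A) z∈)))
      (λ f∈ → ≡.subst (_ ∈ˡ_) (≡.sym (walkEdges-++ A B)) (∈-++-comm (edges B) (≡.subst (_ ∈ˡ_) (walkEdges-++ B A) f∈)))

    closed-verts : ∀ {x} (C : Walk Υ x x) → IsCircle Υ C → ∀ {z} → z ∈ˡ verts C → z ∈ˡ deps C
    closed-verts [] c _ = ⊥-elim (IsCircle.nonempty c ≡.refl)
    closed-verts C@(_ ∷ _) c z∈ with ∈-++⁻ (deps C) z∈
    ... | inj₁ p = p
    ... | inj₂ (here ≡.refl) = here ≡.refl

    base∈figVerts : ∀ {x} (F : Figure Υ x) → x ∈ˡ figVerts Υ F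
    base∈figVerts (circ C c _) = closed-verts C c (start∈ C)
    base∈figVerts (halfE h) = here ≡.refl

    figEdges-unique : ∀ {x} (F : Figure Υ x) → Unique (figEdges Υ F)
    figEdges-unique (circ C c _) = IsCircle.edgesUnique c
    figEdges-unique (halfE h) = [] ∷ []

    figEdges-verts : ∀ {x} (F : Figure Υ x) {f p q t₁ t₂} → f ∈ˡ figEdges Υ F →
      edge Υ f ≡ ends p q t₁ t₂ → p ∈ˡ figVerts Υ F × q ∈ˡ figVerts Υ F
    figEdges-verts (circ C c _) f∈ x with walkEdges-verts C f∈ x
    ... | p∈ , q∈ = closed-verts C c p∈ , closed-verts C c q∈
    figEdges-verts (halfE (e , t , h)) (here ≡.refl) x with ≡.trans (≡.sym h) x
    ... | ()

    figEdges-ends : ∀ {x} (F : Figure Υ x) {f} → f ∈ˡ figEdges Υ F →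
      (Σ (Fin n) λ p → Σ (Fin n) λ q → Σ Sign λ t₁ → Σ Sign λ t₂ → edge Υ f ≡ ends p q t₁ t₂)
      ⊎ Σ Sign λ t → edge Υ f ≡ half x t
    figEdges-ends (circ C c _) f∈ = inj₁ (walkEdges-ends C f∈)
    figEdges-ends (halfE (e , t , h)) (here ≡.refl) = inj₂ (t , h)

    figEdges-disjoint : ∀ {x₁ x₂} (F₁ : Figure Υ x₁) (F₂ : Figure Υ x₂) →
      Disjoint (figVerts Υ F₁) (figVerts Υ F₂) → Disjoint (figEdges Υ F₁) (figEdges Υ F₂)
    figEdges-disjoint F₁ F₂ d (f∈₁ , f∈₂) with figEdges-ends F₁ f∈₁ | figEdges-ends F₂ f∈₂
    ... | inj₁ (p , q , t₁ , t₂ , x) | _ = d (proj₁ (figEdges-verts F₁ f∈₁ x) , proj₁ (figEdges-verts F₂ f∈₂ x))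
    ... | inj₂ _ | inj₁ (p , q , t₁ , t₂ , x) = d (proj₁ (figEdges-verts F₁ f∈₁ x) , proj₁ (figEdges-verts F₂ f∈₂ x))
    ... | inj₂ (t , h) | inj₂ (t′ , h′) with ≡.trans (≡.sym h) h′
    ...   | ≡.refl = d (base∈figVerts F₁ , base∈figVerts F₂)

    -- A common edge would have both ends at `x` by `meet`, hence be a loop, and a path contains no
    -- loop.
    figure-path-disjoint : ∀ {x u v} (F : Figure Υ x) (P : Walk Υ u v) → IsPath Υ P →
      (∀ y → y ∈ˡ figVerts Υ F → y ∈ˡ verts P → y ≡ x) → Disjoint (figEdges Υ F) (edges P)
    figure-path-disjoint F P path meet (f∈F , f∈P) with walkEdges-ends P f∈P
    ... | p , q , t₁ , t₂ , x = path-noLoop P path f∈P x (≡.trans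
      (meet p (proj₁ (figEdges-verts F f∈F x)) (proj₁ (walkEdges-verts P f∈P x)))
      (≡.sym (meet q (proj₂ (figEdges-verts F f∈F x)) (proj₂ (walkEdges-verts P f∈P x)))))

    -- For an empty `P` the vertex conditions still allow both figures to be one and the same loop
    -- or half edge, which is why `d` is assumed; distinctness from the edges of `P` follows from
    -- the vertex conditions.
    mkHandcuff : ∀ {x₁ x₂} (F₁ : Figure Υ x₁) (P : Walk Υ x₁ x₂) (F₂ : Figure Υ x₂) → IsPath Υ P →
      (∀ y → y ∈ˡ figVerts Υ F₁ → y ∈ˡ verts P → y ≡ x₁) →
      (∀ y → y ∈ˡ figVerts Υ F₂ → y ∈ˡ verts P → y ≡ x₂) →
      (∀ y → y ∈ˡ figVerts Υ F₁ → y ∈ˡ figVerts Υ F₂ → y ∈ˡ verts P) →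
      Disjoint (figEdges Υ F₁) (figEdges Υ F₂) → Handcuff Υ
    mkHandcuff F₁ P F₂ path meet₁ meet₂ meet₁₂ d = record
      { F₁ = F₁ ; P = P ; F₂ = F₂ ; path = path ; meet₁ = meet₁ ; meet₂ = meet₂ ; meet₁₂ = meet₁₂
      ; edgesDistinct = Uniqueₚ.++⁺ (figEdges-unique F₁)
          (Uniqueₚ.++⁺ (path-edgesUnique P path) (figEdges-unique F₂)
            (λ (p , q) → figure-path-disjoint F₂ P path meet₂ (q , p)))
          (λ (p , q) → [ (λ r → figure-path-disjoint F₁ P path meet₁ (p , r)) , (λ r → d (p , r)) ]′ (∈-++⁻ (edges P) q)) }

    -- For `P = (_∈ S)` this is `Connected`. A predicate also covers the edge lists over which the
    -- later induction runs.
    Conn : (Fin m → Set) → Fin n → Fin n → Set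
    Conn P u v = Σ (Walk Υ u v) λ W → All P (edges W)

    conn-trans : ∀ {P u v w} → Conn P u v → Conn P v w → Conn P u w
    conn-trans (V , p) (W , q) = V ⊕ W , All-++ V p q

    conn-sym : ∀ {P u v} → Conn P u v → Conn P v u
    conn-sym (V , p) = revWalk Υ V , All-rev V p

    walkVerts-conn : ∀ {P u v} (W : Walk Υ u v) → All P (edges W) → ∀ {z} → z ∈ˡ verts W → Conn P u z
    walkVerts-conn W p z∈ with splitAt W z∈
    ... | split V V′ = V , proj₁ (All-++⁻ V p)

    figVerts-conn : ∀ {P x} (F : Figure Υ x) → All P (figEdges Υ F) → ∀ {z} → z ∈ˡ figVerts Υ F → Conn P x z
    figVerts-conn (circ C _ _) p z∈ = walkVerts-conn C p (∈-++⁺ˡ z∈)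
    figVerts-conn (halfE h) p (here ≡.refl) = [] , []

    closedPath-empty : ∀ {u} (W : Walk Υ u u) → IsPath Υ W → W ≡ []
    closedPath-empty [] _ = ≡.refl
    closedPath-empty (a ∷ W) (u∉ ∷ _) = ⊥-elim (All.lookup u∉ (end∈ W) ≡.refl)

    -- Closing a path by an edge of the path itself retraces that edge.
    backtrack-sign : ∀ {u v} (a : Arc Υ u v) (W : Walk Υ v u) → IsPath Υ W → arcEdge Υ a ∈ˡ edges W →
      sg (a ∷ W) ≡ pos
    backtrack-sign {u} {v} a (_∷_ {v = z} a′ W) path@(v∉ ∷ un) a∈ with walkEdges-ends (a ∷ []) (here ≡.refl)
    backtrack-sign {u} {v} a (_∷_ {v = z} a′ W) (v∉ ∷ un) (here e≡) | p , q , t₁ , t₂ , x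
      with arc-ends a x | arc-ends a′ (≡.subst (λ f → edge Υ f ≡ _) e≡ x)
    ... | inj₁ (≡.refl , ≡.refl) | inj₁ (≡.refl , _) = ⊥-elim (All.lookup v∉ (end∈ W) ≡.refl)
    ... | inj₂ (≡.refl , ≡.refl) | inj₂ (≡.refl , _) = ⊥-elim (All.lookup v∉ (end∈ W) ≡.refl)
    ... | inj₁ (≡.refl , ≡.refl) | inj₂ (_ , ≡.refl) rewrite closedPath-empty W un | e≡
        | ·-identityʳ (σ Υ (arcEdge Υ a′)) = ·-square (σ Υ (arcEdge Υ a′))
    ... | inj₂ (≡.refl , ≡.refl) | inj₁ (_ , ≡.refl) rewrite closedPath-empty W un | e≡
        | ·-identityʳ (σ Υ (arcEdge Υ a′)) = ·-square (σ Υ (arcEdge Υ a′))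
    backtrack-sign a (a′ ∷ W) (v∉ ∷ un) (there a∈) | p , q , t₁ , t₂ , x with arc-ends a x
    ... | inj₁ (≡.refl , ≡.refl) = ⊥-elim (All.lookup v∉ (proj₂ (walkEdges-verts W a∈ x)) ≡.refl)
    ... | inj₂ (≡.refl , ≡.refl) = ⊥-elim (All.lookup v∉ (proj₁ (walkEdges-verts W a∈ x)) ≡.refl)

    record PathWith (P : Fin m → Set) (Q : Sign → Set) (u v : Fin n) : Set where
      constructor pathWith
      field
        walk  : Walk Υ u v
        path  : IsPath Υ walk
        inP   : All P (edges walk)
        inQ   : Q (sg walk)

    -- A positive witness that the component of `v` is not sign balanced. From `¬ SignBalancedAt` it
    -- can be had only up to double negation.
    FigureNear : (Fin m → Set) → Fin n → Set
    FigureNear P v = Σ (Fin n) λ x → Σ (Figure Υ x) λ F → All P (figEdges Υ F) × Conn P x v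

    figureNear-trans : ∀ {P u v} → FigureNear P u → Conn P u v → FigureNear P v
    figureNear-trans (x , F , F⊆ , xu) uv = x , F , F⊆ , conn-trans xu uv

    -- Loop erasure either runs into a negative circle or only removes positive closed walks.
    signedPath : ∀ {P u v} (W : Walk Υ u v) → All P (edges W) → FigureNear P u ⊎ PathWith P (_≡ sg W) u v
    signedPath [] [] = inj₂ (pathWith [] ([] ∷ []) [] ≡.refl)
    signedPath {P} {u} {v} (a ∷ W) (pa ∷ pW) with signedPath W pW
    ... | inj₁ near = inj₁ (figureNear-trans near (conn-sym (a ∷ [] , pa ∷ [])))
    ... | inj₂ (pathWith W′ path p s) with u ∈ˡ? verts W′
    ...   | no u∉ = inj₂ (pathWith (a ∷ W′) (∉⇒All≢ u∉ ∷ path) (pa ∷ p) (≡.cong (σ Υ (arcEdge Υ a) ·_) s))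
    ...   | yes u∈ with splitAt W′ u∈
    ...     | split V V′ with sign-cases (sg (a ∷ V))
    ...       | inj₁ positive = inj₂ (pathWith V′ (proj₂ (IsPath-++⁻ V path)) (proj₂ (All-++⁻ V p))
                  (≡.trans (≡.cong (_· sg V′) (≡.sym positive))
                    (≡.trans (≡.sym (walkSign-++ (a ∷ V) V′)) (≡.cong (σ Υ (arcEdge Υ a) ·_) s))))
    ...       | inj₂ negative = inj₁ (u , circ (a ∷ V) (circle-arc a V V-path
                  (λ a∈ → pos≢neg (≡.trans (≡.sym (backtrack-sign a V V-path a∈)) negative))) negative
                  , pa ∷ proj₁ (All-++⁻ V p) , [] , [])
      where V-path = proj₁ (IsPath-++⁻ V path)

    erase : ∀ {P : Fin m → Set} {u v} (W : Walk Υ u v) → All P (edges W) → Σ (Walk Υ u v) λ W′ → IsPath Υ W′ × All P (edges W′)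
    erase [] [] = [] , [] ∷ [] , []
    erase {u = u} (a ∷ W) (pa ∷ pW) with erase W pW
    ... | W′ , path , p with u ∈ˡ? verts W′
    ...   | no u∉ = a ∷ W′ , ∉⇒All≢ u∉ ∷ path , pa ∷ p
    ...   | yes u∈ with splitAt W′ u∈
    ...     | split V V′ = V′ , proj₂ (IsPath-++⁻ V path) , proj₂ (All-++⁻ V p)

    -- Without a negative figure loop erasure preserves the sign, and the only closed path is the
    -- empty one.
    balanced-closed : ∀ {P u} → ¬ FigureNear P u → (W : Walk Υ u u) → All P (edges W) → sg W ≡ pos
    balanced-closed ¬near W p with signedPath W p
    ... | inj₁ near = ⊥-elim (¬near near)
    ... | inj₂ (pathWith W′ path _ s) rewrite closedPath-empty W′ path = ≡.sym s

    balanced-sign : ∀ {P u v} → ¬ FigureNear P u → (V W : Walk Υ u v) → All P (edges V) → All P (edges W) → sg V ≡ sg W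
    balanced-sign ¬near V W p q = ≡.trans (≡.sym (·-identityʳ (sg V)))
      (≡.trans (≡.cong (sg V ·_) (≡.sym closed)) (·-cancelˡ (sg V) (sg W)))
      where
      closed : sg V · sg W ≡ pos
      closed = ≡.trans (≡.sym (≡.trans (walkSign-++ V (revWalk Υ W)) (≡.cong (sg V ·_) (walkSign-rev W))))
        (balanced-closed ¬near (V ⊕ revWalk Υ W) (All-++ V p (All-rev W q)))

    -- Rotation changes the figure, so `D` records a set in which its vertices remain; this is how
    -- the rotated figure is still known to miss a given path.
    record Attached (P : Fin m → Set) (D : Fin n → Set) (v : Fin n) : Set where
      field
        {x}    : Fin n
        F      : Figure Υ x
        F⊆     : All P (figEdges Υ F)
        vertsD : ∀ {z} → z ∈ˡ figVerts Υ F → D z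
        R      : Walk Υ x v
        R-path : IsPath Υ R
        R⊆     : All P (edges R)
        meet   : ∀ y → y ∈ˡ figVerts Υ F → y ∈ˡ verts R → y ≡ x

    rotate-⊆ : ∀ {P : Fin m → Set} {x y} {F : Figure Υ x} {F′ : Figure Υ y} → F ≈ᶠ F′ → All P (figEdges Υ F) → All P (figEdges Υ F′)
    rotate-⊆ F≈ F⊆ = All.tabulate (λ f∈ → All.lookup F⊆ (_≈ᶠ_.edges⊇ F≈ f∈))

    attach : ∀ {P x v} (F : Figure Υ x) → All P (figEdges Υ F) → Conn P x v → Attached P (_∈ˡ figVerts Υ F) v
    attach {x = x} F F⊆ (W , W⊆) with erase W W⊆
    ... | W′ , path , p with lastHit (_∈ˡ? figVerts Υ F) W′
    ...   | inj₂ miss = ⊥-elim (miss x (base∈figVerts F) (start∈ W′))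
    ...   | inj₁ (lastHit′ V₁ V₂ ≡.refl hit only) with rotate F hit
    ...     | F′ , F≈ = record
      { F = F′ ; F⊆ = rotate-⊆ F≈ F⊆ ; vertsD = verts⊇
      ; R = V₂ ; R-path = proj₂ (IsPath-++⁻ V₁ path) ; R⊆ = proj₂ (All-++⁻ V₁ p)
      ; meet = λ y y∈F y∈R → only y (verts⊇ y∈F) y∈R }
      where open _≈ᶠ_ F≈

    -- The path from `v` to `w` is cut at `q`, where the tail `R` of the figure arrives. Once an
    -- edge from `w` to `v` closes the path to a negative circle, that circle, `R` and `F` form a
    -- handcuff.
    record Tadpole (P : Fin m → Set) (v w : Fin n) : Set where
      field
        {q x}  : Fin n
        Q₁     : Walk Υ v q
        Q₂     : Walk Υ q w
        Q-path : IsPath Υ (Q₁ ⊕ Q₂)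
        Q₁⊆    : All P (edges Q₁)
        Q₂⊆    : All P (edges Q₂)
        F      : Figure Υ x
        F⊆     : All P (figEdges Υ F)
        R      : Walk Υ x q
        R-path : IsPath Υ R
        R⊆     : All P (edges R)
        meetF  : ∀ y → y ∈ˡ figVerts Υ F → y ∈ˡ verts R → y ≡ x
        meetQ  : ∀ y → y ∈ˡ verts (Q₁ ⊕ Q₂) → y ∈ˡ verts R → y ≡ q
        meetFQ : ∀ y → y ∈ˡ figVerts Υ F → y ∈ˡ verts (Q₁ ⊕ Q₂) → y ∈ˡ verts R

    -- Reroutes a path: `A` will be an arc of a circle, inserted between the first and the last
    -- contact of the path with that circle.
    splice : ∀ {u v w x} (Q₁ : Walk Υ u v) (A : Walk Υ v w) (Q₂ : Walk Υ w x) →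
      IsPath Υ Q₁ → IsPath Υ A → IsPath Υ Q₂ → Disjoint (deps Q₁) (verts Q₂) →
      (∀ y → y ∈ˡ verts A → y ∈ˡ verts Q₁ → y ≡ v) → (∀ y → y ∈ˡ verts A → y ∈ˡ verts Q₂ → y ≡ w) →
      IsPath Υ (Q₁ ⊕ A ⊕ Q₂)
    splice {v = v} {w} Q₁ A Q₂ p₁ pA p₂ d m₁ m₂ = ≡.subst Unique
      (≡.sym (≡.trans (walkVerts-++ Q₁ (A ⊕ Q₂)) (≡.cong (deps Q₁ ++_) (walkVerts-++ A Q₂))))
      (Uniqueₚ.++⁺ (proj₁ (Unique-++⁻ (deps Q₁) p₁))
        (Uniqueₚ.++⁺ (proj₁ (Unique-++⁻ (deps A) pA)) p₂
          (λ (y∈A , y∈Q₂) → end∉departures A pA (≡.subst (_∈ˡ deps A) (m₂ _ (∈-++⁺ˡ y∈A) y∈Q₂) y∈A)))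
        (λ (y∈Q₁ , y∈) → [ (λ y∈A → end∉departures Q₁ p₁ (≡.subst (_∈ˡ deps Q₁) (m₁ _ (∈-++⁺ˡ y∈A) (∈-++⁺ˡ y∈Q₁)) y∈Q₁))
                         , (λ y∈Q₂ → d (y∈Q₁ , y∈Q₂)) ]′ (∈-++⁻ (deps A) y∈)))

    -- A path Q closed by an edge of sign s, in a component with a negative figure: either the
    -- figure meets Q in two vertices, and the two ways around it give both signs, or the figure
    -- and the circle through the edge form a handcuff.
    thetaOrTadpole : ∀ {P v w x} (s : Sign) (Q : Walk Υ v w) → IsPath Υ Q → All P (edges Q) →
      (F : Figure Υ x) → All P (figEdges Υ F) → Conn P x v →
      PathWith P (λ t → s · t ≡ pos) v w ⊎ Tadpole P v w
    thetaOrTadpole {P} {v} {w} s Q Q-path Q⊆ F F⊆ xv with firstHit (_∈ˡ? figVerts Υ F) Q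
    ... | inj₂ miss = inj₂ tadpole
      where
      open Attached (attach F F⊆ xv) renaming (F to F′; F⊆ to F′⊆)
      tadpole : Tadpole P v w
      -- `R` ends at `v`, which lies on `Q`, but it may touch `Q` earlier; cutting at the first
      -- contact leaves a tail that meets `Q` in one vertex.
      tadpole with firstHit (_∈ˡ? verts Q) R
      ... | inj₂ missQ = ⊥-elim (missQ v (start∈ Q) (end∈ R))
      ... | inj₁ (firstHit′ R₁ R₂ R≡ hit only) with splitAt Q hit
      ...   | split Q₁ Q₂ = record
        { Q₁ = Q₁ ; Q₂ = Q₂ ; Q-path = Q-path ; Q₁⊆ = proj₁ (All-++⁻ Q₁ Q⊆) ; Q₂⊆ = proj₂ (All-++⁻ Q₁ Q⊆)
        ; F = F′ ; F⊆ = F′⊆ ; R = R₁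
        ; R-path = proj₁ (IsPath-++⁻ R₁ (≡.subst (IsPath Υ) R≡ R-path))
        ; R⊆ = proj₁ (All-++⁻ R₁ (≡.subst (All P ∘ edges) R≡ R⊆))
        ; meetF = λ y y∈F y∈R → meet y y∈F (≡.subst (λ W → y ∈ˡ verts W) (≡.sym R≡) (prefix R₁ R₂ y∈R))
        ; meetQ = λ y y∈Q y∈R → only y y∈Q y∈R
        ; meetFQ = λ y y∈F y∈Q → ⊥-elim (miss y (vertsD y∈F) y∈Q) }
        where
        prefix : ∀ {u v w} (V : Walk Υ u v) (W : Walk Υ v w) {y} → y ∈ˡ verts V → y ∈ˡ verts (V ⊕ W)
        prefix V W y∈ = ≡.subst (_ ∈ˡ_) (≡.sym (walkVerts-++ V W))
          ([ ∈-++⁺ˡ , (λ { (here ≡.refl) → ∈-++⁺ʳ (deps V) (start∈ W) }) ]′ (∈-++⁻ (deps V) y∈))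
    ... | inj₁ (firstHit′ {a} V₁ V₂ ≡.refl hitᵃ onlyᵃ) with lastHit (_∈ˡ? figVerts Υ F) V₂
    ...   | inj₂ miss = ⊥-elim (miss a hitᵃ (start∈ V₂))
    ...   | inj₁ (lastHit′ {b} M Q₂ ≡.refl hitᵇ onlyᵇ) = cases
      where
      V₁⊆ = proj₁ (All-++⁻ V₁ Q⊆)
      Q₂⊆ = proj₂ (All-++⁻ M (proj₂ (All-++⁻ V₁ Q⊆)))
      V₁-path = proj₁ (IsPath-++⁻ V₁ Q-path)
      Q₂-path = proj₂ (IsPath-++⁻ M (proj₂ (IsPath-++⁻ V₁ Q-path)))
      unique : Unique (deps V₁ ++ deps M ++ verts Q₂)
      unique = ≡.subst Unique (≡.trans (walkVerts-++ V₁ (M ⊕ Q₂)) (≡.cong (deps V₁ ++_) (walkVerts-++ M Q₂))) Q-path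
      disjoint : Disjoint (deps V₁) (verts Q₂)
      disjoint (p , q) = proj₂ (proj₂ (Unique-++⁻ (deps V₁) unique)) (p , ∈-++⁺ʳ (deps M) q)
      F′,F≈ = rotate F hitᵃ
      F′ = proj₁ F′,F≈
      F≈ = proj₂ F′,F≈
      open _≈ᶠ_ F≈

      theta : (F′ : Figure Υ a) → (∀ {z} → z ∈ˡ figVerts Υ F′ → z ∈ˡ figVerts Υ F) → b ∈ˡ figVerts Υ F′ →
        All P (figEdges Υ F′) → a ≢ b → PathWith P (λ t → s · t ≡ pos) v w
      theta (halfE h) _ (here b≡a) _ a≢b = ⊥-elim (a≢b (≡.sym b≡a))
      theta (circ C c neg-C) C⊆F b∈ C⊆ a≢b with splitAt C (∈-++⁺ˡ b∈)
      ... | split A B = choose (sign-cases (s · sg (V₁ ⊕ A ⊕ Q₂)))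
        where
        Bʳ = revWalk Υ B
        circle-unique = Unique-++⁻ (deps A) (≡.subst Unique (departures-++ A B) (IsCircle.vertsUnique c))
        arcs-disjoint = proj₂ (proj₂ circle-unique)
        in-circle : ∀ {y} → y ∈ˡ deps A ++ deps B → y ∈ˡ figVerts Υ F
        in-circle y∈ = C⊆F (≡.subst (_ ∈ˡ_) (≡.sym (departures-++ A B)) y∈)
        A-path : IsPath Υ A
        A-path = Uniqueₚ.++⁺ (proj₁ circle-unique) ([] ∷ [])
          λ { (b∈A , here ≡.refl) → arcs-disjoint (b∈A , start∈departures B (a≢b ∘ ≡.sym)) }
        B-path : IsPath Υ B
        B-path = Uniqueₚ.++⁺ (proj₁ (proj₂ circle-unique)) ([] ∷ [])
          λ { (a∈B , here ≡.refl) → arcs-disjoint (start∈departures A a≢b , a∈B) }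
        A⊆F : ∀ {y} → y ∈ˡ verts A → y ∈ˡ figVerts Υ F
        A⊆F y∈ = [ (λ p → in-circle (∈-++⁺ˡ p)) , (λ { (here ≡.refl) → hitᵇ }) ]′ (∈-++⁻ (deps A) y∈)
        B⊆F : ∀ {y} → y ∈ˡ verts B → y ∈ˡ figVerts Υ F
        B⊆F y∈ = [ (λ p → in-circle (∈-++⁺ʳ (deps A) p)) , (λ { (here ≡.refl) → hitᵃ }) ]′ (∈-++⁻ (deps B) y∈)
        through : (X : Walk Υ a b) → IsPath Υ X → (∀ {y} → y ∈ˡ verts X → y ∈ˡ figVerts Υ F) → IsPath Υ (V₁ ⊕ X ⊕ Q₂)
        through X X-path X⊆F = splice V₁ X Q₂ V₁-path X-path Q₂-path disjoint
          (λ y y∈X → onlyᵃ y (X⊆F y∈X)) (λ y y∈X → onlyᵇ y (X⊆F y∈X))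
        through-sign : ∀ (X : Walk Υ a b) → sg (V₁ ⊕ X ⊕ Q₂) ≡ sg V₁ · (sg X · sg Q₂)
        through-sign X = ≡.trans (walkSign-++ V₁ (X ⊕ Q₂)) (≡.cong (sg V₁ ·_) (walkSign-++ X Q₂))
        -- The circle is negative, so its two arcs from `a` to `b` have opposite signs, and exactly
        -- one of the two reroutings has sign `s`.
        sg-Bʳ : sg Bʳ ≡ opp (sg A)
        sg-Bʳ = ≡.trans (walkSign-rev B) (·≡neg (sg A) (sg B) (≡.trans (≡.sym (walkSign-++ A B)) neg-C))
        choose : s · sg (V₁ ⊕ A ⊕ Q₂) ≡ pos ⊎ s · sg (V₁ ⊕ A ⊕ Q₂) ≡ neg → PathWith P (λ t → s · t ≡ pos) v w
        choose (inj₁ positive) = pathWith (V₁ ⊕ A ⊕ Q₂) (through A A-path A⊆F)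
          (All-++ V₁ V₁⊆ (All-++ A (proj₁ (All-++⁻ A C⊆)) Q₂⊆)) positive
        choose (inj₂ negative) = pathWith (V₁ ⊕ Bʳ ⊕ Q₂)
          (through Bʳ (IsPath-rev B B-path) (λ y∈ → B⊆F (Permₚ.∈-resp-↭ (walkVerts-rev B) y∈)))
          (All-++ V₁ V₁⊆ (All-++ Bʳ (All-rev B (proj₂ (All-++⁻ A C⊆))) Q₂⊆))
          (begin
            s · sg (V₁ ⊕ Bʳ ⊕ Q₂)            ≡⟨ ≡.cong (s ·_) (through-sign Bʳ) ⟩
            s · (sg V₁ · (sg Bʳ · sg Q₂))     ≡⟨ ≡.cong (λ t → s · (sg V₁ · (t · sg Q₂))) sg-Bʳ ⟩
            s · (sg V₁ · (opp (sg A) · sg Q₂)) ≡⟨ ≡.cong (λ t → s · (sg V₁ · t)) (opp-·ˡ (sg A) (sg Q₂)) ⟩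
            s · (sg V₁ · opp (sg A · sg Q₂))  ≡⟨ ≡.cong (s ·_) (opp-·ʳ (sg V₁) _) ⟩
            s · opp (sg V₁ · (sg A · sg Q₂))  ≡⟨ opp-·ʳ s _ ⟩
            opp (s · (sg V₁ · (sg A · sg Q₂))) ≡⟨ ≡.cong (λ t → opp (s · t)) (through-sign A) ⟨
            opp (s · sg (V₁ ⊕ A ⊕ Q₂))        ≡⟨ ≡.cong opp negative ⟩
            pos ∎)
          where open ≡.≡-Reasoning

      cases : PathWith P (λ t → s · t ≡ pos) v w ⊎ Tadpole P v w
      cases with a Finₚ.≟ b
      ... | no a≢b = inj₁ (theta F′ verts⊇ (verts⊆ hitᵇ) (rotate-⊆ F≈ F⊆) a≢b)
      -- With a single common vertex there is no detour around the figure; it hangs directly on `Q`,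
      -- by an empty tail.
      ... | yes ≡.refl = inj₂ record
        { Q₁ = V₁ ; Q₂ = Q₂ ; Q₁⊆ = V₁⊆ ; Q₂⊆ = Q₂⊆
        ; Q-path = ≡.subst Unique (≡.sym (walkVerts-++ V₁ Q₂))
            (Uniqueₚ.++⁺ (proj₁ (Unique-++⁻ (deps V₁) unique)) Q₂-path disjoint)
        ; F = F′ ; F⊆ = rotate-⊆ F≈ F⊆ ; R = [] ; R-path = [] ∷ [] ; R⊆ = []
        ; meetF = λ { y _ (here y≡a) → y≡a }
        ; meetQ = λ { y _ (here y≡a) → y≡a }
        ; meetFQ = λ y y∈F y∈Q → here ([ (λ p → onlyᵃ y (verts⊇ y∈F) (∈-++⁺ˡ p)) , onlyᵇ y (verts⊇ y∈F) ]′
            (∈-++⁻ (deps V₁) (≡.subst (y ∈ˡ_) (walkVerts-++ V₁ Q₂) y∈Q))) }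

-- Gains of walks and handcuffs

module Gains {c ℓ} (K : Field c ℓ)
  (2≉0 : ¬ (Field._≈_ K (Field._+_ K (Field.1# K) (Field.1# K)) (Field.0# K))) where
  open Field K
  open GainSigned K
  open Walks K
  open Algebra.Properties.Ring ring using (-0#≈0#; -‿involutive; -‿+-comm)
  open IntegerSolver commutativeRing
  open import Relation.Binary.Reasoning.Setoid setoid

  ⊙-cong : ∀ s {x y} → x ≈ y → s ⊙ x ≈ s ⊙ y
  ⊙-cong pos x≈y = x≈y
  ⊙-cong neg x≈y = -‿cong x≈y

  ⊙-0 : ∀ s → s ⊙ 0# ≈ 0#
  ⊙-0 pos = refl
  ⊙-0 neg = -0#≈0#

  ⊙-+ : ∀ s x y → s ⊙ (x + y) ≈ s ⊙ x + s ⊙ y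
  ⊙-+ pos x y = refl
  ⊙-+ neg x y = sym (-‿+-comm x y)

  ⊙-neg : ∀ s x → s ⊙ (- x) ≈ - (s ⊙ x)
  ⊙-neg pos x = refl
  ⊙-neg neg x = refl

  ·-⊙ : ∀ s t x → (s · t) ⊙ x ≈ s ⊙ (t ⊙ x)
  ·-⊙ pos t x = refl
  ·-⊙ neg pos x = refl
  ·-⊙ neg neg x = sym (-‿involutive x)

  ⊙-≡ : ∀ {s t} → s ≡ t → ∀ x → s ⊙ x ≈ t ⊙ x
  ⊙-≡ ≡.refl x = refl

  ⊙-cancel : ∀ s {x} → s ⊙ x ≈ 0# → x ≈ 0#
  ⊙-cancel pos p = p
  ⊙-cancel neg p = trans (sym (-‿involutive _)) (trans (-‿cong p) -0#≈0#)

  *-cancel-≉0 : ∀ {x y} → ¬ (x ≈ 0#) → x * y ≈ 0# → y ≈ 0#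
  *-cancel-≉0 {x} {y} x≉0 xy≈0 = begin
    y              ≈⟨ *-identityˡ y ⟨
    1# * y         ≈⟨ *-congʳ x*x⁻¹≈1 ⟨
    (x * x⁻¹) * y  ≈⟨ solve 3 (λ a b d → (a :* b) :* d := b :* (a :* d)) refl x x⁻¹ y ⟩
    x⁻¹ * (x * y)  ≈⟨ *-congˡ xy≈0 ⟩
    x⁻¹ * 0#       ≈⟨ zeroʳ x⁻¹ ⟩
    0#             ∎
    where
    x⁻¹ = proj₁ (inverse x x≉0)
    x*x⁻¹≈1 = proj₂ (inverse x x≉0)

  -- The place where the characteristic matters: every division by 2 in the proof goes through this
  -- cancellation.
  double-cancel : ∀ {x} → x + x ≈ 0# → x ≈ 0#
  double-cancel {x} p = *-cancel-≉0 2≉0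
    (trans (distribʳ x 1# 1#) (trans (+-cong (*-identityˡ x) (*-identityˡ x)) p))

  +-zeroes : ∀ {x y} → x ≈ 0# → y ≈ 0# → x + y ≈ 0#
  +-zeroes p q = trans (+-cong p q) (+-identityˡ 0#)

  gainSwitchGain-cong : ∀ {n} {θ η : Fin n → Carrier} (E : Edge n) {x y} →
    (∀ v → θ v ≈ η v) → x ≈ y → gainSwitchGain θ E x ≈ gainSwitchGain η E y
  gainSwitchGain-cong (ends v w t₁ t₂) p q = +-cong (+-cong (⊙-cong t₁ (p v)) q) (⊙-cong t₂ (p w))
  gainSwitchGain-cong (half v t) p q = +-cong (⊙-cong t (p v)) q
  gainSwitchGain-cong loose p q = q

  gainSwitchGain-zero : ∀ {n} (E : Edge n) x → gainSwitchGain (λ _ → 0#) E x ≈ x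
  gainSwitchGain-zero (ends v w t₁ t₂) x =
    trans (+-cong (trans (+-congʳ (⊙-0 t₁)) (+-identityˡ x)) (⊙-0 t₂)) (+-identityʳ x)
  gainSwitchGain-zero (half v t) x = trans (+-congʳ (⊙-0 t)) (+-identityˡ x)
  gainSwitchGain-zero loose x = refl

  -- Switching is linear in the pair of switcher and gain. Pairing a switcher with the gain `0#`
  -- therefore isolates its own effect on an edge.
  gainSwitchGain-+ : ∀ {n} (θ η : Fin n → Carrier) (E : Edge n) x y →
    gainSwitchGain (λ v → θ v + η v) E (x + y) ≈ gainSwitchGain θ E x + gainSwitchGain η E y
  gainSwitchGain-+ θ η (ends v w t₁ t₂) x y = trans
    (+-cong (+-congʳ (⊙-+ t₁ _ _)) (⊙-+ t₂ _ _))
    (solve 6 (λ a b x y d e → ((a :+ b) :+ (x :+ y)) :+ (d :+ e) := ((a :+ x) :+ d) :+ ((b :+ y) :+ e))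
      refl (t₁ ⊙ θ v) (t₁ ⊙ η v) x y (t₂ ⊙ θ w) (t₂ ⊙ η w))
  gainSwitchGain-+ θ η (half v t) x y = trans (+-congʳ (⊙-+ t _ _))
    (solve 4 (λ a b x y → (a :+ b) :+ (x :+ y) := (a :+ x) :+ (b :+ y)) refl (t ⊙ θ v) (t ⊙ η v) x y)
  gainSwitchGain-+ θ η loose x y = refl

  ⊙-* : ∀ s c x → s ⊙ (c * x) ≈ c * (s ⊙ x)
  ⊙-* pos c x = refl
  ⊙-* neg c x = solve 2 (λ c x → :- (c :* x) := c :* (:- x)) refl c x

  gainSwitchGain-* : ∀ {n} (d : Carrier) (η : Fin n → Carrier) (E : Edge n) →
    gainSwitchGain (λ v → d * η v) E 0# ≈ d * gainSwitchGain η E 0#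
  gainSwitchGain-* d η (ends v w t₁ t₂) = trans
    (+-cong (+-cong (⊙-* t₁ d _) (sym (zeroʳ d))) (⊙-* t₂ d _))
    (solve 4 (λ d a b z → (d :* a :+ d :* z) :+ d :* b := d :* ((a :+ z) :+ b)) refl d _ _ 0#)
  gainSwitchGain-* d η (half v t) = trans (+-cong (⊙-* t d _) (sym (zeroʳ d))) (sym (distribˡ d _ _))
  gainSwitchGain-* d η loose = sym (zeroʳ d)

  module _ {n m : ℕ} (Υ : GSG n m) where

    private
      infixr 5 _⊕_
      _⊕_ : ∀ {u v w} → Walk Υ u v → Walk Υ v w → Walk Υ u w
      _⊕_ = _++ʷ_ Υ
      sg : ∀ {u v} → Walk Υ u v → Sign
      sg = walkSign Υ

    arcSign : ∀ {u v} (a : Arc Υ u v) →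
      σ Υ (arcEdge Υ a) ≡ opp (arcTau Υ a · arcTau Υ (revArc Υ a))
    arcSign (fwd e p) = ≡.cong edgeSign p
    arcSign (bwd e {t₁ = t₁} {t₂} p) = ≡.trans (≡.cong edgeSign p) (≡.cong opp (·-comm t₁ t₂))

    -- The walk gain without its overall sign, computed from an arbitrary gain function.
    partialGain : (Fin m → Carrier) → ∀ {u v} → Walk Υ u v → Carrier
    partialGain g [] = 0#
    partialGain g (a ∷ W) = (arcTau Υ a ⊙ g (arcEdge Υ a)) + (σ Υ (arcEdge Υ a) ⊙ partialGain g W)

    gainSum≈ : ∀ s {u v} (W : Walk Υ u v) → gainSum Υ s W ≈ s ⊙ partialGain (gain Υ) W
    gainSum≈ s [] = sym (⊙-0 s)
    gainSum≈ s (a ∷ W) = begin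
      ((s · τ) ⊙ x) + gainSum Υ (s · σₐ) W ≈⟨ +-cong (·-⊙ s τ x) (gainSum≈ (s · σₐ) W) ⟩
      (s ⊙ (τ ⊙ x)) + ((s · σₐ) ⊙ y) ≈⟨ +-congˡ (·-⊙ s σₐ y) ⟩
      (s ⊙ (τ ⊙ x)) + (s ⊙ (σₐ ⊙ y)) ≈⟨ ⊙-+ s _ _ ⟨
      s ⊙ ((τ ⊙ x) + (σₐ ⊙ y)) ∎
      where
      τ = arcTau Υ a
      σₐ = σ Υ (arcEdge Υ a)
      x = gain Υ (arcEdge Υ a)
      y = partialGain (gain Υ) W

    module _ (g : Fin m → Carrier) where
      private
        G : ∀ {u v} → Walk Υ u v → Carrier
        G = partialGain g

      partialGain-++ : ∀ {u v w} (V : Walk Υ u v) (W : Walk Υ v w) → G (V ⊕ W) ≈ G V + (sg V ⊙ G W)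
      partialGain-++ [] W = sym (+-identityˡ _)
      partialGain-++ (a ∷ V) W = begin
        x + (s ⊙ G (V ⊕ W)) ≈⟨ +-congˡ (⊙-cong s (partialGain-++ V W)) ⟩
        x + (s ⊙ (G V + (sg V ⊙ G W))) ≈⟨ +-congˡ (⊙-+ s _ _) ⟩
        x + ((s ⊙ G V) + (s ⊙ (sg V ⊙ G W))) ≈⟨ +-assoc _ _ _ ⟨
        (x + (s ⊙ G V)) + (s ⊙ (sg V ⊙ G W)) ≈⟨ +-congˡ (·-⊙ s (sg V) (G W)) ⟨
        (x + (s ⊙ G V)) + ((s · sg V) ⊙ G W) ∎
        where
        s = σ Υ (arcEdge Υ a)
        x = arcTau Υ a ⊙ g (arcEdge Υ a)

      partialGain-zero : ∀ {u v} (W : Walk Υ u v) →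
        All (λ e → g e ≈ 0#) (walkEdges Υ W) → G W ≈ 0#
      partialGain-zero [] [] = refl
      partialGain-zero (a ∷ W) (p ∷ ps) = +-zeroes
        (trans (⊙-cong (arcTau Υ a) p) (⊙-0 (arcTau Υ a)))
        (trans (⊙-cong (σ Υ (arcEdge Υ a)) (partialGain-zero W ps)) (⊙-0 (σ Υ (arcEdge Υ a))))

      -- Reversal reads each arc from its other end, where the orientation is τ′ = -στ; this is the
      -- source of the minus sign.
      partialGain-rev : ∀ {u v} (W : Walk Υ u v) → G (revWalk Υ W) ≈ - (sg W ⊙ G W)
      partialGain-rev [] = sym -0#≈0#
      partialGain-rev (a ∷ W) = begin
        G (revWalk Υ W ⊕ (a′ ∷ [])) ≈⟨ partialGain-++ (revWalk Υ W) (a′ ∷ []) ⟩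
        G (revWalk Υ W) + (sg (revWalk Υ W) ⊙ ((τ′ ⊙ g (arcEdge Υ a′)) + (σ Υ (arcEdge Υ a′) ⊙ 0#)))
          ≈⟨ +-cong (partialGain-rev W) (trans (⊙-≡ (walkSign-rev Υ W) _) (⊙-cong (sg W)
               (trans (+-cong (⊙-cong τ′ (reflexive (≡.cong g (arcEdge-rev Υ a)))) (⊙-0 (σ Υ (arcEdge Υ a′)))) (+-identityʳ _)))) ⟩
        - (sg W ⊙ G W) + (sg W ⊙ (τ′ ⊙ x)) ≈⟨ lemma (sg W) τ τ′ (G W) x ⟩
        - ((opp (τ · τ′) · sg W) ⊙ ((τ ⊙ x) + (opp (τ · τ′) ⊙ G W)))
          ≈⟨ -‿cong (trans (⊙-≡ (≡.cong (_· sg W) (≡.sym (arcSign a))) _)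
               (⊙-cong (σ Υ (arcEdge Υ a) · sg W) (+-congˡ (⊙-≡ (≡.sym (arcSign a)) (G W))))) ⟩
        - ((σ Υ (arcEdge Υ a) · sg W) ⊙ ((τ ⊙ x) + (σ Υ (arcEdge Υ a) ⊙ G W))) ∎
        where
        a′ = revArc Υ a
        τ = arcTau Υ a
        τ′ = arcTau Υ a′
        x = g (arcEdge Υ a)
        lemma : ∀ p t t′ y x → - (p ⊙ y) + (p ⊙ (t′ ⊙ x)) ≈
          - ((opp (t · t′) · p) ⊙ ((t ⊙ x) + (opp (t · t′) ⊙ y)))
        lemma pos pos pos = solve 2 (λ y x → (:- y) :+ x := :- (:- (x :+ (:- y)))) refl
        lemma pos pos neg = solve 2 (λ y x → (:- y) :+ (:- x) := :- (x :+ y)) refl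
        lemma pos neg pos = solve 2 (λ y x → (:- y) :+ x := :- ((:- x) :+ y)) refl
        lemma pos neg neg = solve 2 (λ y x → (:- y) :+ (:- x) := :- (:- ((:- x) :+ (:- y)))) refl
        lemma neg pos pos = solve 2 (λ y x → (:- (:- y)) :+ (:- x) := :- (x :+ (:- y))) refl
        lemma neg pos neg = solve 2 (λ y x → (:- (:- y)) :+ (:- (:- x)) := :- (:- (x :+ y))) refl
        lemma neg neg pos = solve 2 (λ y x → (:- (:- y)) :+ (:- x) := :- (:- ((:- x) :+ y))) refl
        lemma neg neg neg = solve 2 (λ y x → (:- (:- y)) :+ (:- (:- x)) := :- ((:- x) :+ (:- y))) refl

    switchedGain : (Fin n → Carrier) → Fin m → Carrier
    switchedGain θ e = gainSwitchGain θ (edge Υ e) (gain Υ e)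

    switchedGain-arc : ∀ θ {u v} (a : Arc Υ u v) → switchedGain θ (arcEdge Υ a) ≈
      ((arcTau Υ a ⊙ θ u) + gain Υ (arcEdge Υ a)) + (arcTau Υ (revArc Υ a) ⊙ θ v)
    switchedGain-arc θ (fwd e p) rewrite p = refl
    switchedGain-arc θ (bwd e p) rewrite p =
      solve 3 (λ a x b → (a :+ x) :+ b := (b :+ x) :+ a) refl _ _ _

    -- The sum telescopes: since ττ′ = -σ, the contributions of `θ` at an inner vertex from the
    -- arriving and the departing arc cancel.
    partialGain-switch : ∀ θ {u v} (W : Walk Υ u v) →
      partialGain (switchedGain θ) W ≈ (partialGain (gain Υ) W + θ u) - (walkSign Υ W ⊙ θ v)
    partialGain-switch θ {u} [] = solve 2 (λ z x → z := (z :+ x) :- x) refl 0# (θ u)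
    partialGain-switch θ {u} {v} (_∷_ {v = w} a W) = begin
      (τ ⊙ switchedGain θ (arcEdge Υ a)) + (s ⊙ partialGain (switchedGain θ) W)
        ≈⟨ +-cong (⊙-cong τ (switchedGain-arc θ a)) (trans (⊙-≡ (arcSign a) _) (⊙-cong (opp (τ · τ′)) (partialGain-switch θ W))) ⟩
      (τ ⊙ (((τ ⊙ θ u) + x) + (τ′ ⊙ θ w))) + (opp (τ · τ′) ⊙ ((y + θ w) - (sg W ⊙ θ v)))
        ≈⟨ lemma τ τ′ (θ u) x (θ w) y (sg W ⊙ θ v) ⟩
      (((τ ⊙ x) + (opp (τ · τ′) ⊙ y)) + θ u) - (opp (τ · τ′) ⊙ (sg W ⊙ θ v))
        ≈⟨ +-cong (+-congʳ (+-congˡ (⊙-≡ (≡.sym (arcSign a)) y)))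
             (-‿cong (trans (⊙-≡ (≡.sym (arcSign a)) _) (sym (·-⊙ s (sg W) (θ v))))) ⟩
      (((τ ⊙ x) + (s ⊙ y)) + θ u) - ((s · sg W) ⊙ θ v) ∎
      where
      τ = arcTau Υ a
      τ′ = arcTau Υ (revArc Υ a)
      s = σ Υ (arcEdge Υ a)
      x = gain Υ (arcEdge Υ a)
      y = partialGain (gain Υ) W
      lemma : ∀ t t′ a x b y z → (t ⊙ (((t ⊙ a) + x) + (t′ ⊙ b))) + (opp (t · t′) ⊙ ((y + b) - z)) ≈
        (((t ⊙ x) + (opp (t · t′) ⊙ y)) + a) - (opp (t · t′) ⊙ z)
      lemma pos pos = solve 5 (λ a x b y z → ((a :+ x) :+ b) :+ (:- ((y :+ b) :- z)) := ((x :+ (:- y)) :+ a) :- (:- z)) refl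
      lemma pos neg = solve 5 (λ a x b y z → ((a :+ x) :+ (:- b)) :+ ((y :+ b) :- z) := ((x :+ y) :+ a) :- z) refl
      lemma neg pos = solve 5 (λ a x b y z → (:- (((:- a) :+ x) :+ b)) :+ ((y :+ b) :- z) := (((:- x) :+ y) :+ a) :- z) refl
      lemma neg neg = solve 5 (λ a x b y z → (:- (((:- a) :+ x) :+ (:- b))) :+ (:- ((y :+ b) :- z)) := (((:- x) :+ (:- y)) :+ a) :- (:- z)) refl

    -- Twice the value that a negative figure prescribes for -θ at its base: the figure is
    -- neutral after gain switching by θ iff this constant plus θ x + θ x vanishes.
    figureConst : (Fin m → Carrier) → ∀ {x} → Figure Υ x → Carrier
    figureConst g (circ C _ _) = partialGain g C
    figureConst g (halfE h) = (halfTau Υ h ⊙ g (halfEdge Υ h)) + (halfTau Υ h ⊙ g (halfEdge Υ h))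

    figureConst-switch : ∀ θ {x} (F : Figure Υ x) →
      figureConst (switchedGain θ) F ≈ figureConst (gain Υ) F + (θ x + θ x)
    figureConst-switch θ {x} (circ C _ s) = trans (partialGain-switch θ C)
      (trans (+-congˡ (-‿cong (⊙-≡ s (θ x)))) (solve 2 (λ y x → (y :+ x) :- (:- x) := y :+ (x :+ x)) refl _ _))
    figureConst-switch θ {x} (halfE (e , t , p)) rewrite p = lemma t (gain Υ e) (θ x)
      where
      lemma : ∀ t y x → (t ⊙ ((t ⊙ x) + y)) + (t ⊙ ((t ⊙ x) + y)) ≈ ((t ⊙ y) + (t ⊙ y)) + (x + x)
      lemma pos = solve 2 (λ y x → (x :+ y) :+ (x :+ y) := (y :+ y) :+ (x :+ x)) refl
      lemma neg = solve 2 (λ y x → (:- ((:- x) :+ y)) :+ (:- ((:- x) :+ y)) := ((:- y) :+ (:- y)) :+ (x :+ x)) refl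

    figureConst-zero : ∀ g {x} (F : Figure Υ x) → All (λ e → g e ≈ 0#) (figEdges Υ F) → figureConst g F ≈ 0#
    figureConst-zero g (circ C _ _) p = partialGain-zero g C p
    figureConst-zero g (halfE h) (p ∷ []) = +-zeroes q q
      where q = trans (⊙-cong (halfTau Υ h) p) (⊙-0 (halfTau Υ h))

    -- The gain of a handcuff, up to the factors ±1 and 2, in a form that is uniform in the
    -- kinds of the two figures.
    defect : (Fin m → Carrier) → ∀ {x₁ x₂} → Figure Υ x₁ → Walk Υ x₁ x₂ → Figure Υ x₂ → Carrier
    defect g F₁ P F₂ = (figureConst g F₁ - (partialGain g P + partialGain g P)) - (walkSign Υ P ⊙ figureConst g F₂)

    -- At each end of `P` the switcher enters twice through the figure and twice, with the opposite
    -- sign, through the doubled gain of `P`.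
    defect-switch : ∀ θ {x₁ x₂} (F₁ : Figure Υ x₁) (P : Walk Υ x₁ x₂) (F₂ : Figure Υ x₂) →
      defect (switchedGain θ) F₁ P F₂ ≈ defect (gain Υ) F₁ P F₂
    defect-switch θ {x₁} {x₂} F₁ P F₂ = trans
      (+-cong (+-cong (figureConst-switch θ F₁) (-‿cong (+-cong (partialGain-switch θ P) (partialGain-switch θ P))))
        (-‿cong (⊙-cong (sg P) (figureConst-switch θ F₂))))
      (lemma (sg P) (figureConst (gain Υ) F₁) (θ x₁) (partialGain (gain Υ) P) (θ x₂) (figureConst (gain Υ) F₂))
      where
      lemma : ∀ p k a y b l → ((k + (a + a)) - (((y + a) - (p ⊙ b)) + ((y + a) - (p ⊙ b)))) - (p ⊙ (l + (b + b)))
        ≈ (k - (y + y)) - (p ⊙ l)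
      lemma pos = solve 5 (λ k a y b l → ((k :+ (a :+ a)) :- (((y :+ a) :- b) :+ ((y :+ a) :- b))) :- (l :+ (b :+ b))
        := (k :- (y :+ y)) :- l) refl
      lemma neg = solve 5 (λ k a y b l → ((k :+ (a :+ a)) :- (((y :+ a) :- (:- b)) :+ ((y :+ a) :- (:- b)))) :- (:- (l :+ (b :+ b)))
        := (k :- (y :+ y)) :- (:- l)) refl

    walkGain≈ : ∀ {u v} (W : Walk Υ u v) → walkGain Υ W ≈ - partialGain (gain Υ) W
    walkGain≈ W = -‿cong (gainSum≈ pos W)

    ⊙-zero-iff : ∀ s {x y} → x ≈ s ⊙ y → (x ≈ 0# → y ≈ 0#) × (y ≈ 0# → x ≈ 0#)
    ⊙-zero-iff s p = (λ q → ⊙-cancel s (trans (sym p) q)) , (λ q → trans p (trans (⊙-cong s q) (⊙-0 s)))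

    double-zero-iff : ∀ {x y} → x + x ≈ y → (x ≈ 0# → y ≈ 0#) × (y ≈ 0# → x ≈ 0#)
    double-zero-iff p = (λ q → trans (sym p) (+-zeroes q q)) , (λ q → double-cancel (trans p q))

    module _ where
      private
        G : ∀ {u v} → Walk Υ u v → Carrier
        G = partialGain (gain Υ)

      -- Going around `C` reverses the running sign, so the way back doubles the gain of the way out
      -- instead of cancelling it. `V′` is kept abstract so that the pair `revWalk Υ P`, `P` fits
      -- without identifying a double reversal with `P`.
      roundtrip-gain : ∀ {u v} (V : Walk Υ u v) (C : Walk Υ v v) (V′ : Walk Υ v u) →
        sg C ≡ neg → G V′ ≈ - (sg V ⊙ G V) → G (V ⊕ C ⊕ V′) ≈ (G V + G V) + (sg V ⊙ G C)
      roundtrip-gain V C V′ s r = begin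
        G (V ⊕ C ⊕ V′) ≈⟨ partialGain-++ (gain Υ) V _ ⟩
        G V + (sg V ⊙ G (C ⊕ V′)) ≈⟨ +-congˡ (⊙-cong (sg V) (partialGain-++ (gain Υ) C V′)) ⟩
        G V + (sg V ⊙ (G C + (sg C ⊙ G V′)))
          ≈⟨ +-congˡ (⊙-cong (sg V) (+-congˡ (trans (⊙-≡ s _) (-‿cong r)))) ⟩
        G V + (sg V ⊙ (G C - (- (sg V ⊙ G V)))) ≈⟨ lemma (sg V) (G V) (G C) ⟩
        (G V + G V) + (sg V ⊙ G C) ∎
        where
        lemma : ∀ p y l → y + (p ⊙ (l - (- (p ⊙ y)))) ≈ (y + y) + (p ⊙ l)
        lemma pos = solve 2 (λ y l → y :+ (l :- (:- y)) := (y :+ y) :+ l) refl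
        lemma neg = solve 2 (λ y l → y :+ (:- (l :- (:- (:- y)))) := (y :+ y) :+ (:- l)) refl

      roundtrip-sign : ∀ {u v} (V : Walk Υ u v) (C : Walk Υ v v) (V′ : Walk Υ v u) →
        sg C ≡ neg → sg V′ ≡ sg V → sg (V ⊕ C ⊕ V′) ≡ neg
      roundtrip-sign V C V′ s r rewrite walkSign-++ Υ V (C ⊕ V′) | walkSign-++ Υ C V′ | s | r with sg V
      ... | pos = ≡.refl
      ... | neg = ≡.refl

      rev-partialGain-rev : ∀ {u v} (P : Walk Υ u v) → G P ≈ - (sg (revWalk Υ P) ⊙ G (revWalk Υ P))
      rev-partialGain-rev P = sym (trans (-‿cong (trans (⊙-≡ (walkSign-rev Υ P) _)
        (⊙-cong (sg P) (partialGain-rev (gain Υ) P)))) (lemma (sg P) (G P)))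
        where
        lemma : ∀ p x → - (p ⊙ (- (p ⊙ x))) ≈ x
        lemma pos = solve 1 (λ x → :- (:- x) := x) refl
        lemma neg = solve 1 (λ x → :- (:- (:- (:- x))) := x) refl

      -- Only vanishing is compared: the gain equals the defect up to sign as soon as one figure is
      -- a circle, but for two half edges it is half the defect.
      handcuffGain-zero-iff : ∀ {x₁ x₂} (F₁ : Figure Υ x₁) (P : Walk Υ x₁ x₂) (F₂ : Figure Υ x₂) →
        (handcuffGain Υ F₁ P F₂ ≈ 0# → defect (gain Υ) F₁ P F₂ ≈ 0#) ×
        (defect (gain Υ) F₁ P F₂ ≈ 0# → handcuffGain Υ F₁ P F₂ ≈ 0#)
      handcuffGain-zero-iff (circ C₁ _ s₁) P (circ C₂ _ s₂) = ⊙-zero-iff neg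
        (trans (walkGain≈ (C₁ ⊕ P ⊕ C₂ ⊕ revWalk Υ P)) (-‿cong (begin
          G (C₁ ⊕ P ⊕ C₂ ⊕ revWalk Υ P)
            ≈⟨ partialGain-++ (gain Υ) C₁ _ ⟩
          G C₁ + (sg C₁ ⊙ G (P ⊕ C₂ ⊕ revWalk Υ P))
            ≈⟨ +-congˡ (trans (⊙-≡ s₁ _) (-‿cong
                 (roundtrip-gain P C₂ (revWalk Υ P) s₂ (partialGain-rev (gain Υ) P)))) ⟩
          G C₁ - ((G P + G P) + (sg P ⊙ G C₂))
            ≈⟨ solve 3 (λ k y l → k :- ((y :+ y) :+ l) := (k :- (y :+ y)) :- l) refl _ _ _ ⟩
          (G C₁ - (G P + G P)) - (sg P ⊙ G C₂) ∎)))
      handcuffGain-zero-iff (circ C₁ _ s₁) P (halfE h) = ⊙-zero-iff (opp (sg P)) (begin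
        (x + walkGain Υ W) - ((sg W · halfTau Υ h) ⊙ φ)
          ≈⟨ +-cong (+-congˡ (trans (walkGain≈ W) (-‿cong
               (roundtrip-gain (revWalk Υ P) C₁ P s₁ (rev-partialGain-rev P)))))
               (-‿cong (⊙-≡ (≡.cong (_· halfTau Υ h)
                 (roundtrip-sign (revWalk Υ P) C₁ P s₁ (≡.sym (walkSign-rev Υ P)))) φ)) ⟩
        (x - ((G (revWalk Υ P) + G (revWalk Υ P)) + (sg (revWalk Υ P) ⊙ G C₁))) - ((neg · halfTau Υ h) ⊙ φ)
          ≈⟨ +-cong (+-congˡ (-‿cong (+-cong (+-cong (partialGain-rev (gain Υ) P) (partialGain-rev (gain Υ) P))
               (⊙-≡ (walkSign-rev Υ P) _)))) (-‿cong (·-⊙ neg (halfTau Υ h) φ)) ⟩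
        (x - ((- (sg P ⊙ G P) + - (sg P ⊙ G P)) + (sg P ⊙ G C₁))) - (- x)
          ≈⟨ lemma (sg P) x (G P) (G C₁) ⟩
        opp (sg P) ⊙ ((G C₁ - (G P + G P)) - (sg P ⊙ (x + x))) ∎)
        where
        W = revWalk Υ P ⊕ C₁ ⊕ P
        φ = gain Υ (halfEdge Υ h)
        x = halfTau Υ h ⊙ φ
        lemma : ∀ p x y k → (x - ((- (p ⊙ y) + - (p ⊙ y)) + (p ⊙ k))) - (- x) ≈
          opp p ⊙ ((k - (y + y)) - (p ⊙ (x + x)))
        lemma pos = solve 3 (λ x y k → (x :- (((:- y) :+ (:- y)) :+ k)) :- (:- x) :=
          :- ((k :- (y :+ y)) :- (x :+ x))) refl
        lemma neg = solve 3 (λ x y k → (x :- (((:- (:- y)) :+ (:- (:- y))) :+ (:- k))) :- (:- x) :=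
          ((k :- (y :+ y)) :- (:- (x :+ x)))) refl
      handcuffGain-zero-iff (halfE h) P (circ C₂ _ s₂) = ⊙-zero-iff pos (begin
        (x + walkGain Υ W) - ((sg W · halfTau Υ h) ⊙ φ)
          ≈⟨ +-cong (+-congˡ (trans (walkGain≈ W) (-‿cong
               (roundtrip-gain P C₂ (revWalk Υ P) s₂ (partialGain-rev (gain Υ) P)))))
               (-‿cong (trans (⊙-≡ (≡.cong (_· halfTau Υ h)
                 (roundtrip-sign P C₂ (revWalk Υ P) s₂ (walkSign-rev Υ P))) φ) (·-⊙ neg (halfTau Υ h) φ))) ⟩
        (x - ((G P + G P) + (sg P ⊙ G C₂))) - (- x)
          ≈⟨ solve 3 (λ x y l → (x :- ((y :+ y) :+ l)) :- (:- x) := ((x :+ x) :- (y :+ y)) :- l) refl _ _ _ ⟩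
        ((x + x) - (G P + G P)) - (sg P ⊙ G C₂) ∎)
        where
        W = P ⊕ C₂ ⊕ revWalk Υ P
        φ = gain Υ (halfEdge Υ h)
        x = halfTau Υ h ⊙ φ
      handcuffGain-zero-iff (halfE h₁) P (halfE h₂) = double-zero-iff (begin
        ((x₁ + walkGain Υ P) - ((sg P · halfTau Υ h₂) ⊙ φ₂)) + ((x₁ + walkGain Υ P) - ((sg P · halfTau Υ h₂) ⊙ φ₂))
          ≈⟨ +-cong eq eq ⟩
        ((x₁ - G P) - (sg P ⊙ x₂)) + ((x₁ - G P) - (sg P ⊙ x₂)) ≈⟨ lemma (sg P) x₁ (G P) x₂ ⟩
        ((x₁ + x₁) - (G P + G P)) - (sg P ⊙ (x₂ + x₂)) ∎)
        where
        φ₂ = gain Υ (halfEdge Υ h₂)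
        x₁ = halfTau Υ h₁ ⊙ gain Υ (halfEdge Υ h₁)
        x₂ = halfTau Υ h₂ ⊙ φ₂
        eq : (x₁ + walkGain Υ P) - ((sg P · halfTau Υ h₂) ⊙ φ₂) ≈ (x₁ - G P) - (sg P ⊙ x₂)
        eq = +-cong (+-congˡ (walkGain≈ P)) (-‿cong (·-⊙ (sg P) (halfTau Υ h₂) φ₂))
        lemma : ∀ p x y z → ((x - y) - (p ⊙ z)) + ((x - y) - (p ⊙ z)) ≈ ((x + x) - (y + y)) - (p ⊙ (z + z))
        lemma pos = solve 3 (λ x y z → ((x :- y) :- z) :+ ((x :- y) :- z) := ((x :+ x) :- (y :+ y)) :- (z :+ z)) refl
        lemma neg = solve 3 (λ x y z → ((x :- y) :- (:- z)) :+ ((x :- y) :- (:- z)) := ((x :+ x) :- (y :+ y)) :- (:- (z :+ z))) refl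

    posCircle-switch : ∀ θ {x} (C : Walk Υ x x) → sg C ≡ pos →
      partialGain (switchedGain θ) C ≈ partialGain (gain Υ) C
    posCircle-switch θ {x} C s = trans (partialGain-switch θ C)
      (trans (+-congˡ (-‿cong (⊙-≡ s (θ x)))) (solve 2 (λ y x → (y :+ x) :- x := y) refl _ _))

    Neutralizes : (Fin n → Carrier) → (Fin m → Set) → Set ℓ
    Neutralizes θ P = ∀ e → P e → switchedGain θ e ≈ 0#

    -- Switching does not affect whether a sign circuit is neutral, and after switching by `θ` all
    -- gains in `S` vanish.
    neutralizable⇒hyperbalanced : ∀ θ (S : Subset m) → Neutralizes θ (_∈ S) → Hyperbalanced Υ S
    neutralizable⇒hyperbalanced θ S N (posCircle C _ s) C⊆S =
      trans (walkGain≈ C) (trans (-‿cong (trans (sym (posCircle-switch θ C s))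
        (partialGain-zero (switchedGain θ) C (All.map (N _) C⊆S)))) -0#≈0#)
    neutralizable⇒hyperbalanced θ S N (looseEdge e p) (e∈S ∷ []) with N e e∈S
    ... | q rewrite p = q
    neutralizable⇒hyperbalanced θ S N (handcuff H) H⊆S =
      proj₂ (handcuffGain-zero-iff F₁ P F₂) (trans (sym (defect-switch θ F₁ P F₂)) zero-defect)
      where
      open Handcuff H
      zeroes = All.map (N _) H⊆S
      g = switchedGain θ
      zero-defect : defect g F₁ P F₂ ≈ 0#
      zero-defect = +-zeroes
        (+-zeroes (figureConst-zero g F₁ (Allₚ.++⁻ˡ (figEdges Υ F₁) zeroes))
          (trans (-‿cong (+-zeroes P≈0 P≈0)) -0#≈0#))
        (trans (-‿cong (trans (⊙-cong (sg P) (figureConst-zero g F₂ (Allₚ.++⁻ʳ (walkEdges Υ P) PF₂))) (⊙-0 (sg P)))) -0#≈0#)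
        where
        PF₂ = Allₚ.++⁻ʳ (figEdges Υ F₁) zeroes
        P≈0 = partialGain-zero g P (Allₚ.++⁻ˡ (walkEdges Υ P) PF₂)

-- Neutralizing a hyperbalanced set

-- Double negation commutes with finite products, so facts known doubly negated at each vertex may
-- be assumed at all vertices at once.
¬¬-choice : ∀ {p k} {P : Fin k → Set p} → (∀ i → ¬ ¬ P i) → ¬ ¬ (∀ i → P i)
¬¬-choice {k = zero} h c = c λ ()
¬¬-choice {k = suc k} h c = h zero λ p₀ → ¬¬-choice (h ∘ suc) λ ps → c λ { zero → p₀ ; (suc i) → ps i }

module Potentials {c ℓ} (K : Field c ℓ)
  (2≉0 : ¬ (Field._≈_ K (Field._+_ K (Field.1# K) (Field.1# K)) (Field.0# K))) where
  open Field K
  open GainSigned K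
  open Walks K
  open Gains K 2≉0
  open Algebra.Properties.Ring ring using (-0#≈0#; -‿involutive)
  open IntegerSolver commutativeRing

  module _ {n m : ℕ} (Υ : GSG n m) where
    private
      infixr 5 _⊕_
      _⊕_ : ∀ {u v w} → Walk Υ u v → Walk Υ v w → Walk Υ u w
      _⊕_ = _++ʷ_ Υ
      sg : ∀ {u v} → Walk Υ u v → Sign
      sg = walkSign Υ
      edges : ∀ {u v} → Walk Υ u v → List (Fin m)
      edges = walkEdges Υ
      deps verts : ∀ {u v} → Walk Υ u v → List (Fin n)
      deps = departures Υ
      verts = walkVerts Υ

    HyperbalancedOn : (Fin m → Set) → Set ℓ
    HyperbalancedOn P = ∀ (C : SignCircuit Υ) → All P (circuitEdges Υ C) → circuitGain Υ C ≈ 0#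

    null : (Fin n → Carrier) → Fin m → Set ℓ
    null η f = gainSwitchGain η (edge Υ f) 0# ≈ 0#

    -- The indicator of a balanced component, twisted by the signs of walks from z, leaves the
    -- gains of P unchanged as a gain switcher.
    record ComponentSwitcher (P : Fin m → Set) (z : Fin n) : Set (c ⊔ ℓ) where
      field
        η      : Fin n → Carrier
        inside : ∀ {u} (W : Walk Υ z u) → All P (edges W) → η u ≈ sg W ⊙ 1#
        outside : ∀ {u} → ¬ Conn Υ P z u → η u ≈ 0#
        η-null : ∀ f → P f → null η f

    -- The value at `u` is the sign of any walk from `z`, well defined by `balanced-sign`. At a link
    -- or loop of `P` inside the component the two ends cancel because ττ′ = -σ; a half edge there
    -- would be a negative figure.
    componentSwitcher : ∀ P z → ¬ FigureNear Υ P z → ¬ ¬ ComponentSwitcher P z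
    componentSwitcher P z ¬near k = ¬¬-choice {P = λ u → Dec (Conn Υ P z u)} (λ u → ¬¬-excluded-middle) (k ∘ make)
      where
      module _ (conn? : ∀ u → Dec (Conn Υ P z u)) where
        value : ∀ {u} → Dec (Conn Υ P z u) → Carrier
        value (yes (W , _)) = sg W ⊙ 1#
        value (no _) = 0#
        η : Fin n → Carrier
        η u = value (conn? u)
        inside : ∀ {u} (W : Walk Υ z u) → All P (edges W) → η u ≈ sg W ⊙ 1#
        inside {u} W p with conn? u
        ... | yes (V , q) = ⊙-≡ (balanced-sign Υ ¬near V W q p) 1#
        ... | no ¬c = ⊥-elim (¬c (W , p))
        outside : ∀ {u} → ¬ Conn Υ P z u → η u ≈ 0#
        outside {u} ¬c with conn? u
        ... | yes zu = ⊥-elim (¬c zu)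
        ... | no _ = refl
        lemma : ∀ t₁ t₂ x → ((t₁ ⊙ x) + 0#) + (t₂ ⊙ (opp (t₁ · t₂) ⊙ x)) ≈ 0#
        lemma pos pos = solve 1 (λ x → (x :+ con (+ 0)) :+ (:- x) := con (+ 0)) refl
        lemma pos neg = solve 1 (λ x → (x :+ con (+ 0)) :+ (:- x) := con (+ 0)) refl
        lemma neg pos = solve 1 (λ x → ((:- x) :+ con (+ 0)) :+ x := con (+ 0)) refl
        lemma neg neg = solve 1 (λ x → ((:- x) :+ con (+ 0)) :+ (:- (:- x)) := con (+ 0)) refl
        η-null′ : ∀ f → P f → ∀ E → edge Υ f ≡ E → gainSwitchGain η E 0# ≈ 0#
        η-null′ f pf (ends p q t₁ t₂) x with conn? p in eq
        ... | yes (W , W⊆) = trans (+-congˡ (⊙-cong t₂ (trans (inside (W ⊕ fwd f x ∷ []) (All-++ Υ W W⊆ (pf ∷ [])))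
              (trans (⊙-≡ (≡.trans (walkSign-++ Υ W _) (≡.trans (≡.cong (sg W ·_) (≡.trans (·-identityʳ _) (≡.cong edgeSign x))) (·-comm (sg W) _))) 1#)
                (·-⊙ (opp (t₁ · t₂)) (sg W) 1#))))) (lemma t₁ t₂ (sg W ⊙ 1#))
        ... | no ¬c = +-zeroes (+-zeroes (⊙-0 t₁) refl)
              (trans (⊙-cong t₂ (outside (λ zq → ¬c (conn-trans Υ zq (bwd f x ∷ [] , pf ∷ []))))) (⊙-0 t₂))
        η-null′ f pf (half p t) x with conn? p
        ... | yes zu = ⊥-elim (¬near (p , halfE (f , t , x) , pf ∷ [] , conn-sym Υ zu))
        ... | no ¬c = +-zeroes (⊙-0 t) refl
        η-null′ f pf loose x = refl
        make : ComponentSwitcher P z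
        make = record { η = η ; inside = inside ; outside = outside ; η-null = λ f pf → η-null′ f pf (edge Υ f) ≡.refl }

    module ExtendByEdge (L : List (Fin m)) (e : Fin m) (e∉L : e ∉ˡ L) (θ : Fin n → Carrier)
      (neutral : Neutralizes Υ θ (_∈ˡ L)) (hyperbalanced : HyperbalancedOn (_∈ˡ e ∷ L)) where

      g : Fin m → Carrier
      g = switchedGain Υ θ

      P P⁺ : Fin m → Set
      P f = f ∈ˡ L
      P⁺ f = f ∈ˡ e ∷ L

      Goal : Set (c ⊔ ℓ)
      Goal = Σ (Fin n → Carrier) λ θ′ → Neutralizes Υ θ′ P⁺

      weaken : ∀ {xs} → All P xs → All P⁺ xs
      weaken = All.map there

      zero-on : ∀ {xs} → All P xs → All (λ f → g f ≈ 0#) xs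
      zero-on = All.map (neutral _)

      done : g e ≈ 0# → Goal
      done p = θ , λ { f (here ≡.refl) → p ; f (there f∈) → neutral f f∈ }

      adjust : (η : Fin n → Carrier) → (∀ f → P f → null η f) → ¬ null η e → Goal
      adjust η η-null h≉0 = θ′ , λ { f (here ≡.refl) → at-e ; f (there f∈) → at-L f f∈ }
        where
        h = gainSwitchGain η (edge Υ e) 0#
        h⁻¹ = proj₁ (inverse h h≉0)
        -- The solution of `g e + d * h ≈ 0#`, where `h` is the effect of `η` on the new edge.
        d = - (g e) * h⁻¹
        θ′ : Fin n → Carrier
        θ′ v = θ v + d * η v
        split-gain : ∀ f → switchedGain Υ θ′ f ≈ g f + d * gainSwitchGain η (edge Υ f) 0#
        split-gain f = trans (gainSwitchGain-cong (edge Υ f) (λ _ → refl) (sym (+-identityʳ _)))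
          (trans (gainSwitchGain-+ θ (λ v → d * η v) (edge Υ f) (gain Υ f) 0#)
            (+-congˡ (gainSwitchGain-* d η (edge Υ f))))
        at-L : ∀ f → P f → switchedGain Υ θ′ f ≈ 0#
        at-L f f∈ = trans (split-gain f) (+-zeroes (neutral f f∈) (trans (*-congˡ (η-null f f∈)) (zeroʳ d)))
        at-e : switchedGain Υ θ′ e ≈ 0#
        at-e = trans (split-gain e) (trans
          (solve 3 (λ x y z → x :+ ((:- x) :* y) :* z := x :- x :* (z :* y)) refl (g e) h⁻¹ h)
          (trans (+-congˡ (-‿cong (trans (*-congˡ (proj₂ (inverse h h≉0))) (*-identityʳ _)))) (-‿inverseʳ _)))

      module _ {x₁ x₂} (F₁ : Figure Υ x₁) (R : Walk Υ x₁ x₂) (F₂ : Figure Υ x₂)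
        (R-path : IsPath Υ R)
        (meet₁ : ∀ y → y ∈ˡ figVerts Υ F₁ → y ∈ˡ verts R → y ≡ x₁)
        (meet₂ : ∀ y → y ∈ˡ figVerts Υ F₂ → y ∈ˡ verts R → y ≡ x₂)
        (meet₁₂ : ∀ y → y ∈ˡ figVerts Υ F₁ → y ∈ˡ figVerts Υ F₂ → y ∈ˡ verts R)
        (disjoint : Disjoint (figEdges Υ F₁) (figEdges Υ F₂))
        (F₁⊆ : All P⁺ (figEdges Υ F₁)) (R⊆ : All P⁺ (edges R)) (F₂⊆ : All P⁺ (figEdges Υ F₂)) where

        defect≈0 : defect Υ g F₁ R F₂ ≈ 0#
        defect≈0 = trans (defect-switch Υ θ F₁ R F₂) (proj₁ (handcuffGain-zero-iff Υ F₁ R F₂)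
          (hyperbalanced (handcuff (mkHandcuff Υ F₁ R F₂ R-path meet₁ meet₂ meet₁₂ disjoint))
            (Allₚ.++⁺ F₁⊆ (Allₚ.++⁺ R⊆ F₂⊆))))

        -- The vanishing defect is a linear relation between two figures and a path. The new edge
        -- lies in only one of the three, and when the other two are neutral the relation forces the
        -- third: here the second figure, in `partialGain≈0` the path.
        figureConst₂≈0 : figureConst Υ g F₁ ≈ 0# → partialGain Υ g R ≈ 0# → figureConst Υ g F₂ ≈ 0#
        figureConst₂≈0 p q = ⊙-cancel (sg R) (trans (sym (-‿involutive _)) (trans (-‿cong
          (trans (sym (+-identityˡ _)) (trans (+-congʳ (sym (+-zeroes p (trans (-‿cong (+-zeroes q q)) -0#≈0#)))) defect≈0))) -0#≈0#))

        partialGain≈0 : figureConst Υ g F₁ ≈ 0# → figureConst Υ g F₂ ≈ 0# → partialGain Υ g R ≈ 0#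
        partialGain≈0 p q = double-cancel (trans
          (solve 3 (λ x y z → y :+ y := (x :- z) :- ((x :- (y :+ y)) :- z)) refl (figureConst Υ g F₁) (partialGain Υ g R) (sg R ⊙ figureConst Υ g F₂))
          (+-zeroes (+-zeroes p (trans (-‿cong (trans (⊙-cong (sg R) q) (⊙-0 (sg R)))) -0#≈0#)) (trans (-‿cong defect≈0) -0#≈0#)))

      -- Every arc except `a` is neutral already, so the total is the gain of `e` up to sign.
      gain-through : ∀ {u v w x} (V : Walk Υ u v) (a : Arc Υ v w) (W : Walk Υ w x) → arcEdge Υ a ≡ e →
        All P (edges V) → All P (edges W) → partialGain Υ g (V ⊕ a ∷ W) ≈ 0# → g e ≈ 0#
      gain-through V a W ≡.refl V⊆ W⊆ p = ⊙-cancel (arcTau Υ a) (⊙-cancel (sg V) (trans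
        (sym (trans (partialGain-++ Υ g V (a ∷ W)) (trans (+-cong (partialGain-zero Υ g V (zero-on V⊆))
          (⊙-cong (sg V) (trans (+-congˡ (trans (⊙-cong (σ Υ e) (partialGain-zero Υ g W (zero-on W⊆))) (⊙-0 (σ Υ e))))
            (+-identityʳ _)))) (+-identityˡ _)))) p))

      closing : ∀ {v w} (a : Arc Υ w v) → arcEdge Υ a ≡ e → PathWith Υ P (λ t → σ Υ e · t ≡ pos) v w → g e ≈ 0#
      closing a ≡.refl (pathWith Q Q-path Q⊆ positive) = gain-through [] a Q ≡.refl [] Q⊆
        (trans (posCircle-switch Υ θ (a ∷ Q) positive)
          (trans (sym (-‿involutive _)) (trans (-‿cong (trans (sym (walkGain≈ Υ (a ∷ Q)))
            (hyperbalanced (posCircle (a ∷ Q) (circle-arc Υ a Q Q-path (λ e∈ → e∉L (All.lookup Q⊆ e∈))) positive)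
              (here ≡.refl ∷ weaken Q⊆)))) -0#≈0#)))

      -- The circle through `e` is either positive, a circuit by itself, or negative; then, based at
      -- `q`, it is the second figure of a handcuff whose tail and first figure are neutral.
      tadpole-neutral : ∀ {v w} (a : Arc Υ w v) → arcEdge Υ a ≡ e → Tadpole Υ P v w → g e ≈ 0#
      tadpole-neutral {v} {w} a ≡.refl T with sign-cases (walkSign Υ (a ∷ Tadpole.Q₁ T ⊕ Tadpole.Q₂ T))
      ... | inj₁ positive = closing a ≡.refl (pathWith (Q₁ ⊕ Q₂) Q-path (All-++ Υ Q₁ Q₁⊆ Q₂⊆) positive)
        where open Tadpole T
      ... | inj₂ negative = gain-through Q₂ a Q₁ ≡.refl Q₂⊆ Q₁⊆
        (figureConst₂≈0 F R circle R-path meetF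
          (λ y y∈C → meetQ y (C⊆Q y∈C)) (λ y y∈F y∈C → meetFQ y y∈F (C⊆Q y∈C))
          edges-disjoint (weaken F⊆) (weaken R⊆) (All-++ Υ Q₂ (weaken Q₂⊆) (here ≡.refl ∷ weaken Q₁⊆))
          (figureConst-zero Υ g F (zero-on F⊆)) (partialGain-zero Υ g R (zero-on R⊆)))
        where
        open Tadpole T
        Q⊆ = All-++ Υ Q₁ Q₁⊆ Q₂⊆
        circle : Figure Υ q
        circle = circ (Q₂ ⊕ a ∷ Q₁)
          (circle-rotate Υ (a ∷ Q₁) Q₂ (circle-arc Υ a (Q₁ ⊕ Q₂) Q-path (λ e∈ → e∉L (All.lookup Q⊆ e∈))))
          (≡.trans (walkSign-rotate Υ (a ∷ Q₁) Q₂) negative)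
        C⊆Q : ∀ {y} → y ∈ˡ deps (Q₂ ⊕ a ∷ Q₁) → y ∈ˡ verts (Q₁ ⊕ Q₂)
        C⊆Q {y} y∈ = ≡.subst (y ∈ˡ_) (≡.sym (walkVerts-++ Υ Q₁ Q₂))
          ([ (λ y∈Q₂ → ∈-++⁺ʳ (deps Q₁) (∈-++⁺ˡ y∈Q₂))
           , (λ { (here ≡.refl) → ∈-++⁺ʳ (deps Q₁) (end∈ Υ Q₂) ; (there y∈Q₁) → ∈-++⁺ˡ y∈Q₁ }) ]′
           (∈-++⁻ (deps Q₂) (≡.subst (y ∈ˡ_) (departures-++ Υ Q₂ (a ∷ Q₁)) y∈)))
        Q-edge : ∀ {f} → f ∈ˡ edges (Q₂ ⊕ a ∷ Q₁) → f ≡ e ⊎ f ∈ˡ edges (Q₁ ⊕ Q₂)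
        Q-edge {f} f∈ with ∈-++⁻ (edges Q₂) (≡.subst (f ∈ˡ_) (walkEdges-++ Υ Q₂ (a ∷ Q₁)) f∈)
        ... | inj₁ p = inj₂ (≡.subst (f ∈ˡ_) (≡.sym (walkEdges-++ Υ Q₁ Q₂)) (∈-++⁺ʳ (edges Q₁) p))
        ... | inj₂ (here p) = inj₁ p
        ... | inj₂ (there p) = inj₂ (≡.subst (f ∈ˡ_) (≡.sym (walkEdges-++ Υ Q₁ Q₂)) (∈-++⁺ˡ p))
        -- A common edge would have both ends at q, whereas a path contains no loop.
        edges-disjoint : Disjoint (figEdges Υ F) (edges (Q₂ ⊕ a ∷ Q₁))
        edges-disjoint (f∈F , f∈C) with Q-edge f∈C
        ... | inj₁ ≡.refl = e∉L (All.lookup F⊆ f∈F)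
        ... | inj₂ f∈Q with walkEdges-ends Υ (Q₁ ⊕ Q₂) f∈Q
        ...   | p , r , t₁ , t₂ , x = path-noLoop Υ (Q₁ ⊕ Q₂) Q-path f∈Q x (≡.trans (at-q p∈F p∈Q) (≡.sym (at-q r∈F r∈Q)))
          where
          p∈F = proj₁ (figEdges-verts Υ F f∈F x)
          r∈F = proj₂ (figEdges-verts Υ F f∈F x)
          p∈Q = proj₁ (walkEdges-verts Υ (Q₁ ⊕ Q₂) f∈Q x)
          r∈Q = proj₂ (walkEdges-verts Υ (Q₁ ⊕ Q₂) f∈Q x)
          at-q : ∀ {y} → y ∈ˡ figVerts Υ F → y ∈ˡ verts (Q₁ ⊕ Q₂) → y ≡ q
          at-q y∈F y∈Q = meetQ _ y∈Q (meetFQ _ y∈F y∈Q)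

      -- Each end of `e` can reach a negative figure on its own side, which gives a handcuff with
      -- `e` on its path. That `v` and `w` lie in different components keeps the two sides disjoint.
      bridge-neutral : ∀ {v w} (a : Arc Υ v w) → arcEdge Υ a ≡ e → ¬ Conn Υ P v w →
        FigureNear Υ P v → FigureNear Υ P w → g e ≈ 0#
      bridge-neutral {v} {w} a ≡.refl ¬vw (_ , F₁ , F₁⊆ , c₁) (_ , F₂ , F₂⊆ , c₂) =
        gain-through A₁.R a R₂ ≡.refl A₁.R⊆ R₂⊆
          (partialGain≈0 A₁.F R A₂.F R-path meet₁ meet₂ (λ y p q → ⊥-elim (apart (near-F₁ p) (near-F₂ q)))
            (figEdges-disjoint Υ A₁.F A₂.F (λ (p , q) → apart (near-F₁ p) (near-F₂ q)))
            (weaken A₁.F⊆) (All-++ Υ A₁.R (weaken A₁.R⊆) (here ≡.refl ∷ weaken R₂⊆)) (weaken A₂.F⊆)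
            (figureConst-zero Υ g A₁.F (zero-on A₁.F⊆)) (figureConst-zero Υ g A₂.F (zero-on A₂.F⊆)))
        where
        module A₁ = Attached (attach Υ F₁ F₁⊆ c₁)
        module A₂ = Attached (attach Υ F₂ F₂⊆ c₂)
        R₂ = revWalk Υ A₂.R
        R₂⊆ = All-rev Υ A₂.R A₂.R⊆
        R = A₁.R ⊕ a ∷ R₂
        apart : ∀ {y} → Conn Υ P y v → Conn Υ P y w → ⊥
        apart yv yw = ¬vw (conn-trans Υ (conn-sym Υ yv) yw)
        near-F₁ : ∀ {y} → y ∈ˡ figVerts Υ A₁.F → Conn Υ P y v
        near-F₁ y∈ = conn-trans Υ (conn-sym Υ (figVerts-conn Υ A₁.F A₁.F⊆ y∈)) (A₁.R , A₁.R⊆)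
        near-F₂ : ∀ {y} → y ∈ˡ figVerts Υ A₂.F → Conn Υ P y w
        near-F₂ y∈ = conn-trans Υ (conn-sym Υ (figVerts-conn Υ A₂.F A₂.F⊆ y∈)) (A₂.R , A₂.R⊆)
        near-R₁ : ∀ {y} → y ∈ˡ verts A₁.R → Conn Υ P y v
        near-R₁ y∈ = conn-trans Υ (conn-sym Υ (walkVerts-conn Υ A₁.R A₁.R⊆ y∈)) (A₁.R , A₁.R⊆)
        near-R₂ : ∀ {y} → y ∈ˡ verts R₂ → Conn Υ P y w
        near-R₂ y∈ = conn-sym Υ (walkVerts-conn Υ R₂ R₂⊆ y∈)
        R-verts : verts R ≡ verts A₁.R ++ verts R₂
        R-verts = ≡.trans (walkVerts-++ Υ A₁.R (a ∷ R₂)) (≡.sym (Listₚ.++-assoc (deps A₁.R) [ v ] (verts R₂)))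
        R-path : IsPath Υ R
        R-path = ≡.subst Unique (≡.sym R-verts)
          (Uniqueₚ.++⁺ A₁.R-path (IsPath-rev Υ A₂.R A₂.R-path) (λ (p , q) → apart (near-R₁ p) (near-R₂ q)))
        R-cases : ∀ {y} → y ∈ˡ verts R → y ∈ˡ verts A₁.R ⊎ y ∈ˡ verts R₂
        R-cases {y} y∈ = ∈-++⁻ (verts A₁.R) (≡.subst (y ∈ˡ_) R-verts y∈)
        meet₁ : ∀ y → y ∈ˡ figVerts Υ A₁.F → y ∈ˡ verts R → y ≡ A₁.x
        meet₁ y y∈F y∈R = [ A₁.meet y y∈F , (λ q → ⊥-elim (apart (near-F₁ y∈F) (near-R₂ q))) ]′ (R-cases y∈R)
        meet₂ : ∀ y → y ∈ˡ figVerts Υ A₂.F → y ∈ˡ verts R → y ≡ A₂.x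
        meet₂ y y∈F y∈R = [ (λ p → ⊥-elim (apart (near-R₁ p) (near-F₂ y∈F)))
                          , (λ q → A₂.meet y y∈F (Permₚ.∈-resp-↭ (walkVerts-rev Υ A₂.R) q)) ]′ (R-cases y∈R)

      -- The half edge itself is the second figure; its `figureConst` is twice its gain up to sign,
      -- whence the division by 2.
      half-neutral : ∀ {v} (h : HalfAt Υ v) → halfEdge Υ h ≡ e → FigureNear Υ P v → g e ≈ 0#
      half-neutral {v} h ≡.refl (_ , F , F⊆ , xv) = ⊙-cancel (halfTau Υ h) (double-cancel
        (figureConst₂≈0 A.F A.R (halfE h) A.R-path A.meet (λ { y (here y≡v) _ → y≡v }) (λ { y _ (here ≡.refl) → end∈ Υ A.R })
          (λ { (f∈F , here ≡.refl) → e∉L (All.lookup A.F⊆ f∈F) })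
          (weaken A.F⊆) (weaken A.R⊆) (here ≡.refl ∷ [])
          (figureConst-zero Υ g A.F (zero-on A.F⊆)) (partialGain-zero Υ g A.R (zero-on A.R⊆))))
        where module A = Attached (attach Υ F F⊆ xv)

      1⊙≉0 : ∀ s → ¬ (s ⊙ 1# ≈ 0#)
      1⊙≉0 s p = 1≉0 (⊙-cancel s p)

      extend : ¬ ¬ Goal
      extend k = by-edge (edge Υ e) ≡.refl
        where
        by-edge : ∀ E → edge Υ e ≡ E → ⊥
        by-edge loose x = k (done (trans (reflexive (≡.cong (λ E → gainSwitchGain θ E (gain Υ e)) x))
          (hyperbalanced (looseEdge e x) (here ≡.refl ∷ []))))
        by-edge (half v t) x = ¬¬-excluded-middle {A = FigureNear Υ P v} λ where
          (yes near) → k (done (half-neutral (e , t , x) ≡.refl near))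
          (no ¬near) → componentSwitcher P v ¬near λ H → let open ComponentSwitcher H in
            k (adjust η η-null λ z → 1⊙≉0 t (trans (⊙-cong t (sym (inside [] [])))
              (trans (sym (+-identityʳ _)) (trans (reflexive (≡.cong (λ E → gainSwitchGain η E 0#) (≡.sym x))) z))))
        by-edge (ends v w t₁ t₂) x = ¬¬-excluded-middle {A = Conn Υ P v w} λ where
            (yes vw) → connected vw
            (no ¬vw) → ¬¬-excluded-middle {A = FigureNear Υ P v} λ where
              -- `w` lies outside the component of `v`, so `e` sees the switcher at one end only,
              -- with the invertible effect ±1.
              (no ¬near) → componentSwitcher P v ¬near λ H → let open ComponentSwitcher H in
                k (adjust η η-null λ z → 1⊙≉0 t₁ (trans
                  (trans (solve 1 (λ a → a := (a :+ con (+ 0)) :+ con (+ 0)) refl (t₁ ⊙ 1#))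
                    (+-cong (+-congʳ (⊙-cong t₁ (sym (inside [] [])))) (sym (trans (⊙-cong t₂ (outside ¬vw)) (⊙-0 t₂)))))
                  (trans (at-ends η) z)))
              (yes near-v) → ¬¬-excluded-middle {A = FigureNear Υ P w} λ where
                (no ¬near) → componentSwitcher P w ¬near λ H → let open ComponentSwitcher H in
                  k (adjust η η-null λ z → 1⊙≉0 t₂ (trans
                    (trans (solve 1 (λ a → a := (con (+ 0) :+ con (+ 0)) :+ a) refl (t₂ ⊙ 1#))
                      (+-cong (+-congʳ (sym (trans (⊙-cong t₁ (outside (¬vw ∘ conn-sym Υ))) (⊙-0 t₁)))) (⊙-cong t₂ (sym (inside [] [])))))
                    (trans (at-ends η) z)))
                (yes near-w) → k (done (bridge-neutral (fwd e x) ≡.refl ¬vw near-v near-w))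
          where
          at-ends : ∀ η → ((t₁ ⊙ η v) + 0#) + (t₂ ⊙ η w) ≈ gainSwitchGain η (edge Υ e) 0#
          at-ends η = reflexive (≡.cong (λ E → gainSwitchGain η E 0#) (≡.sym x))
          -- Here `e` closes a negative circle in a balanced component: both ends contribute with
          -- the same sign, so the effect of the switcher on `e` is ±2 rather than 0.
          twice≉0 : ∀ s → opp (t₁ · t₂) · s ≡ neg → ¬ (((t₁ ⊙ 1#) + 0#) + (t₂ ⊙ (s ⊙ 1#)) ≈ 0#)
          twice≉0 s p q = 1⊙≉0 t₁ (double-cancel (trans (trans (+-cong (sym (+-identityʳ _)) (same t₁ t₂ s p)) refl) q))
            where
            same : ∀ t₁ t₂ s → opp (t₁ · t₂) · s ≡ neg → t₁ ⊙ 1# ≈ t₂ ⊙ (s ⊙ 1#)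
            same pos pos pos _ = refl
            same pos neg neg _ = sym (-‿involutive 1#)
            same neg pos neg _ = refl
            same neg neg pos _ = refl
          connected : Conn Υ P v w → ⊥
          connected (W , W⊆) with erase Υ W W⊆
          ... | Q , Q-path , Q⊆ with sign-cases (σ Υ e · sg Q)
          ...   | inj₁ positive = k (done (closing (bwd e x) ≡.refl (pathWith Q Q-path Q⊆ positive)))
          ...   | inj₂ negative = ¬¬-excluded-middle {A = FigureNear Υ P v} λ where
            (no ¬near) → componentSwitcher P v ¬near λ H → let open ComponentSwitcher H in
              k (adjust η η-null λ z → twice≉0 (sg Q) (≡.trans (≡.cong (λ E → edgeSign E · sg Q) (≡.sym x)) negative)
                (trans (+-cong (+-congʳ (⊙-cong t₁ (sym (inside [] [])))) (⊙-cong t₂ (sym (inside Q Q⊆))))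
                  (trans (at-ends η) z)))
            (yes (_ , F , F⊆ , xv)) → [ (λ p → k (done (closing (bwd e x) ≡.refl p)))
                                      , (λ T → k (done (tadpole-neutral (bwd e x) ≡.refl T))) ]′
                                      (thetaOrTadpole Υ (σ Υ e) Q Q-path Q⊆ F F⊆ xv)

    hyperbalancedOn⇒neutralizable : ∀ L → HyperbalancedOn (_∈ˡ L) →
      ¬ ¬ Σ (Fin n → Carrier) λ θ → Neutralizes Υ θ (_∈ˡ L)
    hyperbalancedOn⇒neutralizable [] H k = k ((λ _ → 0#) , λ _ ())
    hyperbalancedOn⇒neutralizable (e ∷ L) H k =
      hyperbalancedOn⇒neutralizable L (λ C C⊆ → H C (All.map there C⊆)) λ (θ , N) → step θ N
      where
      step : ∀ θ → Neutralizes Υ θ (_∈ˡ L) → ⊥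
      step θ N with e ∈ˡ? L
      ... | yes e∈L = k (θ , λ { f (here ≡.refl) → N f e∈L ; f (there f∈) → N f f∈ })
      ... | no e∉L = ExtendByEdge.extend L e e∉L θ N H k

    hyperbalanced⇒neutralizable : ∀ S → Hyperbalanced Υ S → ¬ ¬ Σ (Fin n → Carrier) λ θ → Neutralizes Υ θ (_∈ S)
    hyperbalanced⇒neutralizable S H k = hyperbalancedOn⇒neutralizable (filter (_∈? S) (allFin m))
      (λ C C⊆ → H C (All.map (λ e∈ → proj₂ (∈-filter⁻ (_∈? S) {xs = allFin m} e∈)) C⊆))
      λ (θ , N) → k (θ , λ e e∈S → N e (∈-filter⁺ (_∈? S) (∈-allFin e) e∈S))

-- Contraction

just-or-nothing : ∀ {a} {A : Set a} (x : Maybe A) → (Σ A λ y → x ≡ just y) ⊎ x ≡ nothing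
just-or-nothing (just y) = inj₁ (y , ≡.refl)
just-or-nothing nothing = inj₂ ≡.refl

switched-sign : ∀ a t b u → opp ((a · t) · (b · u)) ≡ a · (opp (t · u) · b)
switched-sign a t b u = ≡.trans
  (≡.cong opp (≡.trans (·-assoc a t (b · u)) (≡.cong (a ·_) (≡.trans (≡.cong (t ·_) (·-comm b u)) (≡.sym (·-assoc t u b))))))
  (≡.trans (≡.sym (opp-·ʳ a _)) (≡.cong (a ·_) (≡.sym (opp-·ˡ (t · u) b))))

·≡pos : ∀ a s b → a · (s · b) ≡ pos → s ≡ a · b
·≡pos pos pos pos p = p
·≡pos pos neg neg p = ≡.refl
·≡pos neg pos neg p = ≡.refl
·≡pos neg neg pos p = ≡.refl

conjugate-sign : ∀ a s → a · (s · a) ≡ s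
conjugate-sign a s = ≡.trans (≡.cong (a ·_) (·-comm s a)) (·-cancelˡ a s)

-- Balanced blocks under contraction

module Blocks {c ℓ} (K : Field c ℓ) where
  open GainSigned K
  open Walks K

  module _ {n m} (Υ : GSG n m) (S : Subset m) where
    balanced⇒¬near : ∀ {v} → SignBalancedAt Υ S v → ¬ FigureNear Υ (_∈ S) v
    balanced⇒¬near (¬circ , _) (x , circ C c s , C⊆ , xv) = ¬circ x C c s C⊆ xv
    balanced⇒¬near (_ , ¬half) (x , halfE h , h∈ ∷ [] , xv) = ¬half x h h∈ xv

    ¬near⇒balanced : ∀ {v} → ¬ FigureNear Υ (_∈ S) v → SignBalancedAt Υ S v
    ¬near⇒balanced ¬near = (λ x C c s C⊆ xv → ¬near (x , circ C c s , C⊆ , xv))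
                         , (λ x h h∈ xv → ¬near (x , halfE h , h∈ ∷ [] , xv))

    unbalanced⇒near : ∀ {v} → ¬ SignBalancedAt Υ S v → ¬ ¬ FigureNear Υ (_∈ S) v
    unbalanced⇒near ¬bal ¬near = ¬bal (¬near⇒balanced ¬near)

  -- Lifting or contracting a negative circle gives only a closed walk of negative sign. It cannot
  -- erase to the empty path with its sign preserved, so the erasure meets a negative figure.
  closedNegative⇒near : ∀ {n m} (Υ : GSG n m) {P : Fin m → Set} {u} (W : Walk Υ u u) → All P (walkEdges Υ W) →
    walkSign Υ W ≡ neg → FigureNear Υ P u
  closedNegative⇒near Υ W W⊆ s with signedPath Υ W W⊆
  ... | inj₁ near = near
  ... | inj₂ (pathWith W′ path _ s′) rewrite closedPath-empty Υ W′ path = ⊥-elim (pos≢neg (≡.trans s′ s))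

  figureNear-mono : ∀ {n m} (Υ : GSG n m) {P Q : Fin m → Set} → (∀ {e} → P e → Q e) → ∀ {v} → FigureNear Υ P v → FigureNear Υ Q v
  figureNear-mono Υ P⊆Q (x , F , F⊆ , W , W⊆) = x , F , All.map P⊆Q F⊆ , W , All.map P⊆Q W⊆

  -- Of a contraction only the data on edges and signs are assumed. This leaves the gains to a later
  -- stage and admits the trivial contraction by `∅` as an instance.
  module Contracted {n m b : ℕ} (Υ : GSG n m) (S : Subset m) (Υ′ : GSG b m) (T : Subset m)
    (blocks : BalancedBlocks Υ S b) (ζ : Fin n → Sign)
    (positive : ∀ e v w t₁ t₂ i → e ∈ S → edge Υ e ≡ ends v w t₁ t₂ → BalancedBlocks.β blocks v ≡ just i →
      opp ((ζ v · t₁) · (ζ w · t₂)) ≡ pos)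
    (contracted : ∀ e → e ∈ T → edge Υ′ e ≡ contractEdge (BalancedBlocks.β blocks) (signSwitchEdge ζ (edge Υ e)))
    where
    open BalancedBlocks blocks
    private
      infixr 5 _⊕_
      _⊕_ : ∀ {u v w} → Walk Υ u v → Walk Υ v w → Walk Υ u w
      _⊕_ = _++ʷ_ Υ

    TS : Fin m → Set
    TS e = e ∈ T ∪ S

    S⊆TS : ∀ {e} → e ∈ S → TS e
    S⊆TS = q⊆p∪q T S
    T⊆TS : ∀ {e} → e ∈ T → TS e
    T⊆TS = p⊆p∪q S

    block-unique : ∀ {v i j} → β v ≡ just i → β v ≡ just j → i ≡ j
    block-unique p q = just-injective (≡.trans (≡.sym p) q)

    -- `sameBlock` speaks only of vertices known to lie in blocks. If `w` lay in none, a negative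
    -- figure near `w` would also be near `u`.
    block-closed : ∀ {u w i} → β u ≡ just i → Conn Υ (_∈ S) u w → β w ≡ just i
    block-closed {u} {w} {i} βu uw with just-or-nothing (β w)
    ... | inj₁ (j , βw) = ≡.trans βw (≡.cong just (≡.sym (proj₂ (sameBlock u w i j βu βw) uw)))
    ... | inj₂ βw = ⊥-elim (unbal w βw (¬near⇒balanced Υ S λ near →
            balanced⇒¬near Υ S (bal u i βu) (figureNear-trans Υ near (conn-sym Υ uw))))

    block-arcSign : ∀ {u w i} (a : Arc Υ u w) → arcEdge Υ a ∈ S → β u ≡ just i → σ Υ (arcEdge Υ a) ≡ ζ u · ζ w
    block-arcSign {u} {w} {i} (fwd e {t₁ = t₁} {t₂} x) e∈ βu = ≡.trans (≡.cong edgeSign x)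
      (·≡pos (ζ u) _ (ζ w) (≡.trans (≡.sym (switched-sign (ζ u) t₁ (ζ w) t₂)) (positive e u w t₁ t₂ i e∈ x βu)))
    block-arcSign {u} {w} {i} a@(bwd e {t₁ = t₁} {t₂} x) e∈ βu = ≡.trans (≡.cong edgeSign x) (≡.trans
      (·≡pos (ζ w) _ (ζ u) (≡.trans (≡.sym (switched-sign (ζ w) t₁ (ζ u) t₂))
        (positive e w u t₁ t₂ i e∈ x (block-closed βu (a ∷ [] , e∈ ∷ [])))))
      (·-comm (ζ w) (ζ u)))

    block-walkSign : ∀ {u w i} (W : Walk Υ u w) → All (_∈ S) (walkEdges Υ W) → β u ≡ just i → walkSign Υ W ≡ ζ u · ζ w
    block-walkSign {u} [] [] βu = ≡.sym (·-square (ζ u))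
    block-walkSign {u} {w} (_∷_ {v = v} a W) (e∈ ∷ W⊆) βu = ≡.trans
      (≡.cong₂ _·_ (block-arcSign a e∈ βu) (block-walkSign W W⊆ (block-closed βu (a ∷ [] , e∈ ∷ []))))
      (≡.trans (·-assoc (ζ u) (ζ v) _) (≡.cong (ζ u ·_) (·-cancelˡ (ζ v) (ζ w))))

    block-conn : ∀ {u w i} → β u ≡ just i → β w ≡ just i → Conn Υ (_∈ S) u w
    block-conn {u} {w} {i} βu βw = proj₁ (sameBlock u w i i βu βw) ≡.refl

    contract-ends : ∀ {v w i j t₁ t₂} → β v ≡ just i → β w ≡ just j → contractEdge β (ends v w t₁ t₂) ≡ ends i j t₁ t₂
    contract-ends p q rewrite p | q = ≡.refl

    contract-half₁ : ∀ {v w i t₁ t₂} → β v ≡ just i → β w ≡ nothing → contractEdge β (ends v w t₁ t₂) ≡ half i t₁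
    contract-half₁ p q rewrite p | q = ≡.refl

    contract-half₂ : ∀ {v w j t₁ t₂} → β v ≡ nothing → β w ≡ just j → contractEdge β (ends v w t₁ t₂) ≡ half j t₂
    contract-half₂ p q rewrite p | q = ≡.refl

    contract-half : ∀ {v i t} → β v ≡ just i → contractEdge β (half v t) ≡ half i t
    contract-half p rewrite p = ≡.refl

    contracted-≡ : ∀ {e E} → e ∈ T → edge Υ e ≡ E → edge Υ′ e ≡ contractEdge β (signSwitchEdge ζ E)
    contracted-≡ e∈ x = ≡.trans (contracted _ e∈) (≡.cong (contractEdge β ∘ signSwitchEdge ζ) x)

    contract-ends⁻ : ∀ E {i j t₁ t₂} → contractEdge β (signSwitchEdge ζ E) ≡ ends i j t₁ t₂ →
      Σ (Fin n) λ v → Σ (Fin n) λ w → Σ Sign λ s₁ → Σ Sign λ s₂ → E ≡ ends v w s₁ s₂ ×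
        β v ≡ just i × β w ≡ just j × t₁ ≡ ζ v · s₁ × t₂ ≡ ζ w · s₂
    contract-ends⁻ (ends v w s₁ s₂) p with β v in βv | β w in βw
    contract-ends⁻ (ends v w s₁ s₂) ≡.refl | just i | just j = v , w , s₁ , s₂ , ≡.refl , βv , βw , ≡.refl , ≡.refl
    contract-ends⁻ (ends v w s₁ s₂) () | just i | nothing
    contract-ends⁻ (ends v w s₁ s₂) () | nothing | just j
    contract-ends⁻ (ends v w s₁ s₂) () | nothing | nothing
    contract-ends⁻ (half v s) p with β v
    contract-ends⁻ (half v s) () | just i
    contract-ends⁻ (half v s) () | nothing

    -- In the second alternative the edge lost its other end to an unbalanced component. The arc is
    -- oriented out of that component, since a negative figure is later fetched from there.
    contract-half⁻ : ∀ {e i t} → contractEdge β (signSwitchEdge ζ (edge Υ e)) ≡ half i t →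
      Σ (Fin n) λ v → β v ≡ just i × ((Σ Sign λ s → edge Υ e ≡ half v s)
        ⊎ Σ (Fin n) λ w → β w ≡ nothing × Σ (Arc Υ w v) λ a → arcEdge Υ a ≡ e)
    contract-half⁻ {e} p with edge Υ e in x
    contract-half⁻ {e} p | ends v w s₁ s₂ with β v in βv | β w in βw
    contract-half⁻ {e} () | ends v w s₁ s₂ | just i | just j
    contract-half⁻ {e} ≡.refl | ends v w s₁ s₂ | just i | nothing = v , βv , inj₂ (w , βw , bwd e x , ≡.refl)
    contract-half⁻ {e} ≡.refl | ends v w s₁ s₂ | nothing | just j = w , βw , inj₂ (v , βv , fwd e x , ≡.refl)
    contract-half⁻ {e} () | ends v w s₁ s₂ | nothing | nothing
    contract-half⁻ {e} p | half v s with β v in βv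
    contract-half⁻ {e} ≡.refl | half v s | just i = v , βv , inj₁ (s , ≡.refl)
    contract-half⁻ {e} () | half v s | nothing

    contractArc : ∀ {u w i j} (a : Arc Υ u w) → arcEdge Υ a ∈ T → β u ≡ just i → β w ≡ just j →
      Σ (Arc Υ′ i j) λ a′ → arcEdge Υ′ a′ ≡ arcEdge Υ a × σ Υ′ (arcEdge Υ a) ≡ ζ u · (σ Υ (arcEdge Υ a) · ζ w)
    contractArc {u} {w} (fwd e {t₁ = t₁} {t₂} x) e∈ βu βw = fwd e x′ , ≡.refl , ≡.trans (≡.cong edgeSign x′)
        (≡.trans (switched-sign (ζ u) t₁ (ζ w) t₂) (≡.cong (λ E → ζ u · (edgeSign E · ζ w)) (≡.sym x)))
      where x′ = ≡.trans (contracted-≡ e∈ x) (contract-ends βu βw)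
    contractArc {u} {w} (bwd e {t₁ = t₁} {t₂} x) e∈ βu βw = bwd e x′ , ≡.refl , ≡.trans (≡.cong edgeSign x′)
        (≡.trans (≡.cong opp (·-comm (ζ w · t₁) (ζ u · t₂))) (≡.trans (switched-sign (ζ u) t₂ (ζ w) t₁)
          (≡.cong (λ s → ζ u · (s · ζ w)) (≡.trans (≡.cong opp (·-comm t₂ t₁)) (≡.cong edgeSign (≡.sym x))))))
      where x′ = ≡.trans (contracted-≡ e∈ x) (contract-ends βw βu)

    liftArc : ∀ {i j} (a′ : Arc Υ′ i j) → arcEdge Υ′ a′ ∈ T → Σ (Fin n) λ u → Σ (Fin n) λ w → β u ≡ just i × β w ≡ just j ×
      Σ (Arc Υ u w) λ a → arcEdge Υ a ≡ arcEdge Υ′ a′ × σ Υ′ (arcEdge Υ′ a′) ≡ ζ u · (σ Υ (arcEdge Υ′ a′) · ζ w)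
    liftArc (fwd e x′) e∈ with contract-ends⁻ (edge Υ e) (≡.trans (≡.sym (contracted e e∈)) x′)
    ... | u , w , _ , _ , x , βu , βw , _ = u , w , βu , βw , fwd e x , ≡.refl , proj₂ (proj₂ (contractArc (fwd e x) e∈ βu βw))
    liftArc (bwd e x′) e∈ with contract-ends⁻ (edge Υ e) (≡.trans (≡.sym (contracted e e∈)) x′)
    ... | u , w , _ , _ , x , βu , βw , _ = w , u , βw , βu , bwd e x , ≡.refl , proj₂ (proj₂ (contractArc (bwd e x) e∈ βw βu))

    -- Consecutive arcs of `W′` meet in a block, but their lifts need not meet in a vertex. The gaps
    -- are bridged by walks of `S` inside the block, whose signs are given by `ζ` alone, so the
    -- intermediate values of `ζ` cancel.
    liftWalk : ∀ {i j} (W′ : Walk Υ′ i j) → All (_∈ T) (walkEdges Υ′ W′) → ∀ {u w} → β u ≡ just i → β w ≡ just j →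
      Σ (Walk Υ u w) λ W → All TS (walkEdges Υ W) × walkSign Υ W ≡ ζ u · (walkSign Υ′ W′ · ζ w)
    liftWalk [] [] βu βw with block-conn βu βw
    ... | V , V⊆ = V , All.map S⊆TS V⊆ , block-walkSign V V⊆ βu
    liftWalk (a′ ∷ W′) (e∈ ∷ W′⊆) {u} {w} βu βw with liftArc a′ e∈
    ... | p , q , βp , βq , a , a≡ , s with block-conn βu βp | liftWalk W′ W′⊆ βq βw
    ...   | V , V⊆ | W , W⊆ , sW = V ⊕ a ∷ W ,
            All-++ Υ V (All.map S⊆TS V⊆) (≡.subst TS (≡.sym a≡) (T⊆TS e∈) ∷ W⊆) , (begin
              walkSign Υ (V ⊕ a ∷ W)
                ≡⟨ walkSign-++ Υ V (a ∷ W) ⟩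
              walkSign Υ V · (σ Υ (arcEdge Υ a) · walkSign Υ W)
                ≡⟨ ≡.cong₂ _·_ (block-walkSign V V⊆ βu) (≡.cong₂ _·_ (≡.cong (σ Υ) a≡) sW) ⟩
              (ζ u · ζ p) · (σ Υ (arcEdge Υ′ a′) · (ζ q · (walkSign Υ′ W′ · ζ w)))
                ≡⟨ regroup (ζ u) (ζ p) _ (ζ q) (walkSign Υ′ W′) (ζ w) ⟩
              ζ u · (((ζ p · (σ Υ (arcEdge Υ′ a′) · ζ q)) · walkSign Υ′ W′) · ζ w)
                ≡⟨ ≡.cong (λ t → ζ u · ((t · walkSign Υ′ W′) · ζ w)) s ⟨
              ζ u · ((σ Υ′ (arcEdge Υ′ a′) · walkSign Υ′ W′) · ζ w) ∎)
      where
      open ≡.≡-Reasoning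
      regroup : ∀ a p s q t u → (a · p) · (s · (q · (t · u))) ≡ a · (((p · (s · q)) · t) · u)
      regroup a p s q t u rewrite ·-assoc (p · (s · q)) t u | ·-assoc p (s · q) (t · u) | ·-assoc s q (t · u) =
        ·-assoc a p _

    lift-conn : ∀ {i j u w} → Conn Υ′ (_∈ T) i j → β u ≡ just i → β w ≡ just j → Conn Υ TS u w
    lift-conn (W′ , W′⊆) βu βw with liftWalk W′ W′⊆ βu βw
    ... | W , W⊆ , _ = W , W⊆

    half-near : ∀ {i e t} → e ∈ T → edge Υ′ e ≡ half i t → FigureNear Υ′ (_∈ T) i
    half-near e∈ x = _ , halfE (_ , _ , x) , e∈ ∷ [] , [] , []

    escaping-near : ∀ {u w i} (a : Arc Υ u w) → arcEdge Υ a ∈ T → β u ≡ just i → β w ≡ nothing → FigureNear Υ′ (_∈ T) i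
    escaping-near (fwd e x) e∈ βu βw = half-near e∈ (≡.trans (contracted-≡ e∈ x) (contract-half₁ βu βw))
    escaping-near (bwd e x) e∈ βu βw = half-near e∈ (≡.trans (contracted-≡ e∈ x) (contract-half₂ βw βu))

    -- Arcs in `S` stay in their block and disappear; arcs in `T` survive. Leaving the balanced
    -- blocks would create a half edge of Υ′ reachable from `i`, which `¬near` forbids.
    contractWalk : ∀ {u w i} (W : Walk Υ u w) → All TS (walkEdges Υ W) → β u ≡ just i → ¬ FigureNear Υ′ (_∈ T) i →
      Σ (Fin b) λ j → β w ≡ just j × Σ (Walk Υ′ i j) λ W′ → All (_∈ T) (walkEdges Υ′ W′) ×
        walkSign Υ′ W′ ≡ ζ u · (walkSign Υ W · ζ w)
    contractWalk {u} [] [] βu ¬near = _ , βu , [] , [] , ≡.sym (·-square (ζ u))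
    contractWalk {u} {w} (_∷_ {v = v} a W) (e∈ ∷ W⊆) βu ¬near with x∈p∪q⁻ T S e∈
    ... | inj₂ e∈S with contractWalk W W⊆ (block-closed βu (a ∷ [] , e∈S ∷ [])) ¬near
    ...   | j , βw , W′ , W′⊆ , s = j , βw , W′ , W′⊆ , ≡.trans s
            (≡.trans (regroup (ζ u) (ζ v) (walkSign Υ W) (ζ w))
              (≡.cong (λ t → ζ u · ((t · walkSign Υ W) · ζ w)) (≡.sym (block-arcSign a e∈S βu))))
      where
      regroup : ∀ a p s q → p · (s · q) ≡ a · (((a · p) · s) · q)
      regroup a p s q rewrite ·-assoc (a · p) s q | ·-assoc a p (s · q) = ≡.sym (·-cancelˡ a _)
    contractWalk {u} {w} (_∷_ {v = v} a W) (e∈ ∷ W⊆) βu ¬near | inj₁ e∈T with just-or-nothing (β v)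
    ... | inj₂ βv = ⊥-elim (¬near (escaping-near a e∈T βu βv))
    ... | inj₁ (k , βv) with contractArc a e∈T βu βv
    ...   | a′ , a′≡ , s with contractWalk W W⊆ βv (λ near → ¬near (figureNear-trans Υ′ near
              (conn-sym Υ′ (a′ ∷ [] , ≡.subst (_∈ T) (≡.sym a′≡) e∈T ∷ []))))
    ...     | j , βw , W′ , W′⊆ , s′ = j , βw , a′ ∷ W′ , ≡.subst (_∈ T) (≡.sym a′≡) e∈T ∷ W′⊆ ,
              ≡.trans (≡.cong₂ _·_ (≡.trans (≡.cong (σ Υ′) a′≡) s) s′)
                (regroup (ζ u) (σ Υ (arcEdge Υ a)) (ζ v) (walkSign Υ W) (ζ w))
      where
      regroup : ∀ a s p t q → (a · (s · p)) · (p · (t · q)) ≡ a · ((s · t) · q)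
      regroup a s p t q rewrite ·-assoc a (s · p) (p · (t · q)) | ·-assoc s p (p · (t · q)) | ·-cancelˡ p (t · q)
        | ·-assoc s t q = ≡.refl

    near-lift : ∀ {i v} → β v ≡ just i → FigureNear Υ′ (_∈ T) i → ¬ ¬ FigureNear Υ TS v
    near-lift {i} {v} βv (x , circ C _ s , C⊆ , xi) k with onto x
    ... | u , βu with liftWalk C C⊆ βu βu
    ...   | W , W⊆ , sW = k (figureNear-trans Υ
            (closedNegative⇒near Υ W W⊆ (≡.trans sW (≡.trans (conjugate-sign (ζ u) _) s)))
            (lift-conn xi βu βv))
    near-lift {i} {v} βv (x , halfE (e , t , h) , e∈ ∷ [] , xi) k
      with contract-half⁻ (≡.trans (≡.sym (contracted e e∈)) h)
    ... | u , βu , inj₁ (s , y) = k (u , halfE (e , s , y) , T⊆TS e∈ ∷ [] , lift-conn xi βu βv)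
    -- The half edge came from an edge into an unbalanced component of `S`; the negative figure of
    -- `S` there, reached through this edge, takes its place.
    ... | u , βu , inj₂ (w , βw , a , ≡.refl) = unbalanced⇒near Υ S (unbal w βw) λ near →
            k (figureNear-trans Υ (figureNear-mono Υ S⊆TS near)
              (conn-trans Υ (a ∷ [] , T⊆TS e∈ ∷ []) (lift-conn xi βu βv)))

    -- Assuming no negative figure in Υ′ keeps the walk to `F`, and `F` itself, within balanced
    -- blocks, so both can be contracted; the result is the figure that was excluded.
    near-contract : ∀ {i v} → β v ≡ just i → FigureNear Υ TS v → ¬ ¬ FigureNear Υ′ (_∈ T) i
    near-contract {i} {v} βv (x , F , F⊆ , xv) ¬near
      with contractWalk (proj₁ (conn-sym Υ xv)) (proj₂ (conn-sym Υ xv)) βv ¬near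
    ... | j , βx , W′ , W′⊆ , _ = at-figure F F⊆
      where
      ¬near-j : ¬ FigureNear Υ′ (_∈ T) j
      ¬near-j near = ¬near (figureNear-trans Υ′ near (conn-sym Υ′ (W′ , W′⊆)))
      at-figure : (F : Figure Υ x) → All TS (figEdges Υ F) → ⊥
      at-figure (circ C _ s) C⊆ with contractWalk C C⊆ βx ¬near-j
      ... | j′ , βx′ , C′ , C′⊆ , s′ with block-unique βx βx′
      ...   | ≡.refl = ¬near-j (closedNegative⇒near Υ′ C′ C′⊆ (≡.trans s′ (≡.trans (conjugate-sign (ζ x) _) s)))
      at-figure (halfE (e , t , h)) (e∈ ∷ []) with x∈p∪q⁻ T S e∈
      ... | inj₁ e∈T = ¬near-j (half-near e∈T (≡.trans (contracted-≡ e∈T h) (contract-half βx)))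
      ... | inj₂ e∈S = balanced⇒¬near Υ S (bal x j βx) (x , halfE (e , t , h) , e∈S ∷ [] , [] , [])

    module _ {b′ b″ : ℕ} (blocks′ : BalancedBlocks Υ′ T b′) (blocks″ : BalancedBlocks Υ (T ∪ S) b″) where
      private
        module B′ = BalancedBlocks blocks′
        module B″ = BalancedBlocks blocks″

      -- A common representative `v` ties the two kinds of blocks together. The relation is total
      -- and injective in both directions, which suffices for counting and avoids showing that a map
      -- does not depend on representatives.
      record Matching (i : Fin b′) (j : Fin b″) : Set where
        constructor matching
        field
          {k} : Fin b
          {v} : Fin n
          βv  : β v ≡ just k
          β′k : B′.β k ≡ just i
          β″v : B″.β v ≡ just j

      -- The labellings decide which vertices are balanced, so a doubly negated negative figure is
      -- enough to refute the `nothing` case.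
      matchˡ : ∀ i → Σ (Fin b″) (Matching i)
      matchˡ i with B′.onto i
      ... | k , β′k with onto k
      ...   | v , βv with just-or-nothing (B″.β v)
      ...     | inj₁ (j , β″v) = j , matching βv β′k β″v
      ...     | inj₂ β″v = ⊥-elim (unbalanced⇒near Υ (T ∪ S) (B″.unbal v β″v) λ near →
                  near-contract βv near (balanced⇒¬near Υ′ T (B′.bal k i β′k)))

      matchʳ : ∀ j → Σ (Fin b′) λ i → Matching i j
      matchʳ j with B″.onto j
      ... | v , β″v with just-or-nothing (β v)
      ...   | inj₂ βv = ⊥-elim (unbalanced⇒near Υ S (unbal v βv) λ near →
                balanced⇒¬near Υ (T ∪ S) (B″.bal v j β″v) (figureNear-mono Υ S⊆TS near))
      ...   | inj₁ (k , βv) with just-or-nothing (B′.β k)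
      ...     | inj₁ (i , β′k) = i , matching βv β′k β″v
      ...     | inj₂ β′k = ⊥-elim (unbalanced⇒near Υ′ T (B′.unbal k β′k) λ near →
                  near-lift βv near (balanced⇒¬near Υ (T ∪ S) (B″.bal v j β″v)))

      match-injectiveˡ : ∀ {i₁ i₂ j} → Matching i₁ j → Matching i₂ j → i₁ ≡ i₂
      match-injectiveˡ {i₁} {i₂} {j} (matching {k₁} {v₁} βv₁ β′k₁ β″v₁) (matching {k₂} {v₂} βv₂ β′k₂ β″v₂)
        with proj₁ (B″.sameBlock v₁ v₂ j j β″v₁ β″v₂) ≡.refl
      ... | W , W⊆ with contractWalk W W⊆ βv₁ (balanced⇒¬near Υ′ T (B′.bal k₁ i₁ β′k₁))
      ...   | k , βv₂′ , W′ , W′⊆ , _ with block-unique βv₂ βv₂′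
      ...     | ≡.refl = proj₂ (B′.sameBlock k₁ k₂ i₁ i₂ β′k₁ β′k₂) (W′ , W′⊆)

      match-injectiveʳ : ∀ {i j₁ j₂} → Matching i j₁ → Matching i j₂ → j₁ ≡ j₂
      match-injectiveʳ {i} {j₁} {j₂} (matching {k₁} {v₁} βv₁ β′k₁ β″v₁) (matching {k₂} {v₂} βv₂ β′k₂ β″v₂) =
        proj₂ (B″.sameBlock v₁ v₂ j₁ j₂ β″v₁ β″v₂)
          (lift-conn (proj₁ (B′.sameBlock k₁ k₂ i i β′k₁ β′k₂) ≡.refl) βv₁ βv₂)

      contraction-blockCount : b′ ≡ b″
      contraction-blockCount = ℕₚ.≤-antisym
        (Finₚ.injective⇒≤ {f = proj₁ ∘ matchˡ} λ {i₁} {i₂} p →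
          match-injectiveˡ (proj₂ (matchˡ i₁)) (≡.subst (Matching i₂) (≡.sym p) (proj₂ (matchˡ i₂))))
        (Finₚ.injective⇒≤ {f = proj₁ ∘ matchʳ} λ {j₁} {j₂} p →
          match-injectiveʳ (proj₂ (matchʳ j₁)) (≡.subst (λ i → Matching i j₂) (≡.sym p) (proj₂ (matchʳ j₂))))

  singletonBlocks : ∀ {n m} (Υ : GSG n m) → BalancedBlocks Υ ∅ n
  singletonBlocks Υ = record
    { β = just
    ; unbal = λ _ ()
    ; bal = λ v _ _ → (λ { _ [] c _ _ _ → IsCircle.nonempty c ≡.refl ; _ (_ ∷ _) _ _ (e∈ ∷ _) _ → ∉⊥ e∈ })
                    , (λ _ _ e∈ _ → ∉⊥ e∈)
    ; sameBlock = λ { u v .u .v ≡.refl ≡.refl → (λ { ≡.refl → [] , [] })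
                                    , (λ { ([] , _) → ≡.refl ; (_ ∷ _ , e∈ ∷ _) → ⊥-elim (∉⊥ e∈) }) }
    ; onto = λ i → i , ≡.refl }

  -- The graph Υ itself plays the contraction of Υ by the empty set.
  blockCount-unique : ∀ {n m} (Υ : GSG n m) (A : Subset m) {T : Subset m} {b′ b″ : ℕ} →
    BalancedBlocks (record Υ { edgeSet = A }) T b′ → BalancedBlocks Υ T b″ → b′ ≡ b″
  blockCount-unique Υ A {T} B′ B″ = Contracted.contraction-blockCount Υ ∅ (record Υ { edgeSet = A }) T
    (singletonBlocks Υ) (λ _ → pos) (λ e _ _ _ _ _ e∈ → ⊥-elim (∉⊥ e∈))
    (λ e _ → same-edge (edge Υ e)) B′ (≡.subst (λ X → BalancedBlocks Υ X _) (≡.sym (∪-identityʳ T)) B″)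
    where
    same-edge : ∀ E → E ≡ contractEdge just (signSwitchEdge (λ _ → pos) E)
    same-edge (ends v w t₁ t₂) = ≡.refl
    same-edge (half v t) = ≡.refl
    same-edge loose = ≡.refl

-- Hyperbalance under contraction

module Contraction {c ℓ} (K : Field c ℓ)
  (2≉0 : ¬ (Field._≈_ K (Field._+_ K (Field.1# K) (Field.1# K)) (Field.0# K))) where
  open Field K
  open GainSigned K
  open Walks K
  open Gains K 2≉0
  open Potentials K 2≉0
  open Blocks K
  open Algebra.Properties.Ring ring using (-0#≈0#)
  open IntegerSolver commutativeRing

  module Difference {n m} (Υ : GSG n m) (S : Subset m) (θ₁ θ₂ : Fin n → Carrier)
    (N₁ : Neutralizes Υ θ₁ (_∈ S)) (N₂ : Neutralizes Υ θ₂ (_∈ S)) where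

    d : Fin n → Carrier
    d v = θ₂ v - θ₁ v

    -- Both switchers satisfy the same affine relation between the ends of `W`; the gain of `W` is
    -- its constant term and drops out of the difference.
    d-walk : ∀ {u w} (W : Walk Υ u w) → All (_∈ S) (walkEdges Υ W) → d u ≈ walkSign Υ W ⊙ d w
    d-walk {u} {w} W W⊆ = lemma (walkSign Υ W) (partialGain Υ (gain Υ) W) (θ₁ u) (θ₁ w) (θ₂ u) (θ₂ w)
        (balance θ₁ N₁) (balance θ₂ N₂)
      where
      balance : ∀ θ → Neutralizes Υ θ (_∈ S) → (partialGain Υ (gain Υ) W + θ u) - (walkSign Υ W ⊙ θ w) ≈ 0#
      balance θ N = trans (sym (partialGain-switch Υ θ W)) (partialGain-zero Υ (switchedGain Υ θ) W (All.map (N _) W⊆))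
      lemma : ∀ s G a b a′ b′ → (G + a) - (s ⊙ b) ≈ 0# → (G + a′) - (s ⊙ b′) ≈ 0# → (a′ - a) ≈ s ⊙ (b′ - b)
      lemma s G a b a′ b′ p q = trans
        (solve 5 (λ G a y a′ y′ → a′ :- a := (((G :+ a′) :- y′) :- ((G :+ a) :- y)) :+ (y′ :- y)) refl G a (s ⊙ b) a′ (s ⊙ b′))
        (trans (+-congʳ (+-zeroes q (trans (-‿cong p) -0#≈0#)))
          (trans (+-identityˡ _) (trans (+-congˡ (sym (⊙-neg s b))) (sym (⊙-+ s b′ (- b))))))

    -- A negative figure determines `θ x + θ x` at its base, so twice the difference vanishes there;
    -- `d-walk` carries this to `v`.
    d-near : ∀ {v} → FigureNear Υ (_∈ S) v → d v ≈ 0#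
    d-near (x , F , F⊆ , W , W⊆) = ⊙-cancel (walkSign Υ W) (trans (sym (d-walk W W⊆)) (double-cancel
        (trans (solve 3 (λ k a a′ → (a′ :- a) :+ (a′ :- a) := (k :+ (a′ :+ a′)) :- (k :+ (a :+ a))) refl (figureConst Υ (gain Υ) F) (θ₁ x) (θ₂ x))
          (+-zeroes (fixed θ₂ N₂) (trans (-‿cong (fixed θ₁ N₁)) -0#≈0#)))))
      where
      fixed : ∀ θ → Neutralizes Υ θ (_∈ S) → figureConst Υ (gain Υ) F + (θ x + θ x) ≈ 0#
      fixed θ N = trans (sym (figureConst-switch Υ θ F)) (figureConst-zero Υ (switchedGain Υ θ) F (All.map (N _) F⊆))

  module HyperbalancedContraction {n m b : ℕ} (Υ : GSG n m) (S : Subset m) (Υ′ : GSG b m) (T : Subset m)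
    (blocks : BalancedBlocks Υ S b) (ζ : Fin n → Sign)
    (positive : ∀ e v w t₁ t₂ i → e ∈ S → edge Υ e ≡ ends v w t₁ t₂ → BalancedBlocks.β blocks v ≡ just i →
      opp ((ζ v · t₁) · (ζ w · t₂)) ≡ pos)
    (contracted : ∀ e → e ∈ T → edge Υ′ e ≡ contractEdge (BalancedBlocks.β blocks) (signSwitchEdge ζ (edge Υ e)))
    (θ : Fin n → Carrier) (θ-neutral : Neutralizes Υ θ (_∈ S))
    (gains : ∀ e → e ∈ T → gain Υ′ e ≈ switchedGain Υ θ e) where

    open BalancedBlocks blocks
    open Contracted Υ S Υ′ T blocks ζ positive contracted

    module _ (θ′ : Fin b → Carrier) where
      -- Outside the blocks the value is `0#`: such vertices have no image in Υ/S, and `θ` is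
      -- already forced there.
      pullback : Fin n → Carrier
      pullback v = maybe′ (λ i → ζ v ⊙ θ′ i) 0# (β v)

      -- An end lost in the contraction sits where `pullback` is `0#`, so dropping it does not
      -- change the switched gain; a surviving end carries the factor `ζ v` either in its
      -- orientation or in `pullback`.
      switch-contractEdge : ∀ E x → gainSwitchGain θ′ (contractEdge β (signSwitchEdge ζ E)) x ≈ gainSwitchGain pullback E x
      switch-contractEdge (ends v w t₁ t₂) x with β v | β w
      ... | just i | just j = +-cong (+-congʳ (twist v t₁ i)) (twist w t₂ j)
        where
        twist : ∀ v t i → (ζ v · t) ⊙ θ′ i ≈ t ⊙ (ζ v ⊙ θ′ i)
        twist v t i = trans (⊙-≡ (·-comm (ζ v) t) _) (·-⊙ t (ζ v) _)
      ... | just i | nothing = trans (+-congʳ (trans (⊙-≡ (·-comm (ζ v) t₁) _) (·-⊙ t₁ (ζ v) _)))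
              (sym (trans (+-congˡ (⊙-0 t₂)) (+-identityʳ _)))
      ... | nothing | just j = trans (+-comm _ _) (+-cong (sym (trans (+-congʳ (⊙-0 t₁)) (+-identityˡ x)))
              (trans (⊙-≡ (·-comm (ζ w) t₂) _) (·-⊙ t₂ (ζ w) _)))
      ... | nothing | nothing = sym (trans (+-cong (trans (+-congʳ (⊙-0 t₁)) (+-identityˡ x)) (⊙-0 t₂)) (+-identityʳ x))
      switch-contractEdge (half v t) x with β v
      ... | just i = +-congʳ (trans (⊙-≡ (·-comm (ζ v) t) _) (·-⊙ t (ζ v) _))
      ... | nothing = sym (trans (+-congʳ (⊙-0 t)) (+-identityˡ x))
      switch-contractEdge loose x = refl

      combined : Fin n → Carrier
      combined v = θ v + pullback v

      switchedGain-combined : ∀ e → switchedGain Υ combined e ≈ switchedGain Υ θ e + gainSwitchGain pullback (edge Υ e) 0#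
      switchedGain-combined e = trans (gainSwitchGain-cong (edge Υ e) (λ _ → refl) (sym (+-identityʳ _)))
        (gainSwitchGain-+ θ pullback (edge Υ e) (gain Υ e) 0#)

      -- Υ′ keeps the gains already switched by `θ`, so a further switch by `θ′` amounts to adding
      -- its pullback to `θ`. Through this identity switchers of Υ′ and Υ determine each other.
      switchedGain-contracted : ∀ e → e ∈ T → switchedGain Υ′ θ′ e ≈ switchedGain Υ combined e
      switchedGain-contracted e e∈ = trans (reflexive (≡.cong (λ E → gainSwitchGain θ′ E (gain Υ′ e)) (contracted e e∈)))
        (trans (switch-contractEdge (edge Υ e) (gain Υ′ e))
          (trans (gainSwitchGain-cong (edge Υ e) (λ v → sym (+-identityˡ (pullback v)))
              (trans (gains e e∈) (sym (+-identityʳ _))))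
            (trans (gainSwitchGain-+ (λ _ → 0#) pullback (edge Υ e) _ 0#)
              (trans (+-congʳ (gainSwitchGain-zero (edge Υ e) _)) (sym (switchedGain-combined e))))))

      -- A link or loop of `S` lies within one block or outside all of them. Within a block it is
      -- positive after switching by `ζ`, so its ends contribute opposite values; a half edge of `S`
      -- lies in no block.
      pullback-null : ∀ f → f ∈ S → null Υ pullback f
      pullback-null f f∈ = by-edge (edge Υ f) ≡.refl
        where
        lemma : ∀ t₁ t₂ a b y → opp (t₁ · t₂) ≡ a · b → ((t₁ ⊙ (a ⊙ y)) + 0#) + (t₂ ⊙ (b ⊙ y)) ≈ 0#
        lemma t₁ t₂ a b y p = trans (+-cong (+-identityʳ _) (sym (·-⊙ t₂ b y)))
            (trans (+-cong (sym (·-⊙ t₁ a y)) (⊙-≡ (flip t₁ t₂ a b p) y)) (cancel (t₁ · a) y))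
          where
          flip : ∀ t₁ t₂ a b → opp (t₁ · t₂) ≡ a · b → t₂ · b ≡ opp (t₁ · a)
          flip pos pos pos neg _ = ≡.refl
          flip pos pos neg pos _ = ≡.refl
          flip pos neg pos pos _ = ≡.refl
          flip pos neg neg neg _ = ≡.refl
          flip neg pos pos pos _ = ≡.refl
          flip neg pos neg neg _ = ≡.refl
          flip neg neg pos neg _ = ≡.refl
          flip neg neg neg pos _ = ≡.refl
          cancel : ∀ s y → (s ⊙ y) + (opp s ⊙ y) ≈ 0#
          cancel pos y = -‿inverseʳ y
          cancel neg y = -‿inverseˡ y
        at-block : ∀ {v i} → β v ≡ just i → pullback v ≈ ζ v ⊙ θ′ i
        at-block {v} p = reflexive (≡.cong (maybe′ (λ i → ζ v ⊙ θ′ i) 0#) p)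
        off-block : ∀ {v} → β v ≡ nothing → pullback v ≈ 0#
        off-block {v} p = reflexive (≡.cong (maybe′ (λ i → ζ v ⊙ θ′ i) 0#) p)
        by-edge : ∀ E → edge Υ f ≡ E → gainSwitchGain pullback E 0# ≈ 0#
        by-edge (ends v w t₁ t₂) x with just-or-nothing (β v) | just-or-nothing (β w)
        ... | inj₁ (i , βv) | _ = trans
                (+-cong (+-congʳ (⊙-cong t₁ (at-block βv))) (⊙-cong t₂ (at-block (block-closed βv (fwd f x ∷ [] , f∈ ∷ [])))))
                (lemma t₁ t₂ (ζ v) (ζ w) (θ′ i) (≡.trans (≡.cong edgeSign (≡.sym x)) (block-arcSign (fwd f x) f∈ βv)))
        ... | inj₂ βv | inj₁ (j , βw) with ≡.trans (≡.sym βv) (block-closed βw (bwd f x ∷ [] , f∈ ∷ []))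
        ...   | ()
        by-edge (ends v w t₁ t₂) x | inj₂ βv | inj₂ βw =
          +-zeroes (+-zeroes (trans (⊙-cong t₁ (off-block βv)) (⊙-0 t₁)) refl) (trans (⊙-cong t₂ (off-block βw)) (⊙-0 t₂))
        by-edge (half v t) x with just-or-nothing (β v)
        ... | inj₁ (i , βv) = ⊥-elim (proj₂ (bal v i βv) v (f , t , x) f∈ ([] , []))
        ... | inj₂ βv = +-zeroes (trans (⊙-cong t (off-block βv)) (⊙-0 t)) refl
        by-edge loose x = refl

    contraction-hyperbalanced⁺ : Hyperbalanced Υ′ T → ¬ ¬ Hyperbalanced Υ (T ∪ S)
    contraction-hyperbalanced⁺ H k = hyperbalanced⇒neutralizable Υ′ T H λ (θ′ , N′) →
      k (neutralizable⇒hyperbalanced Υ (combined θ′) (T ∪ S) λ e e∈ → [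
        (λ e∈T → trans (sym (switchedGain-contracted θ′ e e∈T)) (N′ e e∈T)) ,
        (λ e∈S → trans (switchedGain-combined θ′ e) (+-zeroes (θ-neutral e e∈S) (pullback-null θ′ e e∈S))) ]′
        (x∈p∪q⁻ T S e∈))

    contraction-hyperbalanced⁻ : Hyperbalanced Υ (T ∪ S) → ¬ ¬ Hyperbalanced Υ′ T
    contraction-hyperbalanced⁻ H k = hyperbalanced⇒neutralizable Υ (T ∪ S) H λ (θ₂ , N₂) → with-potential θ₂ N₂
      where
      with-potential : ∀ θ₂ → Neutralizes Υ θ₂ (_∈ T ∪ S) → ⊥
      with-potential θ₂ N₂ = ¬¬-choice vanishes λ d≈0 →
          k (neutralizable⇒hyperbalanced Υ′ θ′ T λ e e∈ → trans (switchedGain-contracted θ′ e e∈)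
            (trans (gainSwitchGain-cong (edge Υ e) (combined≈ d≈0) refl) (N₂ e (T⊆TS e∈))))
        where
        open Difference Υ S θ θ₂ θ-neutral (λ e e∈ → N₂ e (S⊆TS e∈))
        vanishes : ∀ v → ¬ ¬ (β v ≡ nothing → d v ≈ 0#)
        vanishes v h with just-or-nothing (β v)
        ... | inj₁ (i , βv) = h λ βv′ → ⊥-elim (absurd (≡.trans (≡.sym βv) βv′))
          where
          absurd : ¬ (just i ≡ nothing)
          absurd ()
        ... | inj₂ βv = unbalanced⇒near Υ S (unbal v βv) λ near → h λ _ → d-near near
        θ′ : Fin b → Carrier
        -- The difference of the two switchers is constant on a block up to the signs `ζ`; the
        -- constant is read off at the representative chosen by `onto`.
        θ′ i = ζ (proj₁ (onto i)) ⊙ d (proj₁ (onto i))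
        combined≈ : (∀ v → β v ≡ nothing → d v ≈ 0#) → ∀ v → combined θ′ v ≈ θ₂ v
        combined≈ d≈0 v = trans (+-congˡ pullback≈) (solve 2 (λ a b → a :+ (b :- a) := b) refl (θ v) (θ₂ v))
          where
          pullback≈ : pullback θ′ v ≈ d v
          pullback≈ with β v in βv
          ... | nothing = sym (d≈0 v βv)
          ... | just i with onto i
          ...   | r , βr with block-conn βv βr
          ...     | W , W⊆ = sym (trans (d-walk W W⊆) (trans (⊙-≡ (block-walkSign W W⊆ βv) _) (·-⊙ (ζ v) (ζ r) _)))

-- Walks are indexed by the whole graph, so circuits of the two graphs have different types although
-- the edges agree. `Neutralizes` mentions only edge data and gains, and the same `θ` serves both.
edgeSet-irrelevant : ∀ {c ℓ} (K : Field c ℓ) → ¬ (Field._≈_ K (Field._+_ K (Field.1# K) (Field.1# K)) (Field.0# K)) →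
  ∀ {n m} (Υ : GainSigned.GSG K n m) (A T : Subset m) →
  GainSigned.Hyperbalanced K Υ T → ¬ ¬ GainSigned.Hyperbalanced K (record Υ { edgeSet = A }) T
edgeSet-irrelevant K 2≉0 Υ A T H k = hyperbalanced⇒neutralizable Υ T H λ (θ , N) →
  k (neutralizable⇒hyperbalanced (record Υ { edgeSet = A }) θ T N)
  where
  open Gains K 2≉0
  open Potentials K 2≉0

-- The rank formula

open import Data.Nat using (_+_)

-- Here `x` is δ of `T` in Υ/S and `y` is δ of `S`, with `x + y` as δ of `T ∪ S`. The number `b`
-- counts the blocks of `S` and also the vertices of Υ/S, and it cancels.
rank-additive : ∀ {n b b′} x y {r rS rTS} → r + b′ ≡ x + b → rS + b ≡ y + n → rTS + b′ ≡ x + (y + n) → r + rS ≡ rTS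
rank-additive {n} {b} {b′} x y {r} {rS} {rTS} p q s = ℕₚ.+-cancelʳ-≡ b′ (r + rS) rTS (begin
  (r + rS) + b′  ≡⟨ xy∙z≈y∙xz r rS b′ ⟩
  rS + (r + b′)  ≡⟨ ≡.cong (λ k → rS + k) p ⟩
  rS + (x + b)   ≡⟨ x∙yz≈y∙xz rS x b ⟩
  x + (rS + b)   ≡⟨ ≡.cong (λ k → x + k) q ⟩
  x + (y + n)    ≡⟨ s ⟨
  rTS + b′       ∎)
  where
  open ≡.≡-Reasoning
  open Algebra.Properties.CommutativeSemigroup ℕₚ.+-commutativeSemigroup using (xy∙z≈y∙xz; x∙yz≈y∙xz)

theorem9p6 : ∀ {c ℓ : Level} (K : Field c ℓ) →
    ¬ (Field._≈_ K (Field._+_ K (Field.1# K) (Field.1# K)) (Field.0# K)) →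
    ∀ {n m : ℕ} (Υ : GainSigned.GSG K n m) (S : Subset m) →
    S ⊆ GainSigned.GSG.edgeSet Υ →
    (∀ (T : Subset m) → T ⊆ GainSigned.GSG.edgeSet (GainSigned._∖ᵍ_ K Υ S) →
    ∀ (r r′ : ℕ) →
    GainSigned.HasRank K (GainSigned._∖ᵍ_ K Υ S) T r →
    GainSigned.HasRank K Υ T r′ → r ≡ r′)
    ×
    (∀ (b : ℕ) (Υ′ : GainSigned.GSG K b m) →
    GainSigned.IsContraction K Υ S Υ′ →
    ∀ (T : Subset m) → T ⊆ GainSigned.GSG.edgeSet Υ′ →
    ∀ (r rS rTS : ℕ) →
    GainSigned.HasRank K Υ′ T r →
    GainSigned.HasRank K Υ S rS →
    GainSigned.HasRank K Υ (T ∪ S) rTS →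
    r + rS ≡ rTS)
theorem9p6 K 2≉0 {n} {m} Υ S _ = deletion , λ b Υ′ C T T⊆ r rS rTS → contraction Υ′ C T T⊆
  where
  open Field K using (_≈_; 0#; trans)
  open GainSigned K
  open Gains K 2≉0
  open Blocks K
  open Contraction K 2≉0

  deletion : ∀ T → T ⊆ edgeSet (Υ ∖ᵍ S) → ∀ r r′ → HasRank (Υ ∖ᵍ S) T r → HasRank Υ T r′ → r ≡ r′
  deletion T _ r r′ (b , B , δ) (b′ , B′ , δ′) with blockCount-unique Υ (edgeSet (Υ ∖ᵍ S)) B B′ | δ | δ′
  ... | ≡.refl | inj₁ (_ , p) | inj₁ (_ , q) = ℕₚ.+-cancelʳ-≡ b r r′ (≡.trans p (≡.sym q))
  ... | ≡.refl | inj₂ (_ , p) | inj₂ (_ , q) = ℕₚ.+-cancelʳ-≡ b r r′ (≡.trans p (≡.sym q))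
  ... | ≡.refl | inj₁ (H , _) | inj₂ (¬H , _) = ⊥-elim (edgeSet-irrelevant K 2≉0 (Υ ∖ᵍ S) (edgeSet Υ) T H ¬H)
  ... | ≡.refl | inj₂ (¬H , _) | inj₁ (H , _) = ⊥-elim (edgeSet-irrelevant K 2≉0 Υ (edgeSet (Υ ∖ᵍ S)) T H ¬H)

  module _ {b} (Υ′ : GSG b m) (C : IsContraction Υ S Υ′) (T : Subset m) (T⊆ : T ⊆ edgeSet Υ′) where
    open IsContraction C

    positive : ∀ e v w t₁ t₂ i → e ∈ S → edge Υ e ≡ ends v w t₁ t₂ → BalancedBlocks.β blocks v ≡ just i →
      opp ((ζ v · t₁) · (ζ w · t₂)) ≡ pos
    positive e v w t₁ t₂ i e∈ x βv = ≡.trans (≡.cong (edgeSign ∘ signSwitchEdge ζ) (≡.sym x))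
      (balPositive e v w t₁ t₂ i e∈ x βv)

    contracted : ∀ e → e ∈ T → edge Υ′ e ≡ contractEdge (BalancedBlocks.β blocks) (signSwitchEdge ζ (edge Υ e))
    contracted e e∈ = edge' e (T⊆ e∈)

    contraction : ∀ {r rS rTS} → HasRank Υ′ T r → HasRank Υ S rS → HasRank Υ (T ∪ S) rTS → r + rS ≡ rTS
    contraction {r} {rS} {rTS} (b′ , B′ , δ′) (_ , Bₛ , δₛ) (_ , Bₜₛ , δₜₛ)
      -- The blocks of `S` are labelled twice, once by the contraction and once by the rank of `S`;
      -- the two counts must be identified first.
      with blockCount-unique Υ (edgeSet Υ) blocks Bₛ
         | Contracted.contraction-blockCount Υ S Υ′ T blocks ζ positive contracted B′ Bₜₛ
    ... | ≡.refl | ≡.refl = by-balance gains' δ′ δₛ δₜₛ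
      where
      by-balance : _ → (Hyperbalanced Υ′ T × r + b′ ≡ b) ⊎ (¬ Hyperbalanced Υ′ T × r + b′ ≡ suc b) →
        (Hyperbalanced Υ S × rS + b ≡ n) ⊎ (¬ Hyperbalanced Υ S × rS + b ≡ suc n) →
        (Hyperbalanced Υ (T ∪ S) × rTS + b′ ≡ n) ⊎ (¬ Hyperbalanced Υ (T ∪ S) × rTS + b′ ≡ suc n) →
        r + rS ≡ rTS
      by-balance (inj₁ (H , _ , _)) _ (inj₂ (¬H , _)) _ = ⊥-elim (¬H H)
      by-balance (inj₂ (¬H , _)) _ (inj₁ (H , _)) _ = ⊥-elim (¬H H)
      -- A hyperfrustrated `S` leaves only zero gains in Υ′, so the zero switcher shows `T` to be
      -- hyperbalanced there.
      by-balance (inj₂ (_ , zero-gains)) (inj₂ (¬H , _)) _ _ = ⊥-elim (¬H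
        (neutralizable⇒hyperbalanced Υ′ (λ _ → 0#) T λ e e∈ → trans (gainSwitchGain-zero (edge Υ′ e) _) (zero-gains e (T⊆ e∈))))
      by-balance (inj₂ (¬H , _)) _ _ (inj₁ (H , _)) = ⊥-elim (¬H λ C C⊆ → H C (All.map (q⊆p∪q T S) C⊆))
      by-balance (inj₂ _) (inj₁ (_ , p)) (inj₂ (_ , q)) (inj₂ (_ , s)) = rank-additive 0 1 p q s
      by-balance (inj₁ (_ , θ-neutral , same-gains)) δ′ (inj₁ (_ , q)) δₜₛ = compare δ′ δₜₛ
        where
        open HyperbalancedContraction Υ S Υ′ T blocks ζ positive contracted θ θ-neutral (λ e e∈ → same-gains e (T⊆ e∈))
        compare : (Hyperbalanced Υ′ T × r + b′ ≡ b) ⊎ (¬ Hyperbalanced Υ′ T × r + b′ ≡ suc b) →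
          (Hyperbalanced Υ (T ∪ S) × rTS + b′ ≡ n) ⊎ (¬ Hyperbalanced Υ (T ∪ S) × rTS + b′ ≡ suc n) →
          r + rS ≡ rTS
        compare (inj₁ (_ , p)) (inj₁ (_ , s)) = rank-additive 0 0 p q s
        compare (inj₂ (_ , p)) (inj₂ (_ , s)) = rank-additive 1 0 p q s
        compare (inj₁ (H , _)) (inj₂ (¬H , _)) = ⊥-elim (contraction-hyperbalanced⁺ H ¬H)
        compare (inj₂ (¬H , _)) (inj₁ (H , _)) = ⊥-elim (contraction-hyperbalanced⁻ H ¬H)
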